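{- Let $k\geq 2$. Let $\Phi(\bar x,\bar z)$ and $\Psi(\bar y,\bar z)$ be CNF formulas whose only common variables are $\bar z=(z_1,\dots,z_n)$, where the variables $\bar z$ occur in $\Phi$ only positively and in $\Psi$ only negatively. Given a $\Pi^s_k$-Symmetric Calculus refutation $D$ of $\Phi(\bar x,\bar z)\wedge\Psi(\bar y,\bar z)$, one can construct in polynomial time (in particular of size polynomial in the size of $D$) a depth-$(k-1)$ game schema $S(\bar z)$ such that for every assignment $\bar a\in\{0,1\}^n$ to $\bar z$: if $\Phi(\bar x,\bar a)$ is satisfiable then Player I has a positional winning strategy in $S(\bar a)$, and if $\Psi(\bar y,\bar a)$ is satisfiable then Player II has a positional winning strategy in $S(\bar a)$.
   Context: A game of depth $k$ consists of a length $n'$, a finite alphabet $A$ with a distinguished symbol $\Lambda\in A$, transition functions $\overrightarrow{T},\overleftarrow{T}:\{0,1\}\times A\times A\to A$, and a set $W\subseteq A$. A play takes place on a tape of $n'$ squares initially containing $\Lambda$, in $k$ rounds, alternately left-to-right and right-to-left, the first going left-to-right from square 1. In a left-to-right round a move from square $i$ to $i+1$, with $b$ the symbol just written in square $i$ (initially $\Lambda$) and $c$ the current content of square $i+1$, writes $\overrightarrow{T}(h,b,c)$ into square $i+1$ for $h\in\{0,1\}$ chosen by the mover; in a right-to-left round a move from square $i+1$ to $i$, with $c$ just written in square $i+1$ and $b$ the content of square $i$, writes $\overleftarrow{T}(h,b,c)$ into square $i$. The move from square $j$ is made by Player I if $j$ is odd, by Player II if $j$ is even. At the last (resp. first) square the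 next round starts in the opposite direction without rewriting it. After $k$ rounds Player I wins iff the last written symbol is in $W$. A positional strategy for Player I (resp. II) is a family of functions $\sigma_{r,j}:A\times A\to A$, $r\in[k]$, $j$ odd (resp. even), with legal values, the player in round $r$ moving from square $j$ writing the value of $\sigma_{r,j}$ on the two symbols determining the move; it is winning if the player wins every play consistent with it. A depth-$k$ game schema $S(\bar z)$ over variables $z_1,\dots,z_n$ is a depth-$k$ game without the set $W$, together with a labelling of the symbols of $A$ (end positions) by $0$, $1$ or variables $z_i$; for an assignment $\bar a$, $S(\bar a)$ is the game whose winning symbols for Player I are those labelled $1$ or labelled by some $z_i$ with $a_i=1$ (the others being winning for Player II). The $\Pi^s_m$-Symmetric Calculus: a stratified $\Pi^s_m$ formula is a tree of $\wedge,\vee$ nodes of arbitrary arity $\ge1$, all root-to-leaf branches having exactly $m$ edges, connectives alternating regularly starting with $\wedge$ at the root, leaves literals or $\bot,\top$; a refutation of a CNF is a sequence of $\Pi^s_m$ formulas starting with the CNF padded by unary connectives to $\Pi^s_m$ and ending with $\bot$ padded to $\Pi^s_m$, each obtained from the previous by applying to a legal subformula (whole subtree) one of the rules: permutation of terms; contraction of two equal consecutive terms of a disjunction; deletion of $\bot$ from a disjunction of $\ge2$ terms; inserting a formula into a disjunction; dual resolution (a term $A_1\wedge\dots\wedge A_i\wedge\top\wedge A_{i+1}\wedge\dots\wedge A_n$ of a disjunction becomes $(A_1\wedge\dots\wedge A_i\wedge p)\vee(A_{i+1}\wedge\dots\wedge A_n\wedge\neg p)$); and the dual rules on conjunctions (cloning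 a term, inserting $\top$, deleting a term, resolution turning $(A_1\vee\dots\vee A_i\vee p)\wedge(A_{i+1}\vee\dots\vee A_n\vee\neg p)$ into $A_1\vee\dots\vee A_i\vee\bot\vee A_{i+1}\vee\dots\vee A_n$), stratification being preserved. -}

module Defs where

open import Data.Bool.Base using (Bool; true; false; not; T)
open import Data.Empty using (⊥)
open import Data.Fin.Base as Fin using (Fin; toℕ; inject₁)
open import Data.List.Base as List using (List; []; _∷_; _++_; map; concatMap; reverse; allFin)
open import Data.List.NonEmpty.Base as List⁺ using (List⁺; _∷_; [_]; toList; _++⁺_; _∷ʳ_)
open import Data.List.Relation.Binary.Permutation.Propositional using (_↭_)
open import Data.List.Relation.Unary.All using (All)
open import Data.List.Relation.Unary.Any using (Any)
open import Data.List.Relation.Unary.Linked using (Linked)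
open import Data.Maybe.Base using (just)
open import Data.Nat.Base using (ℕ; zero; suc; _+_; _≤_; z≤n; s≤s)
open import Data.Nat.Binary.Base as Bin using (ℕᵇ)
open import Data.Product.Base using (Σ-syntax; ∃-syntax; _×_; _,_; proj₁; proj₂)
open import Data.Sum.Base using (_⊎_; inj₁; inj₂)
open import Data.Unit.Base using (⊤; tt)
open import Data.Vec.Base as Vec using (Vec; lookup; replicate; _[_]≔_)
open import Relation.Binary.PropositionalEquality.Core using (_≡_; _≢_)

------------------------------------------------------------------------
-- CNF formulas

data Literal (V : Set) : Set where
  pos neg : V → Literal V

CNF : Set → Set
CNF V = List (List (Literal V))

evalLiteral : ∀ {V} → (V → Bool) → Literal V → Bool
evalLiteral α (pos v) = α v
evalLiteral α (neg v) = not (α v)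

infix 4 _⊨_

_⊨_ : ∀ {V} → (V → Bool) → CNF V → Set
α ⊨ Φ = All (Any (λ l → T (evalLiteral α l))) Φ

-- In V ⊎ Fin n the right summand holds the common variables z₁, …, zₙ.

Satisfiable : ∀ {V n} → CNF (V ⊎ Fin n) → (Fin n → Bool) → Set
Satisfiable {V} Φ a = Σ[ β ∈ (V → Bool) ] (λ { (inj₁ v) → β v ; (inj₂ i) → a i }) ⊨ Φ

ZPositive ZNegative : ∀ {V n} → CNF (V ⊎ Fin n) → Set
ZPositive Φ = All (All (λ l → ∀ i → l ≢ neg (inj₂ i))) Φ
ZNegative Ψ = All (All (λ l → ∀ i → l ≢ pos (inj₂ i))) Ψ

data Var (p q n : ℕ) : Set where
  xvar : Fin p → Var p q n
  yvar : Fin q → Var p q n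
  zvar : Fin n → Var p q n

mapLiteral : ∀ {V W} → (V → W) → Literal V → Literal W
mapLiteral f (pos v) = pos (f v)
mapLiteral f (neg v) = neg (f v)

renameCNF : ∀ {V W} → (V → W) → CNF V → CNF W
renameCNF f = map (map (mapLiteral f))

viaXZ : ∀ {p q n} → CNF (Fin p ⊎ Fin n) → CNF (Var p q n)
viaXZ = renameCNF (λ { (inj₁ i) → xvar i ; (inj₂ i) → zvar i })

viaYZ : ∀ {p q n} → CNF (Fin q ⊎ Fin n) → CNF (Var p q n)
viaYZ = renameCNF (λ { (inj₁ i) → yvar i ; (inj₂ i) → zvar i })

infixr 6 _∧ᶜ_

_∧ᶜ_ : ∀ {p q n} → CNF (Fin p ⊎ Fin n) → CNF (Fin q ⊎ Fin n) → CNF (Var p q n)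
Φ ∧ᶜ Ψ = viaXZ Φ ++ viaYZ Ψ

------------------------------------------------------------------------
-- Stratified formulas

data Leaf (V : Set) : Set where
  lit      : Literal V → Leaf V
  `⊤ `⊥ : Leaf V

data Connective : Set where
  ∧ ∨ : Connective

dual : Connective → Connective
dual ∧ = ∨
dual ∨ = ∧

-- Formula V c m: all branches have m edges, and the root (if m > 0) is
-- labelled c.

data Formula (V : Set) : Connective → ℕ → Set where
  leaf : ∀ {c} → Leaf V → Formula V c 0
  node : ∀ {c m} → List⁺ (Formula V (dual c) m) → Formula V c (suc m)

Πˢ : ℕ → Set → Set
Πˢ m V = Formula V ∧ m

pad : ∀ {V c} m → Leaf V → Formula V c m
pad zero    l = leaf l
pad (suc m) l = node [ pad m l ]

-- Connectives have arity ≥ 1, so an empty list of terms is replaced by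
-- the given neutral term.

termsOr : ∀ {A : Set} → A → List A → List⁺ A
termsOr d []       = [ d ]
termsOr d (t ∷ ts) = t ∷ ts

-- The unary connectives are placed between each clause and its literals'
-- leaves: the top two levels are the conjunction and the clauses.

paddedCNF : ∀ {V} k → 2 ≤ k → CNF V → Πˢ k V
paddedCNF (suc (suc j)) (s≤s (s≤s z≤n)) Φ = node (termsOr (pad (suc j) `⊤) (map clause Φ))
  where
  clause : List (Literal _) → Formula _ ∨ (suc j)
  clause C = node (termsOr (pad j `⊥) (map (λ l → pad j (lit l)) C))

------------------------------------------------------------------------
-- The Symmetric Calculus

-- The rules act on the list of terms of a disjunction or conjunction.
-- ⊤, ⊥, p, ¬p are padded to the height of the terms they stand among, so
-- that every rule preserves stratification at every level of the tree.

data DisjRule {V : Set} : ∀ {m} → List (Formula V ∧ m) → List (Formula V ∧ m) → Set where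
  permute  : ∀ {m} {φs ψs : List (Formula V ∧ m)} → φs ↭ ψs → DisjRule φs ψs
  contract : ∀ {m} us (φ : Formula V ∧ m) ws →
             DisjRule (us ++ φ ∷ φ ∷ ws) (us ++ φ ∷ ws)
  delete⊥  : ∀ {m} (us ws : List (Formula V ∧ m)) →
             DisjRule (us ++ pad m `⊥ ∷ ws) (us ++ ws)
  insert   : ∀ {m} us (φ : Formula V ∧ m) ws →
             DisjRule (us ++ ws) (us ++ φ ∷ ws)
  dualRes  : ∀ {m} us ws (p : V) (As Bs : List (Formula V ∨ m)) →
             DisjRule (us ++ node (As ++⁺ (pad m `⊤ ∷ Bs)) ∷ ws)
                      (us ++ node (As ∷ʳ pad m (lit (pos p)))
                           ∷ node (Bs ∷ʳ pad m (lit (neg p))) ∷ ws)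

data ConjRule {V : Set} : ∀ {m} → List (Formula V ∨ m) → List (Formula V ∨ m) → Set where
  permute : ∀ {m} {φs ψs : List (Formula V ∨ m)} → φs ↭ ψs → ConjRule φs ψs
  clone   : ∀ {m} us (φ : Formula V ∨ m) ws →
            ConjRule (us ++ φ ∷ ws) (us ++ φ ∷ φ ∷ ws)
  insert⊤ : ∀ {m} (us ws : List (Formula V ∨ m)) →
            ConjRule (us ++ ws) (us ++ pad m `⊤ ∷ ws)
  delete  : ∀ {m} us (φ : Formula V ∨ m) ws →
            ConjRule (us ++ φ ∷ ws) (us ++ ws)
  resolve : ∀ {m} us ws (p : V) (As Bs : List (Formula V ∧ m)) →
            ConjRule (us ++ node (As ∷ʳ pad m (lit (pos p)))
                          ∷ node (Bs ∷ʳ pad m (lit (neg p))) ∷ ws)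
                     (us ++ node (As ++⁺ (pad m `⊥ ∷ Bs)) ∷ ws)

-- Deletions cannot remove the only term: premise and conclusion of a
-- step are given by non-empty lists.

data Step {V : Set} : ∀ {c m} → Formula V c m → Formula V c m → Set where
  disj   : ∀ {m} {φs ψs : List⁺ (Formula V ∧ m)} →
           DisjRule (toList φs) (toList ψs) → Step {c = ∨} (node φs) (node ψs)
  conj   : ∀ {m} {φs ψs : List⁺ (Formula V ∨ m)} →
           ConjRule (toList φs) (toList ψs) → Step {c = ∧} (node φs) (node ψs)
  inside : ∀ {c m} {φ ψ : Formula V (dual c) m} us ws → Step φ ψ →
           Step {c = c} (node (us ++⁺ (φ ∷ ws))) (node (us ++⁺ (ψ ∷ ws)))

record IsRefutation {V : Set} (k : ℕ) (2≤k : 2 ≤ k) (Φ : CNF V) (D : List (Πˢ k V)) : Set where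
  field
    starts : List.head D ≡ just (paddedCNF k 2≤k Φ)
    ends   : List.last D ≡ just (pad k `⊥)
    steps  : Linked Step D

------------------------------------------------------------------------
-- Games

data Player : Set where
  I II : Player

opponent : Player → Player
opponent I  = II
opponent II = I

data Direction : Set where
  rightward leftward : Direction

turn : Direction → Direction
turn rightward = leftward
turn leftward  = rightward

-- Rounds and squares are numbered from 0: round 0 goes rightward, and
-- square 0 (the first, odd one) belongs to Player I.

direction : ℕ → Direction
direction zero    = rightward
direction (suc r) = turn (direction r)

mover : ℕ → Player
mover zero    = I
mover (suc j) = opponent (mover j)

-- A depth-k game without its winning set. The length is 2 + extra: on a
-- single square nothing would be written.

record Arena (k : ℕ) : Set where
  field
    extra : ℕ
    size  : ℕ
  squares : ℕ
  squares = 2 + extra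
  Symbol : Set
  Symbol = Fin size
  field
    Λ        : Symbol
    T→ T← : Bool → Symbol → Symbol → Symbol

  Square Edge Round : Set
  Square = Fin squares
  Edge   = Fin (suc extra)
  Round  = Fin k

  left right : Edge → Square
  left  = inject₁
  right = Fin.suc

  dir : Round → Direction
  dir r = direction (toℕ r)

  -- For both directions the arguments b, c are the contents of the left
  -- and of the right square, in this order.
  transition : Direction → Bool → Symbol → Symbol → Symbol
  transition rightward = T→
  transition leftward  = T←

  source target : Direction → Edge → Square
  source rightward = left
  source leftward  = right
  target rightward = right
  target leftward  = left

  edges : Direction → List Edge
  edges rightward = allFin (suc extra)
  edges leftward  = reverse (allFin (suc extra))

  schedule : List (Round × Edge)
  schedule = concatMap (λ r → map (r ,_) (edges (dir r))) (allFin k)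

  Tape : Set
  Tape = Vec Symbol squares

  -- Play ms t s s′: the moves ms are made from tape t, where s is the
  -- symbol written last before them and s′ the one written last after.
  data Play : List (Round × Edge) → Tape → Symbol → Symbol → Set where
    done : ∀ {t s} → Play [] t s s
    move : ∀ {r e ms t s s′} (h : Bool) →
           let w = transition (dir r) h (lookup t (left e)) (lookup t (right e)) in
           Play ms (t [ target (dir r) e ]≔ w) w s′ →
           Play ((r , e) ∷ ms) t s s′

  record Strategy (P : Player) : Set where
    field
      σ     : (r : Round) (j : Square) → mover (toℕ j) ≡ P → Symbol → Symbol → Symbol
      legal : ∀ r j own b c → ∃[ h ] σ r j own b c ≡ transition (dir r) h b c

  Follows : ∀ {P} → Strategy P → ∀ {ms t s s′} → Play ms t s s′ → Set
  Follows τ done = ⊤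
  Follows {P} τ (move {r} {e} {t = t} h π) =
    (∀ (own : mover (toℕ (source (dir r) e)) ≡ P) →
       transition (dir r) h b c ≡ Strategy.σ τ r (source (dir r) e) own b c)
    × Follows τ π
    where
    b = lookup t (left e)
    c = lookup t (right e)

record Game (k : ℕ) : Set where
  field
    arena : Arena k
  open Arena arena public
  field
    W : Symbol → Bool

  WonBy : Player → Symbol → Set
  WonBy I  s = W s ≡ true
  WonBy II s = W s ≡ false

  Winning : ∀ {P} → Strategy P → Set
  Winning {P} τ = ∀ {s} (π : Play schedule (replicate squares Λ) Λ s) → Follows τ π → WonBy P s

HasPositionalWinningStrategy : ∀ {k} → Player → Game k → Set
HasPositionalWinningStrategy P G = Σ[ τ ∈ Game.Strategy G P ] Game.Winning G τ

data Label (n : ℕ) : Set where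
  𝟎 𝟏 : Label n
  var : Fin n → Label n

evalLabel : ∀ {n} → (Fin n → Bool) → Label n → Bool
evalLabel a 𝟎       = false
evalLabel a 𝟏       = true
evalLabel a (var i) = a i

record Schema (k n : ℕ) : Set where
  field
    arena : Arena k
  open Arena arena public
  field
    label : Symbol → Label n

infix 8 _⟨_⟩

_⟨_⟩ : ∀ {k n} → Schema k n → (Fin n → Bool) → Game k
S ⟨ a ⟩ = record { arena = Schema.arena S ; W = λ s → evalLabel a (Schema.label S s) }

------------------------------------------------------------------------
-- A model of computation for polynomial time

-- A first-order functional language over finite data, in which every
-- operation is charged the size of the data it is applied to (so sharing
-- is never for free). The size of a result is thus at most the cost of
-- computing it, each program is simulated by a Turing machine in time
-- polynomial in its cost, and conversely a clocked Turing machine is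
-- simulated by folding its step function over a list of polynomial length,
-- at polynomial cost. Hence the functions computable at polynomial cost
-- are the polynomial time functions.

infixr 7 _⊗_
infixr 6 _⊕_

data Ty : Set where
  unit    : Ty
  _⊗_ _⊕_ : Ty → Ty → Ty
  list    : Ty → Ty

⟦_⟧ : Ty → Set
⟦ unit ⟧   = ⊤
⟦ A ⊗ B ⟧  = ⟦ A ⟧ × ⟦ B ⟧
⟦ A ⊕ B ⟧  = ⟦ A ⟧ ⊎ ⟦ B ⟧
⟦ list A ⟧ = List ⟦ A ⟧

∣_∣ : ∀ {A} → ⟦ A ⟧ → ℕ
∣_∣ {unit}   _        = 1
∣_∣ {A ⊗ B}  (a , b)  = suc (∣_∣ {A} a + ∣_∣ {B} b)
∣_∣ {A ⊕ B}  (inj₁ a) = suc (∣_∣ {A} a)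
∣_∣ {A ⊕ B}  (inj₂ b) = suc (∣_∣ {B} b)
∣_∣ {list A} []       = 1
∣_∣ {list A} (x ∷ xs) = suc (∣_∣ {A} x + ∣_∣ {list A} xs)

infixr 9 _∘ₚ_

data Prog : Ty → Ty → Set where
  idₚ      : ∀ {A} → Prog A A
  _∘ₚ_     : ∀ {A B C} → Prog B C → Prog A B → Prog A C
  !        : ∀ {A} → Prog A unit
  pair     : ∀ {A B C} → Prog A B → Prog A C → Prog A (B ⊗ C)
  fst      : ∀ {A B} → Prog (A ⊗ B) A
  snd      : ∀ {A B} → Prog (A ⊗ B) B
  inl      : ∀ {A B} → Prog A (A ⊕ B)
  inr      : ∀ {A B} → Prog B (A ⊕ B)
  case     : ∀ {Γ A B C} → Prog (Γ ⊗ A) C → Prog (Γ ⊗ B) C → Prog (Γ ⊗ (A ⊕ B)) C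
  nil      : ∀ {A B} → Prog A (list B)
  cons     : ∀ {A} → Prog (A ⊗ list A) (list A)
  caseList : ∀ {Γ A C} → Prog Γ C → Prog (Γ ⊗ (A ⊗ list A)) C → Prog (Γ ⊗ list A) C
  fold     : ∀ {Γ A C} → Prog Γ C → Prog (Γ ⊗ (A ⊗ C)) C → Prog (Γ ⊗ list A) C

run : ∀ {A B} → Prog A B → ⟦ A ⟧ → ⟦ B ⟧
run idₚ            a            = a
run (f ∘ₚ g)       a            = run f (run g a)
run !              a            = tt
run (pair f g)     a            = run f a , run g a
run fst            (a , b)      = a
run snd            (a , b)      = b
run inl            a            = inj₁ a
run inr            b            = inj₂ b
run (case f g)     (γ , inj₁ a) = run f (γ , a)
run (case f g)     (γ , inj₂ b) = run g (γ , b)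
run nil            a            = []
run cons           (x , xs)     = x ∷ xs
run (caseList f g) (γ , [])     = run f γ
run (caseList f g) (γ , x ∷ xs) = run g (γ , (x , xs))
run (fold f g)     (γ , [])     = run f γ
run (fold f g)     (γ , x ∷ xs) = run g (γ , (x , run (fold f g) (γ , xs)))

mutual
  cost : ∀ {A B} → Prog A B → ⟦ A ⟧ → ℕ
  cost {A} f a = suc (∣_∣ {A} a + subcost f a)

  -- The cost of evaluating the constituents of a program.
  subcost : ∀ {A B} → Prog A B → ⟦ A ⟧ → ℕ
  subcost (f ∘ₚ g)       a            = cost g a + cost f (run g a)
  subcost (pair f g)     a            = cost f a + cost g a
  subcost (case f g)     (γ , inj₁ a) = cost f (γ , a)
  subcost (case f g)     (γ , inj₂ b) = cost g (γ , b)
  subcost (caseList f g) (γ , [])     = cost f γ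
  subcost (caseList f g) (γ , x ∷ xs) = cost g (γ , (x , xs))
  subcost (fold f g)     (γ , [])     = cost f γ
  subcost (fold f g)     (γ , x ∷ xs) =
    cost (fold f g) (γ , xs) + cost g (γ , (x , run (fold f g) (γ , xs)))
  subcost _              _            = 0

------------------------------------------------------------------------
-- Encodings

-- Variable indices are written in (bijective) binary; the parameters and
-- symbols of games are written in unary.

bool bits unary : Ty
bool  = unit ⊕ unit
bits  = list bool
unary = list unit

encodeBool : Bool → ⟦ bool ⟧
encodeBool false = inj₁ tt
encodeBool true  = inj₂ tt

encodeℕᵇ : ℕᵇ → ⟦ bits ⟧
encodeℕᵇ Bin.zero     = []
encodeℕᵇ Bin.2[1+ b ] = encodeBool false ∷ encodeℕᵇ b
encodeℕᵇ Bin.1+[2 b ] = encodeBool true ∷ encodeℕᵇ b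

encodeIndex : ∀ {n} → Fin n → ⟦ bits ⟧
encodeIndex i = encodeℕᵇ (Bin.fromℕ (toℕ i))

encodeUnary : ℕ → ⟦ unary ⟧
encodeUnary n = List.replicate n tt

varTy litTy leafTy cnfTy : Ty
varTy  = bits ⊕ (bits ⊕ bits)
litTy  = bool ⊗ varTy
leafTy = litTy ⊕ bool
cnfTy  = list (list litTy)

formulaTy : ℕ → Ty
formulaTy zero    = leafTy
formulaTy (suc m) = list (formulaTy m)

module _ {p q n : ℕ} where

  encodeVar : Var p q n → ⟦ varTy ⟧
  encodeVar (xvar i) = inj₁ (encodeIndex i)
  encodeVar (yvar i) = inj₂ (inj₁ (encodeIndex i))
  encodeVar (zvar i) = inj₂ (inj₂ (encodeIndex i))

  encodeLiteral : Literal (Var p q n) → ⟦ litTy ⟧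
  encodeLiteral (pos v) = encodeBool true  , encodeVar v
  encodeLiteral (neg v) = encodeBool false , encodeVar v

  encodeLeaf : Leaf (Var p q n) → ⟦ leafTy ⟧
  encodeLeaf (lit l) = inj₁ (encodeLiteral l)
  encodeLeaf `⊤      = inj₂ (encodeBool true)
  encodeLeaf `⊥      = inj₂ (encodeBool false)

  encodeCNF : CNF (Var p q n) → ⟦ cnfTy ⟧
  encodeCNF = map (map encodeLiteral)

  encodeFormula : ∀ {c} m → Formula (Var p q n) c m → ⟦ formulaTy m ⟧
  encodeFormula zero    (leaf l)  = encodeLeaf l
  encodeFormula (suc m) (node φs) = map (encodeFormula m) (toList φs)

proofTy : ℕ → Ty
proofTy k = list (formulaTy k)

encodeProof : ∀ {p q n} k → List (Πˢ k (Var p q n)) → ⟦ proofTy k ⟧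
encodeProof k = map (encodeFormula k)

-- Besides the proof, the input has to tell which clauses come from Φ and
-- which come from Ψ.

inputTy : ℕ → Ty
inputTy k = cnfTy ⊗ (cnfTy ⊗ proofTy k)

encodeInput : ∀ {p q n} k → CNF (Fin p ⊎ Fin n) → CNF (Fin q ⊎ Fin n) →
              List (Πˢ k (Var p q n)) → ⟦ inputTy k ⟧
encodeInput {p} {q} k Φ Ψ D =
  encodeCNF (viaXZ {q = q} Φ) , (encodeCNF (viaYZ {p = p} Ψ) , encodeProof k D)

tableTy labelTy schemaTy : Ty
tableTy  = list (list unary)
labelTy  = bool ⊕ bits
schemaTy = unary ⊗ (unary ⊗ (unary ⊗
           ((tableTy ⊗ tableTy) ⊗ ((tableTy ⊗ tableTy) ⊗ list labelTy))))

encodeLabel : ∀ {n} → Label n → ⟦ labelTy ⟧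
encodeLabel 𝟎       = inj₁ (encodeBool false)
encodeLabel 𝟏       = inj₁ (encodeBool true)
encodeLabel (var i) = inj₂ (encodeIndex i)

encodeSchema : ∀ {k n} → Schema k n → ⟦ schemaTy ⟧
encodeSchema S =
  encodeUnary squares , (encodeUnary size , (symbol Λ ,
  ((table (T→ false) , table (T→ true)) , ((table (T← false) , table (T← true)) ,
  List.tabulate (λ s → encodeLabel (label s))))))
  where
  open Schema S
  symbol : Symbol → ⟦ unary ⟧
  symbol s = encodeUnary (toℕ s)
  table : (Symbol → Symbol → Symbol) → ⟦ tableTy ⟧
  table t = List.tabulate (λ b → List.tabulate (λ c → symbol (t b c)))

proofSize : ∀ {p q n} k → List (Πˢ k (Var p q n)) → ℕ
proofSize k D = ∣_∣ {proofTy k} (encodeProof k D)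

schemaSize : ∀ {k n} → Schema k n → ℕ
schemaSize S = ∣_∣ {schemaTy} (encodeSchema S)

{-# OPTIONS --safe #-}
module Submission where

-- The players move through the refutation. The first round traces a clause
-- claimed to be false from ⊥ back to the CNF, the second one a term of that
-- clause claimed to be true from the CNF on to ⊥, and so on: each round
-- descends by one level into the formulas found by the preceding round. A
-- formula is traced through a step without any choice, except that resolution
-- and dual resolution on p ask for the value of p, and that a true literal of
-- a clause of the CNF has to be found. Values are supplied by the owners of
-- the variables: Player I owns the x- and z-variables, Player II the
-- y-variables. When Player I claims that zᵢ is true, Player II may end the
-- game with the label zᵢ. A player answering according to an assignment that
-- satisfies his CNF never makes conflicting claims, while after k − 1 rounds
-- some literal has been claimed to be both true and false; its owner loses.

open import Data.Bool.Base using (Bool; true; false; not; _xor_; T)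
open import Data.Bool.Properties using (not-involutive)
open import Data.Empty using (⊥; ⊥-elim)
open import Data.Fin.Base using (Fin; toℕ; fromℕ<; zero; suc; inject₁)
open import Data.Fin.Properties using (toℕ<n; fromℕ<-toℕ; toℕ-fromℕ<; toℕ-inject₁)
open import Data.List.Base as List using (List; []; _∷_; _++_; map; foldr; concat; length; reverse; [_]; replicate; lookup; tabulate; concatMap)
open import Data.List.Membership.Propositional using (_∈_)
open import Data.List.Membership.Propositional.Properties using (∈-++⁻; ∈-++⁺ˡ; ∈-++⁺ʳ; ∈-map⁺; ∈-map⁻; ∈-concat⁺′; ∈-concat⁻′; ∈-lookup)
open import Data.List.NonEmpty.Base as List⁺ using (List⁺; toList; _++⁺_; _∷ʳ_)
open import Data.List.Properties using (unfold-reverse; reverse-injective; ++-assoc; ++-identityʳ; length-replicate; map-tabulate; tabulate-cong; tabulate-lookup; length-tabulate; length-++; map-++)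
open import Data.List.Relation.Binary.Permutation.Propositional using (↭-sym)
open import Data.List.Relation.Binary.Permutation.Propositional.Properties using (∈-resp-↭)
open import Data.List.Relation.Unary.All as All using (All; []; _∷_)
open import Data.List.Relation.Unary.Any as Any using (here; there; Any)
open import Data.List.Relation.Unary.Any.Properties using (reverse⁻)
open import Data.List.Relation.Unary.Linked using (Linked; []; [-]; _∷_)
open import Data.Maybe.Base using (just)
open import Data.Nat.Base using (ℕ; zero; suc; _+_; _*_; _^_; _≤_; _<_; z≤n; s≤s; _∸_)
open import Data.Nat.Binary.Base as Bin using (ℕᵇ)
open import Data.Nat.Binary.Properties as Binₚ using ()
open import Data.Nat.Properties
open import Data.Product.Base using (Σ-syntax; ∃-syntax; _×_; _,_; proj₁; proj₂)
open import Data.Sum.Base using (_⊎_; inj₁; inj₂; [_,_]′)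
open import Data.Unit.Base using (⊤; tt)
open import Data.Vec.Base as Vec using (Vec; _[_]≔_)
open import Data.Vec.Properties using (lookup∘update; lookup∘update′; lookup-replicate)
open import Defs
open import Function.Base using (_∘_; id; const)
open import Relation.Binary.PropositionalEquality hiding ([_])
open import Relation.Nullary.Decidable.Core as Dec using (Dec)
open import Relation.Nullary.Negation using (¬_)

-- Polynomially bounded programs

-- A transition sees only two symbols and the direction. Symbols therefore carry what the rules of
-- the game hide: the height of a formula, which identifies its round, and in the first round, whose
-- tape is blank, the lines of the refutation still to be passed. The refutation does not name its
-- rules, and a step may lie deep inside a formula. Instead of parsing a step, a move searches the
-- neighbouring formula for a suitable term, by a test nested through all levels. The test ignores
-- order and multiplicity of terms and is polynomial because `k` is constant; its success on every
-- step is all that the game needs to know of the rules. A query is spread over two squares, as its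
-- answer may need a bit of each player. Both halves of the theorem are one argument about an honest
-- player, with `Honesty` as its parameter. The alphabet is an explicit list of codes closed under
-- the moves, so that a program can write out the transition tables.

data Poly : Set where
  con         : ℕ → Poly
  arg         : Poly
  _⊞_ _⊠_ _⊙_ : Poly → Poly → Poly

infixl 6 _⊞_
infixl 7 _⊠_
infixl 8 _⊙_

⟪_⟫ : Poly → ℕ → ℕ
⟪ con c ⟫ n = c
⟪ arg ⟫     n = n
⟪ p ⊞ q ⟫ n = ⟪ p ⟫ n + ⟪ q ⟫ n
⟪ p ⊠ q ⟫ n = ⟪ p ⟫ n * ⟪ q ⟫ n
⟪ p ⊙ q ⟫ n = ⟪ p ⟫ (⟪ q ⟫ n)

⟪⟫-mono : ∀ p {m n} → m ≤ n → ⟪ p ⟫ m ≤ ⟪ p ⟫ n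
⟪⟫-mono (con c) m≤n = ≤-refl
⟪⟫-mono arg       m≤n = m≤n
⟪⟫-mono (p ⊞ q) m≤n = +-mono-≤ (⟪⟫-mono p m≤n) (⟪⟫-mono q m≤n)
⟪⟫-mono (p ⊠ q) m≤n = *-mono-≤ (⟪⟫-mono p m≤n) (⟪⟫-mono q m≤n)
⟪⟫-mono (p ⊙ q) m≤n = ⟪⟫-mono p (⟪⟫-mono q m≤n)

1≤m^n : ∀ m n → 1 ≤ suc m ^ n
1≤m^n m n = ≤-trans (≤-reflexive (sym (^-zeroˡ n))) (^-monoˡ-≤ n (s≤s z≤n))

^-split : ∀ n e f → suc n ^ e ≤ suc n ^ (e + f)
^-split n e f = ^-monoʳ-≤ (suc n) (m≤m+n e f)

^-splitʳ : ∀ n e f → suc n ^ f ≤ suc n ^ (e + f)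
^-splitʳ n e f = ^-monoʳ-≤ (suc n) (m≤n+m f e)

*-swap₄ : ∀ a b c d → (a * b) * (c * d) ≡ (a * c) * (b * d)
*-swap₄ a b c d = begin
  (a * b) * (c * d) ≡⟨ *-assoc a b (c * d) ⟩
  a * (b * (c * d)) ≡⟨ cong (a *_) (sym (*-assoc b c d)) ⟩
  a * (b * c * d)   ≡⟨ cong (λ x → a * (x * d)) (*-comm b c) ⟩
  a * (c * b * d)   ≡⟨ cong (a *_) (*-assoc c b d) ⟩
  a * (c * (b * d)) ≡⟨ sym (*-assoc a c (b * d)) ⟩
  (a * c) * (b * d) ∎
  where open ≡-Reasoning

^-distribʳ-* : ∀ m n e → (m * n) ^ e ≡ m ^ e * n ^ e
^-distribʳ-* m n zero    = refl
^-distribʳ-* m n (suc e) =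
  trans (cong ((m * n) *_) (^-distribʳ-* m n e)) (*-swap₄ m n (m ^ e) (n ^ e))

-- The base `suc n` is at least 1, so exponents can be raised to a common one, and in the case of
-- `_⊙_` the summand 1 is absorbed into `suc n ^ f`.
monomial-bound : ∀ p → Σ[ c ∈ ℕ ] Σ[ e ∈ ℕ ] (∀ n → ⟪ p ⟫ n ≤ c * suc n ^ e)
monomial-bound (con c) = c , 0 , λ n → ≤-reflexive (sym (*-identityʳ c))
monomial-bound arg = 1 , 1 , λ n → ≤-trans (n≤1+n n) (≤-reflexive (sym (trans (*-identityˡ _) (*-identityʳ (suc n)))))
monomial-bound (p ⊞ q) with monomial-bound p | monomial-bound q
... | c , e , P | d , f , Q = c + d , e + f , λ n → begin
  ⟪ p ⟫ n + ⟪ q ⟫ n                           ≤⟨ +-mono-≤ (P n) (Q n) ⟩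
  c * suc n ^ e + d * suc n ^ f               ≤⟨ +-mono-≤ (*-monoʳ-≤ c (^-split n e f)) (*-monoʳ-≤ d (^-splitʳ n e f)) ⟩
  c * suc n ^ (e + f) + d * suc n ^ (e + f)   ≡⟨ sym (*-distribʳ-+ (suc n ^ (e + f)) c d) ⟩
  (c + d) * suc n ^ (e + f)                   ∎
  where open ≤-Reasoning
monomial-bound (p ⊠ q) with monomial-bound p | monomial-bound q
... | c , e , P | d , f , Q = c * d , e + f , λ n → begin
  ⟪ p ⟫ n * ⟪ q ⟫ n                   ≤⟨ *-mono-≤ (P n) (Q n) ⟩
  (c * suc n ^ e) * (d * suc n ^ f)   ≡⟨ *-swap₄ c (suc n ^ e) d (suc n ^ f) ⟩
  (c * d) * (suc n ^ e * suc n ^ f)   ≡⟨ cong (c * d *_) (sym (^-distribˡ-+-* (suc n) e f)) ⟩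
  (c * d) * suc n ^ (e + f)           ∎
  where open ≤-Reasoning
monomial-bound (p ⊙ q) with monomial-bound p | monomial-bound q
... | c , e , P | d , f , Q = c * suc d ^ e , f * e , λ n → begin
  ⟪ p ⟫ (⟪ q ⟫ n)                       ≤⟨ P _ ⟩
  c * suc (⟪ q ⟫ n) ^ e                 ≤⟨ *-monoʳ-≤ c (^-monoˡ-≤ e (s≤s (Q n))) ⟩
  c * (1 + d * suc n ^ f) ^ e           ≤⟨ *-monoʳ-≤ c (^-monoˡ-≤ e (+-monoˡ-≤ _ (1≤m^n n f))) ⟩
  c * (suc d * suc n ^ f) ^ e           ≡⟨ cong (c *_) (^-distribʳ-* (suc d) (suc n ^ f) e) ⟩
  c * (suc d ^ e * (suc n ^ f) ^ e)     ≡⟨ cong (λ x → c * (suc d ^ e * x)) (^-*-assoc (suc n) f e) ⟩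
  c * (suc d ^ e * suc n ^ (f * e))     ≡⟨ sym (*-assoc c _ _) ⟩
  c * suc d ^ e * suc n ^ (f * e)       ∎
  where open ≤-Reasoning

poly-bound : ∀ p → Σ[ d ∈ ℕ ] (∀ n → ⟪ p ⟫ n ≤ d * n ^ d + d)
poly-bound p with monomial-bound p
... | c , e , P = d , bound
  where
  open ≤-Reasoning
  -- A positive `n` satisfies `suc n ≤ 2 * n`, at the price of the factor `2 ^ e`. Adding `e` lets
  -- the same number serve as coefficient, exponent and additive constant.
  d = c * 2 ^ e + e
  bound : ∀ n → ⟪ p ⟫ n ≤ d * n ^ d + d
  bound zero = begin
    ⟪ p ⟫ 0      ≤⟨ P 0 ⟩
    c * 1 ^ e    ≤⟨ *-monoʳ-≤ c (^-monoˡ-≤ e (s≤s z≤n)) ⟩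
    c * 2 ^ e    ≤⟨ m≤m+n _ e ⟩
    d            ≤⟨ m≤n+m d (d * 0 ^ d) ⟩
    d * 0 ^ d + d ∎
  bound (suc n) = begin
    ⟪ p ⟫ (suc n)             ≤⟨ P (suc n) ⟩
    c * suc (suc n) ^ e       ≤⟨ *-monoʳ-≤ c (^-monoˡ-≤ e (+-mono-≤ (s≤s z≤n) (m≤m+n (suc n) 0))) ⟩
    c * (2 * suc n) ^ e       ≡⟨ cong (c *_) (^-distribʳ-* 2 (suc n) e) ⟩
    c * (2 ^ e * suc n ^ e)   ≡⟨ sym (*-assoc c _ _) ⟩
    c * 2 ^ e * suc n ^ e     ≤⟨ *-mono-≤ (m≤m+n (c * 2 ^ e) e) (^-monoʳ-≤ (suc n) (m≤n+m e (c * 2 ^ e))) ⟩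
    d * suc n ^ d             ≤⟨ m≤m+n _ d ⟩
    d * suc n ^ d + d         ∎

-- Functions with programs of polynomial cost

size : (A : Ty) → ⟦ A ⟧ → ℕ
size A a = ∣_∣ {A} a

size-run : ∀ {A B} (f : Prog A B) a → size B (run f a) ≤ cost f a
size-run idₚ a = m≤n⇒m≤1+n (m≤m+n _ _)
size-run (f ∘ₚ g) a =
  ≤-trans (size-run f (run g a)) (m≤n⇒m≤1+n (≤-trans (m≤n+m _ (cost g a)) (m≤n+m _ _)))
size-run ! a = s≤s z≤n
size-run (pair f g) a =
  s≤s (≤-trans (+-mono-≤ (size-run f a) (size-run g a)) (m≤n+m _ _))
size-run fst (a , b) = m≤n⇒m≤1+n (m≤n⇒m≤1+n (≤-trans (m≤m+n _ _) (m≤m+n _ _)))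
size-run snd (a , b) = m≤n⇒m≤1+n (m≤n⇒m≤1+n (≤-trans (m≤n+m (size _ b) (size _ a)) (m≤m+n _ _)))
size-run inl a = s≤s (m≤m+n _ _)
size-run inr a = s≤s (m≤m+n _ _)
size-run {A} (case f g) (γ , inj₁ a) = ≤-trans (size-run f (γ , a)) (m≤n⇒m≤1+n (m≤n+m _ (size A (γ , inj₁ a))))
size-run {A} (case f g) (γ , inj₂ a) = ≤-trans (size-run g (γ , a)) (m≤n⇒m≤1+n (m≤n+m _ (size A (γ , inj₂ a))))
size-run nil a = s≤s z≤n
size-run cons (x , xs) = m≤n⇒m≤1+n (m≤m+n _ _)
size-run {A} (caseList f g) (γ , []) = ≤-trans (size-run f γ) (m≤n⇒m≤1+n (m≤n+m _ (size A (γ , []))))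
size-run {A} (caseList f g) (γ , x ∷ xs) = ≤-trans (size-run g _) (m≤n⇒m≤1+n (m≤n+m _ (size A (γ , x ∷ xs))))
size-run {A} (fold f g) (γ , []) = ≤-trans (size-run f γ) (m≤n⇒m≤1+n (m≤n+m _ (size A (γ , []))))
size-run {A} (fold f g) (γ , x ∷ xs) =
  ≤-trans (size-run g _) (m≤n⇒m≤1+n (≤-trans (m≤n+m _ (cost (fold f g) (γ , xs))) (m≤n+m _ (size A (γ , x ∷ xs)))))

infixr 1 _⇒_

-- Programs are not analysed individually: each combinator below carries its correctness and its
-- bound along, so that all later reasoning is about `fun`.
record _⇒_ (A B : Ty) : Set where
  field
    fun     : ⟦ A ⟧ → ⟦ B ⟧
    prog    : Prog A B
    correct : ∀ a → run prog a ≡ fun a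
    poly    : Poly
    bounded : ∀ a → cost prog a ≤ ⟪ poly ⟫ (size A a)

  fun-bounded : ∀ a → size B (fun a) ≤ ⟪ poly ⟫ (size A a)
  fun-bounded a =
    ≤-trans (≤-reflexive (cong (size B) (sym (correct a)))) (≤-trans (size-run prog a) (bounded a))

  bounded-at : ∀ {a n} → size A a ≤ n → cost prog a ≤ ⟪ poly ⟫ n
  bounded-at a≤n = ≤-trans (bounded _) (⟪⟫-mono poly a≤n)

open _⇒_ public

linear : Poly
linear = con 1 ⊞ (arg ⊞ con 0)

private
  variable
    A B C G H K : Ty

idᶠ : A ⇒ A
idᶠ = record { fun = id ; prog = idₚ ; correct = λ _ → refl ; poly = linear ; bounded = λ _ → ≤-refl }

infixr 9 _∘ᶠ_

_∘ᶠ_ : B ⇒ C → A ⇒ B → A ⇒ C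
_∘ᶠ_ {B} {C} {A} f g = record
  { fun     = λ a → fun f (fun g a)
  ; prog    = prog f ∘ₚ prog g
  ; correct = λ a → trans (cong (run (prog f)) (correct g a)) (correct f _)
  ; poly    = con 1 ⊞ (arg ⊞ (poly g ⊞ poly f ⊙ poly g))
  ; bounded = λ a → s≤s (+-monoʳ-≤ (size A a) (+-mono-≤ (bounded g a)
                (bounded-at f (≤-trans (size-run (prog g) a) (bounded g a)))))
  }

!ᶠ : A ⇒ unit
!ᶠ = record { fun = λ _ → tt ; prog = ! ; correct = λ _ → refl ; poly = linear ; bounded = λ _ → ≤-refl }

⟅_,_⟆ : A ⇒ B → A ⇒ C → A ⇒ B ⊗ C
⟅_,_⟆ {A} f g = record
  { fun     = λ a → fun f a , fun g a
  ; prog    = pair (prog f) (prog g)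
  ; correct = λ a → cong₂ _,_ (correct f a) (correct g a)
  ; poly    = con 1 ⊞ (arg ⊞ (poly f ⊞ poly g))
  ; bounded = λ a → s≤s (+-monoʳ-≤ (size A a) (+-mono-≤ (bounded f a) (bounded g a)))
  }

π₁ : A ⊗ B ⇒ A
π₁ = record { fun = proj₁ ; prog = fst ; correct = λ _ → refl ; poly = linear ; bounded = λ _ → ≤-refl }

π₂ : A ⊗ B ⇒ B
π₂ = record { fun = proj₂ ; prog = snd ; correct = λ _ → refl ; poly = linear ; bounded = λ _ → ≤-refl }

ι₁ : A ⇒ A ⊕ B
ι₁ = record { fun = inj₁ ; prog = inl ; correct = λ _ → refl ; poly = linear ; bounded = λ _ → ≤-refl }

ι₂ : B ⇒ A ⊕ B
ι₂ = record { fun = inj₂ ; prog = inr ; correct = λ _ → refl ; poly = linear ; bounded = λ _ → ≤-refl }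

nilᶠ : A ⇒ list B
nilᶠ = record { fun = λ _ → [] ; prog = nil ; correct = λ _ → refl ; poly = linear ; bounded = λ _ → ≤-refl }

consᶠ : A ⊗ list A ⇒ list A
consᶠ = record
  { fun = λ (x , xs) → x ∷ xs ; prog = cons ; correct = λ _ → refl ; poly = linear ; bounded = λ _ → ≤-refl }

elimList : {S T : Set} → T → (S → List S → T) → List S → T
elimList c f []       = c
elimList c f (x ∷ xs) = f x xs

split : G ⊗ A ⇒ C → G ⊗ B ⇒ C → G ⊗ (A ⊕ B) ⇒ C
split {G} {A} {C} {B} f g = record
  { fun     = λ (γ , s) → [ (λ a → fun f (γ , a)) , (λ b → fun g (γ , b)) ]′ s
  ; prog    = case (prog f) (prog g)
  ; correct = λ { (γ , inj₁ a) → correct f _ ; (γ , inj₂ b) → correct g _ }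
  ; poly    = con 1 ⊞ (arg ⊞ (poly f ⊞ poly g))
  ; bounded = λ { (γ , inj₁ a) → s≤s (+-monoʳ-≤ (size (G ⊗ (A ⊕ B)) (γ , inj₁ a))
                    (≤-trans (bounded-at f (s≤s (+-monoʳ-≤ (size G γ) (n≤1+n _)))) (m≤m+n _ _)))
                ; (γ , inj₂ b) → s≤s (+-monoʳ-≤ (size (G ⊗ (A ⊕ B)) (γ , inj₂ b))
                    (≤-trans (bounded-at g (s≤s (+-monoʳ-≤ (size G γ) (n≤1+n _)))) (m≤n+m _ (⟪ poly f ⟫ (size (G ⊗ (A ⊕ B)) (γ , inj₂ b)))))) }
  }

caseᶠ : G ⇒ A ⊕ B → G ⊗ A ⇒ C → G ⊗ B ⇒ C → G ⇒ C
caseᶠ e f g = split f g ∘ᶠ ⟅ idᶠ , e ⟆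

splitList : G ⇒ C → G ⊗ (A ⊗ list A) ⇒ C → G ⊗ list A ⇒ C
splitList {G} {C} {A} f g = record
  { fun     = λ (γ , xs) → elimList (fun f γ) (λ x xs → fun g (γ , (x , xs))) xs
  ; prog    = caseList (prog f) (prog g)
  ; correct = λ { (γ , []) → correct f _ ; (γ , x ∷ xs) → correct g _ }
  ; poly    = con 1 ⊞ (arg ⊞ (poly f ⊞ poly g))
  ; bounded = λ { (γ , []) → s≤s (+-monoʳ-≤ (size (G ⊗ list A) (γ , []))
                    (≤-trans (bounded-at f (m≤n⇒m≤1+n (m≤m+n _ _))) (m≤m+n _ _)))
                ; (γ , x ∷ xs) → s≤s (+-monoʳ-≤ (size (G ⊗ list A) (γ , x ∷ xs))
                    (≤-trans (bounded g _) (m≤n+m _ (⟪ poly f ⟫ (size (G ⊗ list A) (γ , x ∷ xs)))))) }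
  }

caseListᶠ : G ⇒ list A → G ⇒ C → G ⊗ (A ⊗ list A) ⇒ C → G ⇒ C
caseListᶠ e f g = splitList f g ∘ᶠ ⟅ idᶠ , e ⟆

length≤size : ∀ xs → length xs ≤ size (list A) xs
length≤size [] = z≤n
length≤size {A} (x ∷ xs) = s≤s (≤-trans (length≤size {A} xs) (m≤n+m _ (size A x)))

-- Iterating a polynomial step may square the accumulator at each element, so a bound `q` on the
-- intermediate results has to be supplied. They are the results for the suffixes of the list, hence
-- the quantification over all lists.
foldᶠ : (f : G ⇒ C) (g : G ⊗ (A ⊗ C) ⇒ C) (q : Poly) →
        (∀ γ xs → size C (foldr (λ x c → fun g (γ , (x , c))) (fun f γ) xs) ≤ ⟪ q ⟫ (size (G ⊗ list A) (γ , xs))) →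
        G ⊗ list A ⇒ C
foldᶠ {G} {C} {A} f g q small = record
  { fun     = result
  ; prog    = fold (prog f) (prog g)
  ; correct = correct′
  ; poly    = (con 1 ⊞ arg) ⊠ step
  ; bounded = λ (γ , xs) → ≤-trans (total (size (G ⊗ list A) (γ , xs)) γ xs ≤-refl)
                (*-monoˡ-≤ (⟪ step ⟫ (size (G ⊗ list A) (γ , xs))) (s≤s (≤-trans (length≤size {A} xs) (m≤n⇒m≤1+n (m≤n+m _ (size G γ))))))
  }
  where
  result : ⟦ G ⊗ list A ⟧ → ⟦ C ⟧
  result (γ , xs) = foldr (λ x c → fun g (γ , (x , c))) (fun f γ) xs
  correct′ : ∀ a → run (fold (prog f) (prog g)) a ≡ result a
  correct′ (γ , [])     = correct f γ
  correct′ (γ , x ∷ xs) =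
    trans (cong (λ c → run (prog g) (γ , (x , c))) (correct′ (γ , xs))) (correct g _)
  step : Poly
  step = con 1 ⊞ (arg ⊞ (poly f ⊞ poly g ⊙ (con 1 ⊞ (arg ⊞ (con 1 ⊞ (arg ⊞ q))))))
  total : ∀ n γ xs → size (G ⊗ list A) (γ , xs) ≤ n →
          cost (fold (prog f) (prog g)) (γ , xs) ≤ suc (length xs) * ⟪ step ⟫ n
  total n γ [] le = ≤-trans
    (s≤s (+-mono-≤ le (≤-trans (bounded-at f (≤-trans (m≤n⇒m≤1+n (m≤m+n _ _)) le)) (m≤m+n _ _))))
    (m≤m+n _ 0)
  total n γ (x ∷ xs) le = begin
    suc (size (G ⊗ list A) (γ , x ∷ xs) + (cost (fold (prog f) (prog g)) (γ , xs) + cost (prog g) (γ , (x , c))))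
      ≡⟨ cong suc (trans (cong (size (G ⊗ list A) (γ , x ∷ xs) +_) (+-comm (cost (fold (prog f) (prog g)) (γ , xs)) _))
                         (sym (+-assoc (size (G ⊗ list A) (γ , x ∷ xs)) _ _))) ⟩
    suc (size (G ⊗ list A) (γ , x ∷ xs) + cost (prog g) (γ , (x , c))) + cost (fold (prog f) (prog g)) (γ , xs)
      ≤⟨ +-mono-≤ (s≤s (+-mono-≤ le (≤-trans (bounded-at g small′) (m≤n+m _ (⟪ poly f ⟫ n))))) (total n γ xs shorter) ⟩
    ⟪ step ⟫ n + suc (length xs) * ⟪ step ⟫ n ∎
    where
    open ≤-Reasoning
    c = run (fold (prog f) (prog g)) (γ , xs)
    shorter : size (G ⊗ list A) (γ , xs) ≤ n
    shorter = ≤-trans (s≤s (+-monoʳ-≤ (size G γ) (m≤n⇒m≤1+n (m≤n+m _ (size A x))))) le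
    small′ : size (G ⊗ (A ⊗ C)) (γ , (x , c)) ≤ 1 + (n + (1 + (n + ⟪ q ⟫ n)))
    small′ = s≤s (+-mono-≤ (≤-trans (m≤n⇒m≤1+n (m≤m+n _ _)) shorter) (s≤s (+-mono-≤
      (≤-trans (≤-trans (m≤n⇒m≤1+n (m≤m+n _ _)) (≤-trans (m≤n+m _ (size G γ)) (n≤1+n _))) le)
      (≤-trans (≤-reflexive (cong (size C) (correct′ (γ , xs)))) (≤-trans (small γ xs) (⟪⟫-mono q shorter))))))

-- The increment does not depend on the accumulator, so the total growth is at most the length of
-- the list times one increment. All folds below except that of `suffixesᶠ` have this form.
foldAddᶠ : (f : G ⇒ C) (g : G ⊗ (A ⊗ C) ⇒ C) (q : Poly) →
           (∀ γ x c → size C (fun g (γ , (x , c))) ≤ size C c + ⟪ q ⟫ (size (G ⊗ A) (γ , x))) →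
           G ⊗ list A ⇒ C
foldAddᶠ {G} {C} {A} f g q additive = foldᶠ f g (poly f ⊞ arg ⊠ q) λ γ xs →
  ≤-trans (total (size (G ⊗ list A) (γ , xs)) γ xs ≤-refl) (+-mono-≤ (⟪⟫-mono (poly f) (m≤n⇒m≤1+n (m≤m+n _ _)))
    (*-monoˡ-≤ (⟪ q ⟫ (size (G ⊗ list A) (γ , xs))) (≤-trans (length≤size {A} xs) (m≤n⇒m≤1+n (m≤n+m _ (size G γ))))))
  where
  total : ∀ n γ xs → size (G ⊗ list A) (γ , xs) ≤ n →
          size C (foldr (λ x c → fun g (γ , (x , c))) (fun f γ) xs) ≤ ⟪ poly f ⟫ (size G γ) + length xs * ⟪ q ⟫ n
  total n γ [] le = ≤-trans (fun-bounded f γ) (m≤m+n _ 0)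
  total n γ (x ∷ xs) le = begin
    size C (fun g (γ , (x , c)))                         ≤⟨ additive γ x c ⟩
    size C c + ⟪ q ⟫ (size (G ⊗ A) (γ , x))               ≤⟨ +-mono-≤ (total n γ xs shorter) (⟪⟫-mono q element) ⟩
    b + length xs * ⟪ q ⟫ n + ⟪ q ⟫ n                    ≡⟨ +-assoc b _ _ ⟩
    b + (length xs * ⟪ q ⟫ n + ⟪ q ⟫ n)                  ≡⟨ cong (b +_) (+-comm (length xs * ⟪ q ⟫ n) _) ⟩
    b + length (x ∷ xs) * ⟪ q ⟫ n                        ∎
    where
    open ≤-Reasoning
    b = ⟪ poly f ⟫ (size G γ)
    c = foldr (λ x c → fun g (γ , (x , c))) (fun f γ) xs
    shorter : size (G ⊗ list A) (γ , xs) ≤ n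
    shorter = ≤-trans (s≤s (+-monoʳ-≤ (size G γ) (m≤n⇒m≤1+n (m≤n+m _ (size A x))))) le
    element : size (G ⊗ A) (γ , x) ≤ n
    element = ≤-trans (s≤s (+-monoʳ-≤ (size G γ) (m≤n⇒m≤1+n (m≤m+n _ _)))) le

-- Replaces the nested folds and cases that the combinators yield by a function suited to proofs.
specify : (f : A ⇒ B) (h : ⟦ A ⟧ → ⟦ B ⟧) → (∀ a → fun f a ≡ h a) → A ⇒ B
specify f h f≗h = record
  { fun = h ; prog = prog f ; correct = λ a → trans (correct f a) (f≗h a) ; poly = poly f ; bounded = bounded f }

-- Booleans, lists and decidable equality

pattern yes = inj₂ tt
pattern no  = inj₁ tt

IsYes : ⊤ ⊎ ⊤ → Set
IsYes b = b ≡ yes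

boolᶠ : Bool → A ⇒ bool
boolᶠ b = specify (constant b) (λ _ → encodeBool b) (constant-fun b)
  where
  constant : Bool → A ⇒ bool
  constant false = ι₁ ∘ᶠ !ᶠ
  constant true  = ι₂ ∘ᶠ !ᶠ
  constant-fun : ∀ b (a : ⟦ A ⟧) → fun (constant b) a ≡ encodeBool b
  constant-fun false _ = refl
  constant-fun true  _ = refl

ifᶠ : G ⇒ bool → G ⇒ C → G ⇒ C → G ⇒ C
ifᶠ e f g = caseᶠ e (g ∘ᶠ π₁) (f ∘ᶠ π₁)

both either : ⊤ ⊎ ⊤ → ⊤ ⊎ ⊤ → ⊤ ⊎ ⊤
both   a b = [ (λ _ → no) , (λ _ → b) ]′ a
either a b = [ (λ _ → b) , (λ _ → yes) ]′ a

bothᶠ eitherᶠ : G ⇒ bool → G ⇒ bool → G ⇒ bool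
bothᶠ   e f = specify (ifᶠ e f (boolᶠ false)) (λ γ → both (fun e γ) (fun f γ)) λ γ → refl
eitherᶠ e f = specify (ifᶠ e (boolᶠ true) f) (λ γ → either (fun e γ) (fun f γ)) λ γ → refl

either-yes : ∀ a {b} → IsYes (either a b) → IsYes a ⊎ IsYes b
either-yes no  y = inj₂ y
either-yes yes y = inj₁ refl

eitherʳ : ∀ a {b} → IsYes b → IsYes (either a b)
eitherʳ no  y = y
eitherʳ yes y = refl

both-yes : ∀ a {b} → IsYes (both a b) → IsYes a × IsYes b
both-yes yes y = refl , y

grow : ∀ {a b} c → a ≤ b → suc (a + c) ≤ c + suc b
grow {a} {b} c a≤b = ≤-trans (s≤s (≤-trans (+-monoˡ-≤ c a≤b) (≤-reflexive (+-comm b c)))) (≤-reflexive (sym (+-suc c b)))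

size≥1 : ∀ A a → 1 ≤ size A a
size≥1 unit     _        = s≤s z≤n
size≥1 (A ⊗ B)  _        = s≤s z≤n
size≥1 (A ⊕ B)  (inj₁ _) = s≤s z≤n
size≥1 (A ⊕ B)  (inj₂ _) = s≤s z≤n
size≥1 (list A) []       = s≤s z≤n
size≥1 (list A) (_ ∷ _)  = s≤s z≤n

onList : unit ⊗ list A ⇒ C → list A ⇒ C
onList f = f ∘ᶠ ⟅ !ᶠ , idᶠ ⟆

mapᶠ : G ⊗ A ⇒ B → G ⊗ list A ⇒ list B
mapᶠ {G} {A} {B} f = specify
  (foldAddᶠ nilᶠ (consᶠ ∘ᶠ ⟅ f ∘ᶠ ⟅ π₁ , π₁ ∘ᶠ π₂ ⟆ , π₂ ∘ᶠ π₂ ⟆) (con 1 ⊞ poly f)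
    λ γ x c → grow (size (list B) c) (fun-bounded f (γ , x)))
  (λ (γ , xs) → map (λ x → fun f (γ , x)) xs) λ (γ , xs) → foldr-map (λ x → fun f (γ , x)) xs
  where
  foldr-map : ∀ (h : ⟦ A ⟧ → ⟦ B ⟧) xs → foldr (λ x c → h x ∷ c) [] xs ≡ map h xs
  foldr-map h []       = refl
  foldr-map h (x ∷ xs) = cong (h x ∷_) (foldr-map h xs)

orElse : {S : Set} → ⊤ ⊎ S → ⊤ ⊎ S → ⊤ ⊎ S
orElse s c = [ (λ _ → c) , inj₂ ]′ s

first : {S T : Set} → (S → ⊤ ⊎ T) → List S → ⊤ ⊎ T
first f []       = inj₁ tt
first f (x ∷ xs) = orElse (f x) (first f xs)

firstᶠ : G ⊗ A ⇒ unit ⊕ B → G ⊗ list A ⇒ unit ⊕ B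
firstᶠ {G} {A} {B} f = specify
  (foldAddᶠ (ι₁ ∘ᶠ !ᶠ) (caseᶠ (f ∘ᶠ ⟅ π₁ , π₁ ∘ᶠ π₂ ⟆) (π₂ ∘ᶠ π₂ ∘ᶠ π₁) (ι₂ ∘ᶠ π₂)) (poly f) small)
  (λ (γ , xs) → first (λ x → fun f (γ , x)) xs) λ (γ , xs) → foldr-first (λ x → fun f (γ , x)) xs
  where
  small : ∀ γ x c → size (unit ⊕ B) ([ (λ _ → c) , inj₂ ]′ (fun f (γ , x))) ≤ size (unit ⊕ B) c + ⟪ poly f ⟫ (size (G ⊗ A) (γ , x))
  small γ x c with fun f (γ , x) | fun-bounded f (γ , x)
  ... | inj₁ _ | _ = m≤m+n _ _
  ... | inj₂ b | p = ≤-trans p (m≤n+m _ (size (unit ⊕ B) c))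
  foldr-first : ∀ (h : ⟦ A ⟧ → ⊤ ⊎ ⟦ B ⟧) xs → foldr (λ x c → [ (λ _ → c) , inj₂ ]′ (h x)) no xs ≡ first h xs
  foldr-first h []       = refl
  foldr-first h (x ∷ xs) = cong (orElse (h x)) (foldr-first h xs)

first-just : ∀ {S T : Set} (f : S → ⊤ ⊎ T) xs {y} → first f xs ≡ inj₂ y → ∃[ x ] (x ∈ xs × f x ≡ inj₂ y)
first-just f (x ∷ xs) eq with f x in fx
... | inj₂ b with refl ← eq = x , here refl , fx
... | inj₁ _ with x′ , m , e ← first-just f xs eq = x′ , there m , e

first-complete : ∀ {S T : Set} (f : S → ⊤ ⊎ T) {x xs y} → x ∈ xs → f x ≡ inj₂ y → ∃[ y′ ] first f xs ≡ inj₂ y′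
first-complete f (here refl) eq rewrite eq = _ , refl
first-complete f {xs = x ∷ xs} (there m) eq with f x
... | inj₁ _ = first-complete f m eq
... | inj₂ b = b , refl

found : {S : Set} → ⊤ ⊎ S → ⊤ ⊎ ⊤
found s = [ (λ _ → no) , (λ _ → yes) ]′ s

foundᶠ : G ⇒ unit ⊕ A → G ⇒ bool
foundᶠ f = specify (caseᶠ f (boolᶠ false) (boolᶠ true)) (λ γ → found (fun f γ)) λ γ → refl

found-just : ∀ {S : Set} (s : ⊤ ⊎ S) → IsYes (found s) → ∃[ y ] s ≡ inj₂ y
found-just (inj₂ y) _ = y , refl

guard : {S : Set} → ⊤ ⊎ ⊤ → S → ⊤ ⊎ S
guard b x = [ (λ _ → inj₁ tt) , (λ _ → inj₂ x) ]′ b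

guardᶠ : G ⊗ A ⇒ bool → G ⊗ A ⇒ unit ⊕ A
guardᶠ p = specify (ifᶠ p (ι₂ ∘ᶠ π₂) (ι₁ ∘ᶠ !ᶠ)) (λ (γ , x) → guard (fun p (γ , x)) x) λ γ → refl

guard-just : ∀ {S : Set} b {x y : S} → guard b x ≡ inj₂ y → IsYes b × x ≡ y
guard-just yes refl = refl , refl

every : {S : Set} → (S → ⊤ ⊎ ⊤) → List S → ⊤ ⊎ ⊤
every p []       = yes
every p (x ∷ xs) = both (p x) (every p xs)

everyᶠ : G ⊗ A ⇒ bool → G ⊗ list A ⇒ bool
everyᶠ {G} {A} p = specify
  (foldAddᶠ (boolᶠ true) (bothᶠ (p ∘ᶠ ⟅ π₁ , π₁ ∘ᶠ π₂ ⟆) (π₂ ∘ᶠ π₂)) (con 2) small)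
  (λ (γ , xs) → every (λ x → fun p (γ , x)) xs) λ (γ , xs) → foldr-every (λ x → fun p (γ , x)) xs
  where
  small : ∀ γ x c → size bool (both (fun p (γ , x)) c) ≤ size bool c + 2
  small γ x c with fun p (γ , x)
  ... | no  = m≤n+m 2 (size bool c)
  ... | yes = m≤m+n _ 2
  foldr-every : ∀ (h : ⟦ A ⟧ → ⟦ bool ⟧) xs → foldr (λ x c → both (h x) c) yes xs ≡ every h xs
  foldr-every h []       = refl
  foldr-every h (x ∷ xs) = cong (both (h x)) (foldr-every h xs)

every-∈ : ∀ {S : Set} (p : S → ⊤ ⊎ ⊤) {xs x} → IsYes (every p xs) → x ∈ xs → IsYes (p x)
every-∈ p {x ∷ xs} y (here refl) = proj₁ (both-yes (p x) y)
every-∈ p {x ∷ xs} y (there m)   = every-∈ p (proj₂ (both-yes (p x) y)) m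

∈-every : ∀ {S : Set} (p : S → ⊤ ⊎ ⊤) xs → (∀ {x} → x ∈ xs → IsYes (p x)) → IsYes (every p xs)
∈-every p []       h = refl
∈-every p (x ∷ xs) h rewrite h (here refl) = ∈-every p xs (h ∘ there)

appendᶠ : list A ⊗ list A ⇒ list A
appendᶠ {A} = specify
  (foldAddᶠ idᶠ (consᶠ ∘ᶠ π₂) (con 1 ⊞ arg)
     (λ γ x c → grow (size (list A) c) (≤-trans (m≤n+m (size A x) (size (list A) γ)) (n≤1+n _)))
   ∘ᶠ ⟅ π₂ , π₁ ⟆)
  (λ (xs , ys) → xs ++ ys) λ (xs , ys) → foldr-++ ys xs
  where
  foldr-++ : ∀ (ys xs : List ⟦ A ⟧) → foldr _∷_ ys xs ≡ xs ++ ys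
  foldr-++ ys []       = refl
  foldr-++ ys (x ∷ xs) = cong (x ∷_) (foldr-++ ys xs)

size-++ : ∀ A xs ys → size (list A) (xs ++ ys) ≤ size (list A) xs + size (list A) ys
size-++ A []       ys = n≤1+n _
size-++ A (x ∷ xs) ys = s≤s (≤-trans (+-monoʳ-≤ (size A x) (size-++ A xs ys)) (≤-reflexive (sym (+-assoc (size A x) _ _))))

concatᶠ : list (list A) ⇒ list A
concatᶠ {A} = specify
  (onList (foldAddᶠ nilᶠ (appendᶠ ∘ᶠ π₂) arg λ γ xs c →
    ≤-trans (size-++ A xs c) (≤-trans (≤-reflexive (+-comm (size (list A) xs) _))
      (+-monoʳ-≤ (size (list A) c) (m≤n⇒m≤1+n (m≤n+m _ 1))))))
  concat foldr-concat
  where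
  foldr-concat : ∀ (xss : List (List ⟦ A ⟧)) → foldr _++_ [] xss ≡ concat xss
  foldr-concat []         = refl
  foldr-concat (xs ∷ xss) = cong (xs ++_) (foldr-concat xss)

reverseᶠ : list A ⇒ list A
reverseᶠ {A} = specify
  (onList (foldAddᶠ nilᶠ (appendᶠ ∘ᶠ ⟅ π₂ ∘ᶠ π₂ , consᶠ ∘ᶠ ⟅ π₁ ∘ᶠ π₂ , nilᶠ ⟆ ⟆) (con 2 ⊞ arg) λ γ x c →
    ≤-trans (size-++ A c (x ∷ [])) (+-monoʳ-≤ (size (list A) c) (s≤s (≤-trans (≤-reflexive (+-comm (size A x) 1)) (s≤s (m≤n⇒m≤1+n (m≤n⇒m≤1+n ≤-refl))))))))
  reverse foldr-reverse
  where
  foldr-reverse : ∀ (xs : List ⟦ A ⟧) → foldr (λ x c → c ++ x ∷ []) [] xs ≡ reverse xs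
  foldr-reverse []       = refl
  foldr-reverse (x ∷ xs) = trans (cong (_++ x ∷ []) (foldr-reverse xs)) (sym (unfold-reverse x xs))

suffixes : {S : Set} → List S → List (List S)
suffixes []       = [] ∷ []
suffixes (x ∷ xs) = (x ∷ xs) ∷ suffixes xs

-- A step sees only the accumulator, so the suffix itself is returned along with the list of its
-- suffixes. The result is quadratic, and the growth at an element depends on the accumulator, which
-- rules out `foldAddᶠ`.
suffixesᶠ : list A ⇒ list (list A)
suffixesᶠ {A} = specify
  (π₂ ∘ᶠ onList (foldᶠ ⟅ nilᶠ , consᶠ ∘ᶠ ⟅ nilᶠ , nilᶠ ⟆ ⟆
    (⟅ π₁ , consᶠ ⟆ ∘ᶠ ⟅ consᶠ ∘ᶠ ⟅ π₁ ∘ᶠ π₂ , π₁ ∘ᶠ π₂ ∘ᶠ π₂ ⟆ , π₂ ∘ᶠ π₂ ∘ᶠ π₂ ⟆)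
    bound (λ _ → small)))
  suffixes (λ xs → cong proj₂ (folded xs))
  where
  bound : Poly
  bound = con 1 ⊞ (arg ⊞ (con 1 ⊞ arg ⊠ (con 1 ⊞ arg)))
  folded : ∀ (xs : List ⟦ A ⟧) → foldr (λ x (c , d) → (x ∷ c , (x ∷ c) ∷ d)) ([] , [] ∷ []) xs ≡ (xs , suffixes xs)
  folded []       = refl
  folded (x ∷ xs) rewrite folded xs = refl
  size-suffixes : ∀ n xs → size (list A) xs ≤ n → size (list (list A)) (suffixes xs) ≤ 1 + suc (length xs) * (1 + n)
  size-suffixes n [] le = ≤-trans (s≤s (s≤s (s≤s z≤n)))
    (s≤s (≤-trans (s≤s le) (m≤m+n _ 0)))
  size-suffixes n (x ∷ xs) le = s≤s (≤-trans
    (+-mono-≤ le (size-suffixes n xs (≤-trans (m≤n⇒m≤1+n (m≤n+m _ (size A x))) le)))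
    (≤-reflexive (+-suc n _)))
  small : ∀ xs → size (list A ⊗ list (list A)) (foldr (λ x (c , d) → (x ∷ c , (x ∷ c) ∷ d)) ([] , [] ∷ []) xs) ≤
                 ⟪ bound ⟫ (2 + size (list A) xs)
  small xs rewrite folded xs = s≤s (+-mono-≤ (m≤n⇒m≤1+n (m≤n⇒m≤1+n ≤-refl)) (≤-trans (size-suffixes (size (list A) xs) xs ≤-refl)
    (s≤s (*-mono-≤ (s≤s (≤-trans (length≤size {A} xs) (n≤1+n _))) (s≤s (m≤n⇒m≤1+n (n≤1+n _)))))))

strip : {S : Set} → (S → S → ⊤ ⊎ ⊤) → S → ⊤ ⊎ List S → ⊤ ⊎ List S
strip eq x s = [ (λ _ → inj₁ tt) , elimList (inj₁ tt) (λ y r → guard (eq x y) r) ]′ s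

stripᶠ : A ⊗ A ⇒ bool → A ⊗ (unit ⊕ list A) ⇒ unit ⊕ list A
stripᶠ eq = specify
  (caseᶠ π₂ (ι₁ ∘ᶠ !ᶠ) (caseListᶠ π₂ (ι₁ ∘ᶠ !ᶠ)
    (ifᶠ (eq ∘ᶠ ⟅ π₁ ∘ᶠ π₁ ∘ᶠ π₁ , π₁ ∘ᶠ π₂ ⟆) (ι₂ ∘ᶠ π₂ ∘ᶠ π₂) (ι₁ ∘ᶠ !ᶠ))))
  (λ (x , s) → strip (λ a b → fun eq (a , b)) x s) λ _ → refl

emptyᶠ : list A ⇒ bool
emptyᶠ = caseListᶠ idᶠ (boolᶠ true) (boolᶠ false)

-- A fold meets the last element of its list first, so it compares from the
-- right, with the other list reversed.
eqListᶠ : A ⊗ A ⇒ bool → list A ⊗ list A ⇒ bool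
eqListᶠ {A} eq = caseᶠ
  (foldAddᶠ (ι₂ ∘ᶠ reverseᶠ) (stripᶠ eq ∘ᶠ π₂) (con 2) small ∘ᶠ ⟅ π₂ , π₁ ⟆)
  (boolᶠ false) (emptyᶠ ∘ᶠ π₂)
  where
  small : ∀ (γ : ⟦ list A ⟧) x c → size (unit ⊕ list A) (strip (λ a b → fun eq (a , b)) x c) ≤ size (unit ⊕ list A) c + 2
  small γ x (inj₁ _) = s≤s (s≤s z≤n)
  small γ x (inj₂ []) = s≤s (s≤s z≤n)
  small γ x (inj₂ (y ∷ r)) with fun eq (x , y)
  ... | no  = s≤s (s≤s z≤n)
  ... | yes = s≤s (≤-trans (m≤n⇒m≤1+n (m≤n+m _ (size A y))) (m≤m+n _ 2))

eqᶠ : ∀ A → A ⊗ A ⇒ bool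
eqᶠ unit     = boolᶠ true
eqᶠ (A ⊗ B)  = bothᶠ (eqᶠ A ∘ᶠ ⟅ π₁ ∘ᶠ π₁ , π₁ ∘ᶠ π₂ ⟆) (eqᶠ B ∘ᶠ ⟅ π₂ ∘ᶠ π₁ , π₂ ∘ᶠ π₂ ⟆)
eqᶠ (A ⊕ B)  = caseᶠ π₁ (caseᶠ (π₂ ∘ᶠ π₁) (eqᶠ A ∘ᶠ ⟅ π₂ ∘ᶠ π₁ , π₂ ⟆) (boolᶠ false))
                        (caseᶠ (π₂ ∘ᶠ π₁) (boolᶠ false) (eqᶠ B ∘ᶠ ⟅ π₂ ∘ᶠ π₁ , π₂ ⟆))
eqᶠ (list A) = eqListᶠ (eqᶠ A)

same : ∀ A → ⟦ A ⟧ → ⟦ A ⟧ → ⊤ ⊎ ⊤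
same A a b = fun (eqᶠ A) (a , b)

module _ {S : Set} (eq : S → S → ⊤ ⊎ ⊤) where

  strip-sound : (∀ {a b} → IsYes (eq a b) → a ≡ b) →
                ∀ zs xs {r} → foldr (strip eq) (inj₂ zs) xs ≡ inj₂ r → zs ≡ reverse xs ++ r
  strip-sound sound zs []       refl = refl
  strip-sound sound zs (x ∷ xs) e with foldr (strip eq) (inj₂ zs) xs in f
  ... | inj₂ (y ∷ r) with eq x y in q
  ... | yes with refl ← e | refl ← sound q = begin
    zs                               ≡⟨ strip-sound sound zs xs f ⟩
    reverse xs ++ x ∷ r              ≡⟨ sym (++-assoc (reverse xs) [ x ] r) ⟩
    (reverse xs ++ [ x ]) ++ r       ≡⟨ cong (_++ r) (sym (unfold-reverse x xs)) ⟩
    reverse (x ∷ xs) ++ r            ∎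
    where open ≡-Reasoning

  strip-complete : (∀ a → IsYes (eq a a)) →
                   ∀ xs r → foldr (strip eq) (inj₂ (reverse xs ++ r)) xs ≡ inj₂ r
  strip-complete complete []       r = refl
  strip-complete complete (x ∷ xs) r
    rewrite unfold-reverse x xs | ++-assoc (reverse xs) [ x ] r
          | strip-complete complete xs (x ∷ r) | complete x = refl

same-sound : ∀ A {a b} → IsYes (same A a b) → a ≡ b
same-sound unit     _ = refl
same-sound (A ⊗ B) {a , b} {c , d} e with p , q ← both-yes (same A a c) e =
  cong₂ _,_ (same-sound A p) (same-sound B q)
same-sound (A ⊕ B) {inj₁ _} {inj₁ _} e = cong inj₁ (same-sound A e)
same-sound (A ⊕ B) {inj₂ _} {inj₂ _} e = cong inj₂ (same-sound B e)
same-sound (list A) {xs} {ys} e with foldr (strip (same A)) (inj₂ (reverse ys)) xs in f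
... | inj₂ [] = reverse-injective (sym (trans (strip-sound (same A) (same-sound A) (reverse ys) xs f) (++-identityʳ _)))

same-refl : ∀ A a → IsYes (same A a a)
same-refl unit     _        = refl
same-refl (A ⊗ B)  (a , b)  rewrite same-refl A a = same-refl B b
same-refl (A ⊕ B)  (inj₁ a) = same-refl A a
same-refl (A ⊕ B)  (inj₂ b) = same-refl B b
same-refl (list A) xs = subst (λ zs → IsYes ([ (λ _ → no) , (λ r → fun emptyᶠ r) ]′ (foldr (strip (same A)) (inj₂ zs) xs)))
  (++-identityʳ (reverse xs)) (cong [ (λ _ → no) , (λ r → fun emptyᶠ r) ]′ (strip-complete (same A) (same-refl A) xs []))

position : ∀ A → ⟦ A ⟧ → List ⟦ A ⟧ → ⟦ unary ⟧
position A x []       = []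
position A x (y ∷ ys) = [ (λ _ → tt ∷ position A x ys) , (λ _ → []) ]′ (same A x y)

positionᶠ : A ⊗ list A ⇒ unary
positionᶠ {A} = specify
  (foldAddᶠ nilᶠ (ifᶠ (eqᶠ A ∘ᶠ ⟅ π₁ , π₁ ∘ᶠ π₂ ⟆) nilᶠ (consᶠ ∘ᶠ ⟅ !ᶠ , π₂ ∘ᶠ π₂ ⟆)) (con 2) small)
  (λ (x , ys) → position A x ys) λ (x , ys) → folded x ys
  where
  small : ∀ x y c → size unary ([ (λ _ → tt ∷ c) , (λ _ → []) ]′ (same A x y)) ≤ size unary c + 2
  small x y c with same A x y
  ... | no  = ≤-reflexive (+-comm 2 (size unary c))
  ... | yes = ≤-trans (s≤s z≤n) (m≤n+m 2 (size unary c))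
  folded : ∀ x ys → foldr (λ y c → [ (λ _ → tt ∷ c) , (λ _ → []) ]′ (same A x y)) [] ys ≡ position A x ys
  folded x []       = refl
  folded x (y ∷ ys) = cong (λ c → [ (λ _ → tt ∷ c) , (λ _ → []) ]′ (same A x y)) (folded x ys)

-- Encoded formulas

FT : ℕ → Ty
FT = formulaTy

constᶠ : Bool → A ⇒ leafTy
constᶠ b = ι₂ ∘ᶠ boolᶠ b

litᶠ : Bool → G ⇒ varTy → G ⇒ leafTy
litᶠ b v = ι₁ ∘ᶠ ⟅ boolᶠ b , v ⟆

padᶠ : ∀ h → leafTy ⇒ FT h
padᶠ zero    = idᶠ
padᶠ (suc h) = consᶠ ∘ᶠ ⟅ padᶠ h , nilᶠ ⟆

headᶠ : ∀ h → FT (suc h) ⇒ FT h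
headᶠ h = caseListᶠ idᶠ (padᶠ h ∘ᶠ constᶠ false) (π₁ ∘ᶠ π₂)

leafOfᶠ : ∀ h → FT h ⇒ leafTy
leafOfᶠ zero    = idᶠ
leafOfᶠ (suc h) = leafOfᶠ h ∘ᶠ headᶠ h

leavesᶠ : ∀ h → FT h ⇒ list leafTy
leavesᶠ zero    = consᶠ ∘ᶠ ⟅ idᶠ , nilᶠ ⟆
leavesᶠ (suc h) = concatᶠ ∘ᶠ onList (mapᶠ (leavesᶠ h ∘ᶠ π₂))

module _ (h : ℕ) (available : FT h ⊗ FT (suc h) ⇒ bool) where

  -- The test behind every rule. With the sign `true` it ensures that `D` is false if `D′` and `l`
  -- are, with the sign `false` the dual, so a claim about `D′` passes to `D`. The leaf `l` is a
  -- neutral constant in the rules without a pivot, and a literal of the pivot in the two resolution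
  -- rules.
  relatedᶠ : (leafTy ⊗ FT (suc h)) ⊗ FT (suc h) ⇒ bool
  relatedᶠ = everyᶠ (eitherᶠ (eqᶠ (FT h) ∘ᶠ ⟅ π₂ , padᶠ h ∘ᶠ π₁ ∘ᶠ π₁ ⟆) (available ∘ᶠ ⟅ π₂ , π₂ ∘ᶠ π₁ ⟆))

  termᶠ : leafTy ⊗ (FT (suc h) ⊗ FT (2 + h)) ⇒ unit ⊕ FT (suc h)
  termᶠ = firstᶠ (guardᶠ relatedᶠ) ∘ᶠ ⟅ ⟅ π₁ , π₁ ∘ᶠ π₂ ⟆ , π₂ ∘ᶠ π₂ ⟆

  -- If the pivot is true, a claim of falsity passes to the clause with the negative literal, and a
  -- claim of truth to the conjunction with the positive one. Hence the literal of polarity `not s`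
  -- belongs to the outcome for true.
  resolventOnᶠ : Bool → (FT (suc h) ⊗ FT (2 + h)) ⊗ leafTy ⇒ unit ⊕ (varTy ⊗ (FT (suc h) ⊗ FT (suc h)))
  resolventOnᶠ s = caseᶠ π₂
    (caseᶠ (termᶠ ∘ᶠ ⟅ litᶠ (not s) (π₂ ∘ᶠ π₂) , π₁ ∘ᶠ π₁ ⟆) (ι₁ ∘ᶠ !ᶠ)
      (caseᶠ (termᶠ ∘ᶠ ⟅ litᶠ s (π₂ ∘ᶠ π₂ ∘ᶠ π₁) , π₁ ∘ᶠ π₁ ∘ᶠ π₁ ⟆) (ι₁ ∘ᶠ !ᶠ)
        (ι₂ ∘ᶠ ⟅ π₂ ∘ᶠ π₂ ∘ᶠ π₁ ∘ᶠ π₁ , ⟅ π₂ ∘ᶠ π₁ , π₂ ⟆ ⟆)))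
    (ι₁ ∘ᶠ !ᶠ)

  -- The pivot occurs in the formula that is searched, so trying the variables of its leaves is
  -- enough.
  resolventᶠ : Bool → FT (suc h) ⊗ FT (2 + h) ⇒ unit ⊕ (varTy ⊗ (FT (suc h) ⊗ FT (suc h)))
  resolventᶠ s = firstᶠ (resolventOnᶠ s) ∘ᶠ ⟅ idᶠ , leavesᶠ (2 + h) ∘ᶠ π₂ ⟆

-- The recursion is on the height, which is fixed for a program, so the nested searches stay
-- polynomial. The sign is `true` for terms of conjunctions and `false` for terms of disjunctions.
availableᶠ : ∀ h → Bool → FT h ⊗ FT (suc h) ⇒ bool
availableᶠ zero s = eitherᶠ (eqᶠ leafTy ∘ᶠ ⟅ π₁ , constᶠ s ⟆) (foundᶠ (firstᶠ (guardᶠ (eqᶠ leafTy))))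
availableᶠ (suc h) s = eitherᶠ (eqᶠ (FT (suc h)) ∘ᶠ ⟅ π₁ , padᶠ (suc h) ∘ᶠ constᶠ s ⟆)
  (eitherᶠ (foundᶠ (termᶠ h (availableᶠ h (not s)) ∘ᶠ ⟅ constᶠ (not s) , idᶠ ⟆))
           (foundᶠ (resolventᶠ h (availableᶠ h (not s)) s)))

-- Moves

-- A query is a variable, to be evaluated by the players, together with the
-- outcomes for the values true and false.
queryTy decTy : Ty → Ty
queryTy A = varTy ⊗ (A ⊗ A)
decTy A = (unit ⊕ labelTy) ⊕ A

verdictTy : Ty
verdictTy = unit ⊕ labelTy

goᶠ : G ⇒ A → G ⇒ queryTy A
goᶠ f = ⟅ ι₁ ∘ᶠ nilᶠ , ⟅ f , f ⟆ ⟆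

mapQueryᶠ : G ⊗ A ⇒ B → G ⇒ queryTy A → G ⇒ queryTy B
mapQueryᶠ f e = ⟅ π₁ ∘ᶠ e , ⟅ f ∘ᶠ ⟅ idᶠ , π₁ ∘ᶠ π₂ ∘ᶠ e ⟆ , f ∘ᶠ ⟅ idᶠ , π₂ ∘ᶠ π₂ ∘ᶠ e ⟆ ⟆ ⟆

undecidedᶠ : G ⊗ A ⇒ B → G ⊗ decTy A ⇒ decTy B
undecidedᶠ f = caseᶠ π₂ (ι₁ ∘ᶠ π₂) (ι₂ ∘ᶠ f ∘ᶠ ⟅ π₁ ∘ᶠ π₁ , π₂ ⟆)

blameᶠ : litTy ⇒ labelTy
blameᶠ = ι₁ ∘ᶠ caseᶠ π₂ (boolᶠ false) (caseᶠ π₂ (boolᶠ true) (boolᶠ false))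

-- A clause whose literals have all been claimed to be false is to be lost by the player whose CNF
-- contains it. One literal tells which CNF that is: a z-variable occurs positively only in the
-- first and negatively only in the second.
clauseLabelᶠ : litTy ⇒ labelTy
clauseLabelᶠ = ι₁ ∘ᶠ caseᶠ π₂ (boolᶠ false) (caseᶠ π₂ (boolᶠ true) (ifᶠ (π₁ ∘ᶠ π₁ ∘ᶠ π₁) (boolᶠ false) (boolᶠ true)))

-- The case of a literal for which no term is found, since a pivot has used it up. At the lowest
-- height two claims contradict each other and the owner is blamed; higher up a constant takes the
-- place of the literal, and the next round returns from the constant to the literal.
conflictᶠ : ∀ h → Bool → G ⊗ litTy ⇒ queryTy (decTy (FT (suc h)))
conflictᶠ zero    s = goᶠ (ι₁ ∘ᶠ ι₂ ∘ᶠ blameᶠ ∘ᶠ π₂)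
conflictᶠ (suc h) s = goᶠ (ι₂ ∘ᶠ padᶠ (2 + h) ∘ᶠ constᶠ s)

selectᶠ : ∀ h → Bool → FT (suc h) ⊗ FT (2 + h) ⇒ queryTy (decTy (FT (suc h)))
selectᶠ h s =
  ifᶠ (eqᶠ (FT (suc h)) ∘ᶠ ⟅ π₁ , padᶠ (suc h) ∘ᶠ constᶠ s ⟆)
    (goᶠ (ι₂ ∘ᶠ padᶠ (suc h) ∘ᶠ constᶠ s))
    (caseᶠ (termᶠ h (availableᶠ h (not s)) ∘ᶠ ⟅ constᶠ (not s) , idᶠ ⟆)
      (caseᶠ (resolventᶠ h (availableᶠ h (not s)) s ∘ᶠ π₁)
        -- With neither a term nor a resolvent, `D′` is a literal used up by a pivot or the constant
        -- that has replaced one. In the latter case the head of `C` is that literal.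
        (caseᶠ (leafOfᶠ (suc h) ∘ᶠ π₁ ∘ᶠ π₁ ∘ᶠ π₁)
          (conflictᶠ h s)
          (goᶠ (ι₂ ∘ᶠ headᶠ (suc h) ∘ᶠ π₂ ∘ᶠ π₁ ∘ᶠ π₁ ∘ᶠ π₁)))
        ⟅ π₁ ∘ᶠ π₂ , ⟅ ι₂ ∘ᶠ π₁ ∘ᶠ π₂ ∘ᶠ π₂ , ι₂ ∘ᶠ π₂ ∘ᶠ π₂ ∘ᶠ π₂ ⟆ ⟆)
      (goᶠ (ι₂ ∘ᶠ π₂)))

-- The summand in which a position lies is its height, and so tells a transition to which round the
-- position belongs.
Low : ℕ → Ty
Low zero    = FT 0
Low (suc n) = FT (suc n) ⊕ Low n

topᶠ : ∀ n → FT n ⇒ Low n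
topᶠ zero    = idᶠ
topᶠ (suc n) = ι₁

noneᶠ : ∀ n → G ⇒ Low n
noneᶠ zero    = constᶠ false
noneᶠ (suc n) = ι₂ ∘ᶠ noneᶠ n

-- A target that is more than one level above the source is forgotten; the source is then copied, as
-- it is for a target that is too low.
lowerᶠ : ∀ n → Low (suc n) ⇒ Low n
lowerᶠ n = caseᶠ idᶠ (noneᶠ n) π₂

-- At the height n the positions have the sign s, and a play arriving there
-- has just turned around if t is true.
topMoveᶠ : ∀ n (s t : Bool) → (Low (2 + n) ⊗ Low (suc n)) ⊗ FT (suc n) ⇒ queryTy (decTy (Low (suc n)))
topMoveᶠ n s true  = goᶠ (ι₂ ∘ᶠ ι₂ ∘ᶠ topᶠ n ∘ᶠ headᶠ n ∘ᶠ π₂)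
topMoveᶠ n s false = caseᶠ (π₁ ∘ᶠ π₁)
  (mapQueryᶠ (undecidedᶠ (ι₁ ∘ᶠ π₂)) (selectᶠ n s ∘ᶠ ⟅ π₂ ∘ᶠ π₁ , π₂ ⟆))
  (goᶠ (ι₂ ∘ᶠ ι₁ ∘ᶠ π₂ ∘ᶠ π₁))

lowMoveᶠ : ∀ n (s t : Bool) → Low (suc n) ⊗ Low n ⇒ queryTy (decTy (Low n))
lowMoveᶠ zero    s t = goᶠ (ι₂ ∘ᶠ π₂)
lowMoveᶠ (suc n) s t = caseᶠ π₂ (topMoveᶠ n s t)
  (mapQueryᶠ (undecidedᶠ (ι₂ ∘ᶠ π₂)) (lowMoveᶠ n (not s) (not t) ∘ᶠ ⟅ lowerᶠ (suc n) ∘ᶠ π₁ ∘ᶠ π₁ , π₂ ⟆))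

lowLeafᶠ : ∀ n → Low n ⇒ leafTy
lowLeafᶠ zero    = idᶠ
lowLeafᶠ (suc n) = caseᶠ idᶠ (leafOfᶠ (suc n) ∘ᶠ π₂) (lowLeafᶠ n ∘ᶠ π₂)

-- The padded constants are included because a move may put one in the place of a term.
childrenᶠ : ∀ h → list (FT (suc h)) ⇒ list (FT h)
childrenᶠ h = consᶠ ∘ᶠ ⟅ padᶠ h ∘ᶠ constᶠ false , consᶠ ∘ᶠ ⟅ padᶠ h ∘ᶠ constᶠ true , concatᶠ ⟆ ⟆

lowsᶠ : ∀ n → list (FT n) ⇒ list (Low n)
lowsᶠ zero    = idᶠ
lowsᶠ (suc n) = appendᶠ ∘ᶠ ⟅ onList (mapᶠ (ι₁ ∘ᶠ π₂)) , onList (mapᶠ (ι₂ ∘ᶠ π₂)) ∘ᶠ lowsᶠ n ∘ᶠ childrenᶠ n ⟆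

isRight : Direction → Bool
isRight rightward = true
isRight leftward  = false

module _ (r : G ⇒ A) (l : H ⇒ B) (c : A ⇒ C) (s : (A ⊗ B) ⊗ C ⇒ K) where

  Assembly : Ty → Set
  Assembly X = Σ[ f ∈ H ⊗ (X ⊗ G) ⇒ K ] (∀ x {y g a b v} → fun r g ≡ a → fun l y ≡ b → fun c a ≡ v → run (prog f) (y , (x , g)) ≡ fun s ((a , b) , v))

  -- Opaque, so that the program is never evaluated in conversion checks.
  abstract
    assemble : ∀ X → Assembly X
    assemble X = assembled , λ { x {y} {g} refl refl refl → correct assembled (y , (x , g)) }
      where
      assembled : H ⊗ (X ⊗ G) ⇒ K
      assembled = s ∘ᶠ ⟅ idᶠ , c ∘ᶠ π₁ ⟆ ∘ᶠ ⟅ r ∘ᶠ π₂ ∘ᶠ π₂ , l ∘ᶠ π₁ ⟆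

-- The program that computes the schema

module Machine (j : ℕ) where

  k : ℕ
  k = 2 + j

  -- A station is a verdict or a position: the initial one, one of the first
  -- round (the formulas still to be visited, and a clause), or a later one.
  positionTy stationTy codeTy : Ty
  positionTy = list (FT k) ⊕ ((list (FT k) ⊗ FT (suc j)) ⊕ Low j)
  stationTy  = decTy positionTy
  codeTy     = stationTy ⊕ (bool ⊗ stationTy)

  first-roundᶠ : G ⇒ list (FT k) → G ⇒ FT (suc j) → G ⇒ stationTy
  first-roundᶠ e f = ι₂ ∘ᶠ ι₂ ∘ᶠ ι₁ ∘ᶠ ⟅ e , f ⟆

  scanContext : Ty
  scanContext = (list (FT k) ⊗ FT (suc j)) ⊗ (FT j ⊗ list (FT j))

  -- The clause has been cut down to a suffix whose head is the literal claimed to be true. A turn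
  -- descends into the head, so the next round starts with this literal. The empty route makes the
  -- clause stay until the round ends.
  acceptᶠ : scanContext ⇒ stationTy
  acceptᶠ = first-roundᶠ nilᶠ (π₂ ∘ᶠ π₁)

  advanceᶠ : scanContext ⊗ verdictTy ⇒ stationTy
  advanceᶠ = caseListᶠ (π₂ ∘ᶠ π₂ ∘ᶠ π₁) (ι₁ ∘ᶠ π₂) (first-roundᶠ (π₁ ∘ᶠ π₁ ∘ᶠ π₁) (π₂ ∘ᶠ π₂ ∘ᶠ π₁) ∘ᶠ π₁)

  scanᶠ : list (FT k) ⊗ FT (suc j) ⇒ queryTy stationTy
  scanᶠ = caseListᶠ π₂ (goᶠ (first-roundᶠ π₁ π₂))
    (caseᶠ (leafOfᶠ j ∘ᶠ π₁ ∘ᶠ π₂)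
      (ifᶠ (π₁ ∘ᶠ π₂)
        ⟅ π₂ ∘ᶠ π₂ , ⟅ acceptᶠ ∘ᶠ π₁ , rejectᶠ ⟆ ⟆
        ⟅ π₂ ∘ᶠ π₂ , ⟅ rejectᶠ , acceptᶠ ∘ᶠ π₁ ⟆ ⟆)
      -- The constant true pads an empty conjunction or is the neutral clause. The constant false
      -- pads an empty clause, which has no literal to show its origin, so its verdict is left open
      -- as `inj₁ tt`.
      (ifᶠ π₂ (goᶠ (acceptᶠ ∘ᶠ π₁)) (goᶠ (advanceᶠ ∘ᶠ ⟅ π₁ , ι₁ ∘ᶠ !ᶠ ⟆))))
    where
    rejectᶠ : scanContext ⊗ litTy ⇒ stationTy
    rejectᶠ = advanceᶠ ∘ᶠ ⟅ π₁ , ι₂ ∘ᶠ clauseLabelᶠ ∘ᶠ π₂ ⟆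

  firstMoveᶠ : list (FT k) ⊗ FT (suc j) ⇒ queryTy stationTy
  firstMoveᶠ = caseListᶠ π₁ (goᶠ (first-roundᶠ π₁ π₂))
    (caseListᶠ (π₁ ∘ᶠ π₂) (scanᶠ ∘ᶠ ⟅ π₂ ∘ᶠ π₂ , π₂ ∘ᶠ π₁ ⟆)
      (mapQueryᶠ (undecidedᶠ (ι₂ ∘ᶠ ι₁ ∘ᶠ ⟅ π₂ ∘ᶠ π₂ ∘ᶠ π₁ , π₂ ⟆)) (selectᶠ j true ∘ᶠ ⟅ π₂ ∘ᶠ π₁ , π₁ ∘ᶠ π₂ ⟆) ∘ᶠ π₁))

  viewᶠ : stationTy ⇒ Low (suc j)
  viewᶠ = caseᶠ idᶠ (noneᶠ (suc j)) (caseᶠ π₂ (noneᶠ (suc j)) (caseᶠ π₂ (ι₁ ∘ᶠ π₂ ∘ᶠ π₂) (ι₂ ∘ᶠ π₂)))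

  moveᶠ : Direction → stationTy ⊗ stationTy ⇒ queryTy stationTy
  moveᶠ d = caseᶠ π₂ (goᶠ (ι₁ ∘ᶠ π₂)) (caseᶠ π₂
    (caseListᶠ π₂ (goᶠ (ι₂ ∘ᶠ ι₁ ∘ᶠ π₂)) (goᶠ (first-roundᶠ (π₂ ∘ᶠ π₂) (headᶠ (suc j) ∘ᶠ π₁ ∘ᶠ π₂))))
    (caseᶠ π₂ (pos1 d)
      -- Height `j` belongs to the second round, with the sign `false`; a rightward move from such a
      -- position is therefore one that has just turned around.
      (mapQueryᶠ (undecidedᶠ (ι₂ ∘ᶠ ι₂ ∘ᶠ π₂)) (lowMoveᶠ j false (isRight d) ∘ᶠ ⟅ viewᶠ ∘ᶠ π₁ ∘ᶠ π₁ ∘ᶠ π₁ ∘ᶠ π₁ , π₂ ⟆))))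
    where
    pos1 : Direction → G ⊗ (list (FT k) ⊗ FT (suc j)) ⇒ queryTy stationTy
    pos1 rightward = firstMoveᶠ ∘ᶠ π₂
    pos1 leftward  = goᶠ (ι₂ ∘ᶠ ι₂ ∘ᶠ ι₂ ∘ᶠ topᶠ j ∘ᶠ headᶠ j ∘ᶠ π₂ ∘ᶠ π₂)

  -- Player I moves first; his bit is part of the input, Player II's is h.
  answerᶠ : Bool → bool ⊗ queryTy stationTy ⇒ stationTy
  answerᶠ h = caseᶠ (π₁ ∘ᶠ π₂) (ifᶠ (π₁ ∘ᶠ π₁) (π₁ ∘ᶠ π₂ ∘ᶠ π₂ ∘ᶠ π₁) (π₂ ∘ᶠ π₂ ∘ᶠ π₂ ∘ᶠ π₁))
    (caseᶠ π₂ (byII h ∘ᶠ π₁ ∘ᶠ π₁)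
      (ifᶠ (π₁ ∘ᶠ π₁ ∘ᶠ π₁) (challenge h) (π₂ ∘ᶠ π₂ ∘ᶠ π₂ ∘ᶠ π₁ ∘ᶠ π₁)))
    where
    byII : Bool → bool ⊗ queryTy stationTy ⇒ stationTy
    byII true  = π₁ ∘ᶠ π₂ ∘ᶠ π₂
    byII false = π₂ ∘ᶠ π₂ ∘ᶠ π₂
    challenge : Bool → ((bool ⊗ queryTy stationTy) ⊗ (bits ⊕ bits)) ⊗ bits ⇒ stationTy
    challenge true  = ι₁ ∘ᶠ ι₂ ∘ᶠ ι₂ ∘ᶠ π₂
    challenge false = π₁ ∘ᶠ π₂ ∘ᶠ π₂ ∘ᶠ π₁ ∘ᶠ π₁

  stationᶠ : codeTy ⇒ stationTy
  stationᶠ = caseᶠ idᶠ π₂ (π₂ ∘ᶠ π₂)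

  -- A query takes two moves. The first stores the bit of Player I together with the station being
  -- left; the second adds the bit of Player II and evaluates the query.
  stepᶠ : Direction → Bool → codeTy ⊗ codeTy ⇒ codeTy
  stepᶠ d h = caseᶠ π₂ (ι₂ ∘ᶠ ⟅ boolᶠ h , π₂ ⟆)
    (ι₁ ∘ᶠ answerᶠ h ∘ᶠ ⟅ π₁ ∘ᶠ π₂ , moveᶠ d ∘ᶠ ⟅ stationᶠ ∘ᶠ π₁ ∘ᶠ π₁ , π₂ ∘ᶠ π₂ ⟆ ⟆)

  zlabelᶠ : leafTy ⇒ verdictTy
  zlabelᶠ = caseᶠ idᶠ (caseᶠ (π₂ ∘ᶠ π₂) (ι₁ ∘ᶠ !ᶠ) (caseᶠ π₂ (ι₁ ∘ᶠ !ᶠ) (ι₂ ∘ᶠ ι₂ ∘ᶠ π₂))) (ι₁ ∘ᶠ !ᶠ)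

  verdictsᶠ : list (FT k) ⇒ list verdictTy
  verdictsᶠ = consᶠ ∘ᶠ ⟅ ι₁ ∘ᶠ !ᶠ , consᶠ ∘ᶠ ⟅ ι₂ ∘ᶠ ι₁ ∘ᶠ boolᶠ false , consᶠ ∘ᶠ ⟅ ι₂ ∘ᶠ ι₁ ∘ᶠ boolᶠ true ,
    onList (mapᶠ (zlabelᶠ ∘ᶠ π₂)) ∘ᶠ leavesᶠ (suc k) ⟆ ⟆ ⟆

  clausesᶠ : list (FT k) ⇒ list (FT (suc j))
  clausesᶠ = concatᶠ ∘ᶠ onList (mapᶠ (suffixesᶠ ∘ᶠ π₂)) ∘ᶠ childrenᶠ (suc j)

  stationsᶠ : list (FT k) ⇒ list stationTy
  stationsᶠ = appendᶠ ∘ᶠ ⟅ onList (mapᶠ (ι₁ ∘ᶠ π₂)) ∘ᶠ verdictsᶠ , onList (mapᶠ (ι₂ ∘ᶠ π₂)) ∘ᶠ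
    consᶠ ∘ᶠ ⟅ ι₁ , appendᶠ ∘ᶠ
      ⟅ concatᶠ ∘ᶠ mapᶠ (mapᶠ (ι₂ ∘ᶠ ι₁ ∘ᶠ ⟅ π₂ ∘ᶠ π₁ , π₂ ⟆) ∘ᶠ ⟅ idᶠ , clausesᶠ ∘ᶠ π₁ ⟆) ∘ᶠ ⟅ idᶠ , suffixesᶠ ⟆
      , onList (mapᶠ (ι₂ ∘ᶠ ι₂ ∘ᶠ π₂)) ∘ᶠ lowsᶠ j ∘ᶠ childrenᶠ j ∘ᶠ clausesᶠ ⟆ ⟆ ⟆

  codesᶠ : list (FT k) ⇒ list codeTy
  codesᶠ = appendᶠ ∘ᶠ ⟅ onList (mapᶠ (ι₁ ∘ᶠ π₂)) , appendᶠ ∘ᶠ ⟅ middle false , middle true ⟆ ⟆ ∘ᶠ stationsᶠ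
    where
    middle : Bool → list stationTy ⇒ list codeTy
    middle h = onList (mapᶠ (ι₂ ∘ᶠ ⟅ boolᶠ h , π₂ ⟆))

  blameLeafᶠ : leafTy ⇒ labelTy
  blameLeafᶠ = caseᶠ idᶠ (blameᶠ ∘ᶠ π₂) (ι₁ ∘ᶠ boolᶠ false)

  labelOfᶠ : bool ⊗ stationTy ⇒ labelTy
  labelOfᶠ = caseᶠ π₂ (caseᶠ π₂ (ι₁ ∘ᶠ π₁ ∘ᶠ π₁ ∘ᶠ π₁) π₂)
    (caseᶠ π₂ (ι₁ ∘ᶠ boolᶠ false) (blameLeafᶠ ∘ᶠ caseᶠ π₂ (leafOfᶠ (suc j) ∘ᶠ π₂ ∘ᶠ π₂) (lowLeafᶠ j ∘ᶠ π₂)))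

  -- An empty formula stands for a station at which a clause is scanned.
  routeᶠ : list (FT k) ⇒ list (FT k)
  routeᶠ = appendᶠ ∘ᶠ ⟅ reverseᶠ , consᶠ ∘ᶠ ⟅ nilᶠ , onList (mapᶠ nilᶠ) ∘ᶠ concatᶠ ∘ᶠ concatᶠ ⟆ ⟆

  -- Decides the open verdict of an empty clause. If the first CNF contains an empty clause, it is
  -- unsatisfiable and Player I may lose; otherwise the clause that was met comes from the second
  -- CNF, and Player II loses.
  emptyLabelᶠ : cnfTy ⇒ bool
  emptyLabelᶠ = ifᶠ (foundᶠ (onList (firstᶠ (guardᶠ (emptyᶠ ∘ᶠ π₂))))) (boolᶠ false) (boolᶠ true)

  -- Two squares for each formula of the route and one more: with an odd number of squares, rounds
  -- in both directions begin with a move of Player I.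
  squaresᶠ : list (FT k) ⇒ unary
  squaresᶠ = consᶠ ∘ᶠ ⟅ !ᶠ , concatᶠ ∘ᶠ onList (mapᶠ (consᶠ ∘ᶠ ⟅ !ᶠ , consᶠ ∘ᶠ ⟅ !ᶠ , nilᶠ ⟆ ⟆)) ⟆

  tableᶠ : codeTy ⊗ codeTy ⇒ codeTy → list codeTy ⇒ tableTy
  tableᶠ f = mapᶠ (mapᶠ (positionᶠ ∘ᶠ ⟅ f ∘ᶠ ⟅ π₂ ∘ᶠ π₁ , π₂ ⟆ , π₁ ∘ᶠ π₁ ⟆) ∘ᶠ ⟅ idᶠ , π₁ ⟆) ∘ᶠ ⟅ idᶠ , idᶠ ⟆

  schemaOfᶠ : (list (FT k) ⊗ bool) ⊗ list codeTy ⇒ schemaTy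
  schemaOfᶠ = ⟅ squaresᶠ ∘ᶠ π₁ ∘ᶠ π₁ , ⟅ onList (mapᶠ !ᶠ) ∘ᶠ π₂ , ⟅ positionᶠ ∘ᶠ ⟅ ι₁ ∘ᶠ ι₂ ∘ᶠ ι₁ ∘ᶠ π₁ ∘ᶠ π₁ , π₂ ⟆ ,
    ⟅ ⟅ right false , right true ⟆ , ⟅ ⟅ left false , left true ⟆ ,
      mapᶠ (labelᶠ ∘ᶠ ⟅ π₂ ∘ᶠ π₁ , π₂ ⟆) ∘ᶠ ⟅ π₁ , π₂ ⟆ ⟆ ⟆ ⟆ ⟆ ⟆
    where
    right left : Bool → (list (FT k) ⊗ bool) ⊗ list codeTy ⇒ tableTy
    -- The rows of a table belong to the left square, which is the source of a rightward and the
    -- target of a leftward move, whereas `stepᶠ` expects the target first.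
    right h = tableᶠ (stepᶠ rightward h ∘ᶠ ⟅ π₂ , π₁ ⟆) ∘ᶠ π₂
    left  h = tableᶠ (stepᶠ leftward h) ∘ᶠ π₂
    labelᶠ : bool ⊗ codeTy ⇒ labelTy
    labelᶠ = labelOfᶠ ∘ᶠ ⟅ π₁ , stationᶠ ∘ᶠ π₂ ⟆

  machine : Assembly routeᶠ emptyLabelᶠ codesᶠ schemaOfᶠ cnfTy
  machine = assemble routeᶠ emptyLabelᶠ codesᶠ schemaOfᶠ cnfTy

-- Derivability between encoded formulas

F : ℕ → Set
F h = ⟦ FT h ⟧

padE : ∀ h → ⟦ leafTy ⟧ → F h
padE h = fun (padᶠ h)

neutral : Bool → ⟦ leafTy ⟧
neutral s = inj₂ (encodeBool s)

literal : Bool → ⟦ varTy ⟧ → ⟦ leafTy ⟧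
literal b v = inj₁ (encodeBool b , v)

leaves : ∀ h → F h → List ⟦ leafTy ⟧
leaves h = fun (leavesᶠ h)

leaves-child : ∀ h {l E D} → E ∈ D → l ∈ leaves h E → l ∈ leaves (suc h) D
leaves-child h m l∈ = ∈-concat⁺′ l∈ (∈-map⁺ (leaves h) m)

leaves-child⁻ : ∀ h {l} D → l ∈ leaves (suc h) D → ∃[ E ] (E ∈ D × l ∈ leaves h E)
leaves-child⁻ h D l∈ with xs , l∈xs , xs∈ ← ∈-concat⁻′ (map (leaves h) D) l∈
                     with E , E∈D , refl ← ∈-map⁻ (leaves h) xs∈ = E , E∈D , l∈xs

leaves-pad : ∀ h l → leaves h (padE h l) ≡ l ∷ []
leaves-pad zero    l = refl
leaves-pad (suc h) l rewrite leaves-pad h l = refl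

-- Avail h s D C: the formula D of height h can be replaced by a member of
-- C, possibly after querying a variable.
record Avail h (s : Bool) (D : F h) (C : F (suc h)) : Set where
  constructor avail
  field isAvail : IsYes (fun (availableᶠ h s) (D , C))

open Avail

record Rel h (s : Bool) (l : ⟦ leafTy ⟧) (D′ D : F (suc h)) : Set where
  constructor rel
  field isRel : IsYes (fun (relatedᶠ h (availableᶠ h (not s))) ((l , D′) , D))

open Rel

term : ∀ h → Bool → ⟦ leafTy ⟧ × (F (suc h) × F (2 + h)) → ⊤ ⊎ F (suc h)
term h s = fun (termᶠ h (availableᶠ h (not s)))

resolvent : ∀ h → Bool → F (suc h) × F (2 + h) → ⊤ ⊎ (⟦ varTy ⟧ × (F (suc h) × F (suc h)))
resolvent h s = fun (resolventᶠ h (availableᶠ h (not s)) s)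

Term : ∀ h → Bool → ⟦ leafTy ⟧ → F (suc h) → F (2 + h) → F (suc h) → Set
Term h s l D′ C D = term h s (l , (D′ , C)) ≡ inj₂ D

Resolvent : ∀ h → Bool → F (suc h) → F (2 + h) → ⟦ varTy ⟧ → F (suc h) → F (suc h) → Set
Resolvent h s D′ C v Dₜ D_f = resolvent h s (D′ , C) ≡ inj₂ (v , (Dₜ , D_f))

Rel⁻ : ∀ h s {l D′ D E} → Rel h s l D′ D → E ∈ D → E ≡ padE h l ⊎ Avail h (not s) E D′
Rel⁻ h s {l} {D′} {D} {E} r m with either-yes (same (FT h) E (padE h l)) (every-∈ _ (isRel r) m)
... | inj₁ e = inj₁ (same-sound (FT h) e)
... | inj₂ a = inj₂ (avail a)

Rel⁺ : ∀ h s {l D′} D → (∀ {E} → E ∈ D → E ≡ padE h l ⊎ Avail h (not s) E D′) → Rel h s l D′ D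
Rel⁺ h s {l} {D′} D f = rel (∈-every _ D λ m → one (f m))
  where
  one : ∀ {E} → E ≡ padE h l ⊎ Avail h (not s) E D′ →
        IsYes (either (same (FT h) E (padE h l)) (fun (availableᶠ h (not s)) (E , D′)))
  one (inj₁ refl) rewrite same-refl (FT h) (padE h l) = refl
  one {E} (inj₂ (avail a)) = eitherʳ (same (FT h) E (padE h l)) a

Term⁻ : ∀ h s {l D′ C D} → Term h s l D′ C D → D ∈ C × Rel h s l D′ D
Term⁻ h s {l} {D′} {C} e with first-just (λ x → guard (fun (relatedᶠ h (availableᶠ h (not s))) ((l , D′) , x)) x) C e
... | x , m , g with r , refl ← guard-just (fun (relatedᶠ h (availableᶠ h (not s))) ((l , D′) , x)) g = m , rel r

Term⁺ : ∀ h s {l D′ C D} → D ∈ C → Rel h s l D′ D → ∃[ D₁ ] Term h s l D′ C D₁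
Term⁺ h s {D = D} m r = first-complete _ m (cong (λ b → guard b D) (isRel r))

both-found : ∀ {S T U : Set} (x : ⊤ ⊎ S) (y : ⊤ ⊎ T) {f : S → T → U} {r} →
             [ (λ _ → inj₁ tt) , (λ a → [ (λ _ → inj₁ tt) , (λ b → inj₂ (f a b)) ]′ y) ]′ x ≡ inj₂ r →
             ∃[ a ] ∃[ b ] (x ≡ inj₂ a × y ≡ inj₂ b × f a b ≡ r)
both-found (inj₂ a) (inj₂ b) refl = a , b , refl , refl , refl

Resolvent⁻ : ∀ h s {D′ C v Dₜ D_f} → Resolvent h s D′ C v Dₜ D_f →
             (∃[ b ] inj₁ (b , v) ∈ leaves (2 + h) C)
             × Term h s (literal (not s) v) D′ C Dₜ × Term h s (literal s v) D′ C D_f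
Resolvent⁻ h s {D′} {C} e
  with first-just (λ l → fun (resolventOnᶠ h (availableᶠ h (not s)) s) ((D′ , C) , l)) (leaves (2 + h) C) e
... | inj₁ (b , v) , m , g
  with Dₜ , D_f , t , f , refl ← both-found (term h s (literal (not s) v , (D′ , C)))
                                           (term h s (literal s v , (D′ , C))) g
  = (b , m) , t , f

avail-neutral : ∀ h s C → Avail h s (padE h (neutral s)) C
avail-neutral zero    s C = avail (neutral-found)
  where
  neutral-found : IsYes (fun (availableᶠ zero s) (neutral s , C))
  neutral-found rewrite same-refl leafTy (neutral s) = refl
avail-neutral (suc h) s C = avail (neutral-found)
  where
  neutral-found : IsYes (fun (availableᶠ (suc h) s) (padE (suc h) (neutral s) , C))
  neutral-found rewrite same-refl (FT (suc h)) (padE (suc h) (neutral s)) = refl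

avail-rel : ∀ h s {D′ C D} → D ∈ C → Rel h s (neutral (not s)) D′ D → Avail (suc h) s D′ C
avail-rel h s {D′} {C} m r with D₁ , t ← Term⁺ h s {neutral (not s)} {D′} {C} m r =
  avail (eitherʳ (same (FT (suc h)) D′ (padE (suc h) (neutral s))) found-term)
  where
  found-term : IsYes (either (found (term h s (neutral (not s) , (D′ , C))))
                             (found (resolvent h s (D′ , C))))
  found-term rewrite t = refl

avail-resolvent : ∀ h s {D′ C b v Dₜ D_f} → inj₁ (b , v) ∈ leaves (2 + h) C →
                  Dₜ ∈ C → Rel h s (literal (not s) v) D′ Dₜ →
                  D_f ∈ C → Rel h s (literal s v) D′ D_f → Avail (suc h) s D′ C
avail-resolvent h s {D′} {C} {b} {v} m mₜ rₜ m_f r_f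
  with D₁ , t₁ ← Term⁺ h s {literal (not s) v} {D′} {C} mₜ rₜ | D₂ , t₂ ← Term⁺ h s {literal s v} {D′} {C} m_f r_f
  = avail (eitherʳ (same (FT (suc h)) D′ (padE (suc h) (neutral s)))
      (eitherʳ (found (term h s (neutral (not s) , (D′ , C)))) (found-resolvent (first-complete _ m on-v))))
  where
  on-v : fun (resolventOnᶠ h (availableᶠ h (not s)) s) ((D′ , C) , inj₁ (b , v)) ≡ inj₂ (v , (D₁ , D₂))
  on-v rewrite t₁ | t₂ = refl
  found-resolvent : ∃[ r ] (resolvent h s (D′ , C) ≡ inj₂ r) →
                    IsYes (found (resolvent h s (D′ , C)))
  found-resolvent (r , eq) = cong found eq

avail-self : ∀ h s {D C} → D ∈ C → Avail h s D C
avail-self zero s {D} {C} m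
  with _ , e ← first-complete (λ x → guard (same leafTy D x) x) m (cong (λ b → guard b D) (same-refl leafTy D)) =
  avail (eitherʳ (same leafTy D (neutral s)) (cong found e))
avail-self (suc h) s {D} m = avail-rel h s m (Rel⁺ h s D λ m′ → inj₂ (avail-self h (not s) m′))

-- The rules of the calculus

Extends : ∀ h → Bool → F (suc h) → F (suc h) → Set
Extends h s P Q = ∀ {E} → E ∈ Q → Avail h s E P

avail-extends : ∀ h s {D′ C D} → D ∈ C → Extends h (not s) D′ D → Avail (suc h) s D′ C
avail-extends h s {D = D} m e = avail-rel h s m (Rel⁺ h s D λ m′ → inj₂ (e m′))

∈-++-delete : ∀ {S : Set} (us : List S) {x y ws} → y ∈ us ++ x ∷ ws → y ≡ x ⊎ y ∈ us ++ ws
∈-++-delete []       (here e)  = inj₁ e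
∈-++-delete []       (there m) = inj₂ m
∈-++-delete (u ∷ us) (here e)  = inj₂ (here e)
∈-++-delete (u ∷ us) (there m) with ∈-++-delete us m
... | inj₁ e = inj₁ e
... | inj₂ n = inj₂ (there n)

∈-++-insert : ∀ {S : Set} (us : List S) {x y ws} → y ∈ us ++ ws → y ∈ us ++ x ∷ ws
∈-++-insert []       m         = there m
∈-++-insert (u ∷ us) (here e)  = here e
∈-++-insert (u ∷ us) (there m) = there (∈-++-insert us m)

∈-middle : ∀ {S : Set} (us : List S) {x ws} → x ∈ us ++ x ∷ ws
∈-middle us = ∈-++⁺ʳ us (here refl)

∈-++-unclone : ∀ {S : Set} (us : List S) {x y ws} → y ∈ us ++ x ∷ x ∷ ws → y ∈ us ++ x ∷ ws
∈-++-unclone us m with ∈-++-delete us m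
... | inj₁ refl = ∈-middle us
... | inj₂ m′   = m′

toList-++⁺ : ∀ {S : Set} (us : List S) (ws : List⁺ S) → toList (us ++⁺ ws) ≡ us ++ toList ws
toList-++⁺ []       ws = refl
toList-++⁺ (u ∷ us) ws = cong (u ∷_) (toList-++⁺ us ws)

toList-∷ʳ : ∀ {S : Set} (us : List S) x → toList (us ∷ʳ x) ≡ us ++ [ x ]
toList-∷ʳ []       x = refl
toList-∷ʳ (u ∷ us) x = refl

module _ {p q n : ℕ} where

  private
    V : Set
    V = Var p q n

  ⌜_⌝ : ∀ {c m} → Formula V c m → F m
  ⌜_⌝ {m = m} = encodeFormula m

  encode-pad : ∀ {c} m l → ⌜ pad {V} {c} m l ⌝ ≡ padE m (encodeLeaf l)
  encode-pad zero    l = refl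
  encode-pad (suc m) l = cong (_∷ []) (encode-pad m l)

  ⌜⌝⁺ : ∀ {c m} {φ : Formula V c m} {φs} → φ ∈ φs → ⌜ φ ⌝ ∈ map ⌜_⌝ φs
  ⌜⌝⁺ = ∈-map⁺ ⌜_⌝

  Kept : ∀ {m c} → Bool → List (Formula V c m) → Formula V c m → Set
  Kept {m} s φs φ = ⌜ φ ⌝ ≡ padE m (neutral s) ⊎ (φ ∈ φs ⊎ Avail m s ⌜ φ ⌝ (map ⌜_⌝ φs))

  all-available : ∀ {m c} s {φs ψs : List (Formula V c m)} → (∀ {φ} → φ ∈ ψs → Kept s φs φ) →
                  Extends m s (map ⌜_⌝ φs) (map ⌜_⌝ ψs)
  all-available {m} s {φs} f e with φ , φ∈ , refl ← ∈-map⁻ ⌜_⌝ e with f φ∈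
  ... | inj₁ eq rewrite eq = avail-neutral m s _
  ... | inj₂ (inj₁ φ∈φs)   = avail-self m s (⌜⌝⁺ φ∈φs)
  ... | inj₂ (inj₂ a)      = a

  rel-∷ʳ : ∀ {m c} s L (φs : List (Formula V c m)) {D} → (∀ {φ} → φ ∈ φs → ⌜ φ ⌝ ∈ D) →
           Rel m s (encodeLeaf L) D (map ⌜_⌝ (toList (φs ∷ʳ pad m L)))
  rel-∷ʳ {m} s L φs {D} ⊆D = Rel⁺ m s _ member
    where
    member : ∀ {E} → E ∈ map ⌜_⌝ (toList (φs ∷ʳ pad m L)) → E ≡ padE m (encodeLeaf L) ⊎ Avail m (not s) E D
    member e with φ , φ∈ , refl ← ∈-map⁻ ⌜_⌝ e with ∈-++⁻ φs (subst (φ ∈_) (toList-∷ʳ φs _) φ∈)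
    ... | inj₁ φ∈φs        = inj₂ (avail-self m (not s) (⊆D φ∈φs))
    ... | inj₂ (here refl) = inj₁ (encode-pad m L)

  -- Makes the pivot visible to `resolventᶠ`, which tries only variables of leaves.
  literal-leaf : ∀ {m c} l (φs : List (Formula V (dual c) m)) {ψs : List (Formula V c (suc m))} →
                 node (φs ∷ʳ pad m (lit l)) ∈ ψs → inj₁ (encodeLiteral l) ∈ leaves (2 + m) (map ⌜_⌝ ψs)
  literal-leaf {m} l φs m∈ = leaves-child (suc m) (⌜⌝⁺ m∈) (leaves-child m
    (⌜⌝⁺ (subst (pad m (lit l) ∈_) (sym (toList-∷ʳ φs _)) (∈-++⁺ʳ φs (here refl))))
    (subst (_ ∈_) (sym (trans (cong (leaves m) (encode-pad m (lit l))) (leaves-pad m _))) (here refl)))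

  ∈-++⁺-middle : ∀ {S : Set} (us : List S) {x ws y} → y ∈ us ++ ws → y ∈ toList (us ++⁺ (x List⁺.∷ ws))
  ∈-++⁺-middle us {x} {ws} m = subst (_ ∈_) (sym (toList-++⁺ us (x List⁺.∷ ws))) (∈-++-insert us m)

  disj-available : ∀ {m} {φs ψs : List (Formula V ∧ m)} → DisjRule φs ψs → Extends m false (map ⌜_⌝ ψs) (map ⌜_⌝ φs)
  disj-available {m} (permute φs↭ψs)  = all-available false λ φ∈ → inj₂ (inj₁ (∈-resp-↭ φs↭ψs φ∈))
  disj-available (contract us φ ws)   = all-available false λ φ∈ → inj₂ (inj₁ (∈-++-unclone us φ∈))
  disj-available {m} (delete⊥ us ws)  = all-available false λ φ∈ → kept (∈-++-delete us φ∈)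
    where
    kept : ∀ {φ} → φ ≡ pad m `⊥ ⊎ φ ∈ us ++ ws → Kept false (us ++ ws) φ
    kept (inj₁ refl) = inj₁ (encode-pad m `⊥)
    kept (inj₂ m∈)   = inj₂ (inj₁ m∈)
  disj-available (insert us φ ws)     = all-available false λ φ∈ → inj₂ (inj₁ (∈-++-insert us φ∈))
  disj-available {suc m} (dualRes us ws p As Bs) = all-available false λ φ∈ → kept (∈-++-delete us φ∈)
    where
    ψs = us ++ node (As ∷ʳ pad m (lit (pos p))) ∷ node (Bs ∷ʳ pad m (lit (neg p))) ∷ ws
    ∈₁ : node (As ∷ʳ pad m (lit (pos p))) ∈ ψs
    ∈₁ = ∈-middle us
    ∈₂ : node (Bs ∷ʳ pad m (lit (neg p))) ∈ ψs
    ∈₂ = ∈-++-insert us (∈-middle us)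
    kept : ∀ {φ} → φ ≡ node (As ++⁺ (pad m `⊤ List⁺.∷ Bs)) ⊎ φ ∈ us ++ ws →
           Kept false ψs φ
    kept (inj₂ m∈)   = inj₂ (inj₁ (∈-++-insert us (∈-++-insert us m∈)))
    kept (inj₁ refl) = inj₂ (inj₂ (avail-resolvent m false (literal-leaf (pos p) As ∈₁)
      (⌜⌝⁺ ∈₁) (rel-∷ʳ false (lit (pos p)) As λ m∈ → ⌜⌝⁺ (∈-++⁺-middle As (∈-++⁺ˡ m∈)))
      (⌜⌝⁺ ∈₂) (rel-∷ʳ false (lit (neg p)) Bs λ m∈ → ⌜⌝⁺ (∈-++⁺-middle As (∈-++⁺ʳ As m∈)))))

  conj-available : ∀ {m} {φs ψs : List (Formula V ∨ m)} → ConjRule φs ψs → Extends m true (map ⌜_⌝ φs) (map ⌜_⌝ ψs)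
  conj-available (permute φs↭ψs)      = all-available true λ φ∈ → inj₂ (inj₁ (∈-resp-↭ (↭-sym φs↭ψs) φ∈))
  conj-available (clone us φ ws)      = all-available true λ φ∈ → inj₂ (inj₁ (∈-++-unclone us φ∈))
  conj-available {m} (insert⊤ us ws)  = all-available true λ φ∈ → kept (∈-++-delete us φ∈)
    where
    kept : ∀ {φ} → φ ≡ pad m `⊤ ⊎ φ ∈ us ++ ws → Kept true (us ++ ws) φ
    kept (inj₁ refl) = inj₁ (encode-pad m `⊤)
    kept (inj₂ m∈)   = inj₂ (inj₁ m∈)
  conj-available (delete us φ ws)     = all-available true λ φ∈ → inj₂ (inj₁ (∈-++-insert us φ∈))
  conj-available {suc m} (resolve us ws p As Bs) = all-available true λ φ∈ → kept (∈-++-delete us φ∈)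
    where
    φs = us ++ node (As ∷ʳ pad m (lit (pos p))) ∷ node (Bs ∷ʳ pad m (lit (neg p))) ∷ ws
    ∈₁ : node (As ∷ʳ pad m (lit (pos p))) ∈ φs
    ∈₁ = ∈-middle us
    ∈₂ : node (Bs ∷ʳ pad m (lit (neg p))) ∈ φs
    ∈₂ = ∈-++-insert us (∈-middle us)
    kept : ∀ {φ} → φ ≡ node (As ++⁺ (pad m `⊥ List⁺.∷ Bs)) ⊎ φ ∈ us ++ ws →
           Kept true φs φ
    kept (inj₂ m∈)   = inj₂ (inj₁ (∈-++-insert us (∈-++-insert us m∈)))
    -- Compared with dual resolution the two terms change places: if `p` is true, it is the premise
    -- with `neg p` whose falsity follows.
    kept (inj₁ refl) = inj₂ (inj₂ (avail-resolvent m true (literal-leaf (neg p) Bs ∈₂)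
      (⌜⌝⁺ ∈₂) (rel-∷ʳ true (lit (neg p)) Bs λ m∈ → ⌜⌝⁺ (∈-++⁺-middle As (∈-++⁺ʳ As m∈)))
      (⌜⌝⁺ ∈₁) (rel-∷ʳ true (lit (pos p)) As λ m∈ → ⌜⌝⁺ (∈-++⁺-middle As (∈-++⁺ˡ m∈)))))

  -- A conjunction is traced backwards, a disjunction forwards.
  Traceable : Connective → ∀ h → F (suc h) → F (suc h) → Set
  Traceable ∧ h P Q = Extends h true P Q
  Traceable ∨ h P Q = Extends h false Q P

  -- A step inside a term is traced in the opposite direction, that of the dual connective. This is
  -- what `avail-extends` asks for to trace the changed term as a whole.
  step-traceable : ∀ {c h} {φ ψ : Formula V c (suc h)} → Step φ ψ → Traceable c h ⌜ φ ⌝ ⌜ ψ ⌝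
  step-traceable (disj rule) = disj-available rule
  step-traceable (conj rule) = conj-available rule
  step-traceable {∧} {suc h} (inside {φ = φ} {ψ} us ws step) =
    subst₂ (λ φs ψs → Extends (suc h) true (map ⌜_⌝ φs) (map ⌜_⌝ ψs)) (sym (toList-++⁺ us (φ List⁺.∷ ws))) (sym (toList-++⁺ us (ψ List⁺.∷ ws)))
      (all-available true λ χ∈ → kept (∈-++-delete us χ∈))
    where
    kept : ∀ {χ} → χ ≡ ψ ⊎ χ ∈ us ++ ws → Kept true (us ++ φ ∷ ws) χ
    kept (inj₁ refl) = inj₂ (inj₂ (avail-extends h true (⌜⌝⁺ (∈-middle us)) (step-traceable step)))
    kept (inj₂ m∈)   = inj₂ (inj₁ (∈-++-insert us m∈))
  step-traceable {∨} {suc h} (inside {φ = φ} {ψ} us ws step) =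
    subst₂ (λ φs ψs → Extends (suc h) false (map ⌜_⌝ φs) (map ⌜_⌝ ψs)) (sym (toList-++⁺ us (ψ List⁺.∷ ws))) (sym (toList-++⁺ us (φ List⁺.∷ ws)))
      (all-available false λ χ∈ → kept (∈-++-delete us χ∈))
    where
    kept : ∀ {χ} → χ ≡ φ ⊎ χ ∈ us ++ ws → Kept false (us ++ ψ ∷ ws) χ
    kept (inj₁ refl) = inj₂ (inj₂ (avail-extends h false (⌜⌝⁺ (∈-middle us)) (step-traceable step)))
    kept (inj₂ m∈)   = inj₂ (inj₁ (∈-++-insert us m∈))

-- Tracing a formula through a step

truth : ⟦ bool ⟧ → Bool
truth no  = false
truth yes = true

-- The results of the tests of `selectᶠ` are made arguments, so that proofs can match on them
-- without unfolding the searches.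
select-by : ∀ h → Bool → F (2 + h) → ⊤ ⊎ ⊤ → ⊤ ⊎ F (suc h) → ⊤ ⊎ (⟦ varTy ⟧ × (F (suc h) × F (suc h))) →
            ⟦ leafTy ⟧ → ⟦ queryTy (decTy (FT (suc h))) ⟧
select-by h s C b t r l = [ (λ _ → [ (λ _ → [ (λ _ →
    [ (λ l → fun (conflictᶠ {G = unit} h s) (tt , l)) , (λ _ → go (inj₂ (fun (headᶠ (suc h)) C))) ]′ l)
  , (λ x → proj₁ x , (inj₂ (proj₁ (proj₂ x)) , inj₂ (proj₂ (proj₂ x)))) ]′ r) , (λ D → go (inj₂ D)) ]′ t)
  , (λ _ → go (inj₂ (padE (suc h) (neutral s)))) ]′ b
  where
  go : {S : Set} → S → ⟦ varTy ⟧ × (S × S)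
  go x = inj₁ [] , (x , x)

-- Here `conflictᶠ` occurs in two different contexts `G`; the two functions agree once `h` is zero
-- or a successor, hence the split.
select-unfold : ∀ h s D′ C → fun (selectᶠ h s) (D′ , C) ≡
  select-by h s C (same (FT (suc h)) D′ (padE (suc h) (neutral s)))
    (term h s (neutral (not s) , (D′ , C)))
    (resolvent h s (D′ , C)) (fun (leafOfᶠ (suc h)) D′)
select-unfold zero    s D′ C = refl
select-unfold (suc h) s D′ C = refl

-- What an honest player has to ensure: Poss v b means that he can let
-- v = b be claimed, and Win that he wins with a verdict.
record Honesty : Set₁ where
  field
    Poss  : ⟦ varTy ⟧ → Bool → Set
    Win   : ⟦ verdictTy ⟧ → Set
    clash : ∀ b v → Poss v true → Poss v false → Win (inj₂ (fun blameᶠ (b , v)))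

leafOf-pad : ∀ h l → fun (leafOfᶠ h) (padE h l) ≡ l
leafOf-pad zero    l = refl
leafOf-pad (suc h) l = leafOf-pad h l

module Tracing (honesty : Honesty) where

  open Honesty honesty

  -- Positions of sign s = true, those of the odd rounds, are claimed to be
  -- false, the others to be true. A leaf is fine if this can be claimed.
  Fine : Bool → ⟦ leafTy ⟧ → Set
  Fine s (inj₁ (b , v)) = Poss v (truth b xor s)
  Fine s (inj₂ b)       = b ≡ encodeBool (not s)

  fine-true : ∀ s {v} → Poss v true → Fine s (literal (not s) v)
  fine-true false p = p
  fine-true true  p = p

  fine-false : ∀ s {v} → Poss v false → Fine s (literal s v)
  fine-false false p = p
  fine-false true  p = p

  fine-not-not : ∀ s {l} → Fine s l → Fine (not (not s)) l
  fine-not-not s {l} = subst (λ s → Fine s l) (sym (not-involutive s))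

  fine-clash : ∀ s l → Fine s l → Fine (not s) l → ∃[ l′ ] (l ≡ inj₁ l′ × Win (inj₂ (fun blameᶠ l′)))
  fine-clash false (inj₁ (no  , v)) p q = _ , refl , clash no v q p
  fine-clash false (inj₁ (yes , v)) p q = _ , refl , clash yes v p q
  fine-clash true  (inj₁ (no  , v)) p q = _ , refl , clash no v p q
  fine-clash true  (inj₁ (yes , v)) p q = _ , refl , clash yes v q p
  fine-clash false (inj₂ b) refl ()
  fine-clash true  (inj₂ b) refl ()

  -- A position that is a claimed literal is replaced by a constant where its
  -- literal has been claimed in the preceding round, and conversely.
  data Tracked h s (D : F h) (C : F (suc h)) : Set where
    by-avail  : Avail h s D C → Tracked h s D C
    by-claim  : ∀ l → D ≡ padE h (inj₁ l) → Fine (not s) (inj₁ l) → Tracked h s D C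
    by-source : ∀ l → D ≡ padE h (neutral (not s)) → C ≡ padE (suc h) (inj₁ l) → Fine s (inj₁ l) → Tracked h s D C

  -- An edge points against the round that creates it: the next round comes back along it, from a
  -- member of `D` into `D′`.
  Edge : ∀ h → Bool → F (suc h) → F (suc h) → Set
  Edge h s D′ D = ∀ {E} → E ∈ D → Tracked h s E D′

  -- After the last round nothing traces the leaves of a position any more, so it must be possible
  -- to claim them at once.
  LastFine : ∀ h → Bool → F (suc h) → Set
  LastFine zero    s D = ∀ {l} → l ∈ D → Fine s l
  LastFine (suc h) s D = ⊤

  data Chosen {A : Set} (q : ⟦ varTy ⟧ × (A × A)) (w : A) : Set where
    if-true  : w ≡ proj₁ (proj₂ q) → Poss (proj₁ q) true → Chosen q w
    if-false : w ≡ proj₂ (proj₂ q) → Poss (proj₁ q) false → Chosen q w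

  data Traced h s (D′ : F (suc h)) (C : F (2 + h)) : ⟦ decTy (FT (suc h)) ⟧ → Set where
    won   : ∀ {δ} → Win δ → Traced h s D′ C (inj₁ δ)
    moved : ∀ {D} → D ∈ C ⊎ D ≡ padE (suc h) (neutral s) → Edge h (not s) D′ D → LastFine h s D → Traced h s D′ C (inj₂ D)

  chosen-go : ∀ {A : Set} {v} {x w : A} → Chosen (v , (x , x)) w → w ≡ x
  chosen-go (if-true e _)  = e
  chosen-go (if-false e _) = e

  edge-self : ∀ h s D → Edge h s D D
  edge-self h s D m = by-avail (avail-self h s m)

  edge-rel : ∀ h s {l D′ D} → (∀ l′ → l ≡ inj₁ l′ → Fine s l) → (∀ b → l ≡ inj₂ b → l ≡ neutral (not s)) →
             Rel h s l D′ D → Edge h (not s) D′ D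
  edge-rel h s {l} fine const r m with Rel⁻ h s r m
  edge-rel h s {inj₁ l} fine const r m | inj₁ e = by-claim l e (fine-not-not s {inj₁ l} (fine l refl))
  edge-rel h s {inj₂ b} {D′} fine const r m | inj₁ refl rewrite const b refl = by-avail (avail-neutral h (not s) D′)
  ... | inj₂ a = by-avail a

  last-rel : ∀ h s {l D′ D} → Fine s l → Rel h s l D′ D → LastFine h s D′ → LastFine h s D
  last-rel (suc h) s fine r all = tt
  last-rel zero s {l} {D′} fine r all {E} m with Rel⁻ zero s r m
  ... | inj₁ refl = fine
  ... | inj₂ (avail a) with either-yes (same leafTy E (neutral (not s))) a
  ... | inj₁ e = subst (Fine s) (sym (same-sound leafTy {E} {neutral (not s)} e)) refl
  ... | inj₂ f with _ , g ← found-just (first (λ x → guard (same leafTy E x) x) D′) f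
               with x , m′ , g′ ← first-just (λ x → guard (same leafTy E x) x) D′ g
               with e , _ ← guard-just (same leafTy E x) g′ = subst (Fine s) (sym (same-sound leafTy {E} {x} e)) (all m′)

  select-cases : ∀ h s {D′ C w} b t r → same (FT (suc h)) D′ (padE (suc h) (neutral s)) ≡ b →
    term h s (neutral (not s) , (D′ , C)) ≡ t →
    resolvent h s (D′ , C) ≡ r →
    Tracked (suc h) s D′ C → LastFine h s D′ →
    Chosen (select-by h s C b t r (fun (leafOfᶠ (suc h)) D′)) w → Traced h s D′ C w
  select-cases h s {D′} yes t r eb et er tracked last c with refl ← chosen-go c | refl ← same-sound (FT (suc h)) {D′} {padE (suc h) (neutral s)} eb =
    moved (inj₂ refl) (edge-self h (not s) D′) last
  select-cases h s {D′} {C} no (inj₂ D) r eb et er tracked last c with refl ← chosen-go c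
    with D∈ , r′ ← Term⁻ h s {C = C} et =
    moved (inj₁ D∈) (edge-rel h s (λ _ ()) (λ _ _ → refl) r′) (last-rel h s refl r′ last)
  select-cases h s {D′} {C} no no (inj₂ (v , (Dₜ , D_f))) eb et er tracked last c with Resolvent⁻ h s {C = C} er | c
  ... | _ , t , f | if-true refl p with D∈ , r′ ← Term⁻ h s {C = C} t =
    moved (inj₁ D∈) (edge-rel h s (λ _ _ → fine-true s p) (λ _ ()) r′) (last-rel h s (fine-true s p) r′ last)
  ... | _ , t , f | if-false refl p with D∈ , r′ ← Term⁻ h s {C = C} f =
    moved (inj₁ D∈) (edge-rel h s (λ _ _ → fine-false s p) (λ _ ()) r′) (last-rel h s (fine-false s p) r′ last)
  select-cases h s {D′} {C} no no no eb et er (by-avail (avail a)) last c = ⊥-elim (impossible a)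
    where
    impossible : IsYes (fun (availableᶠ (suc h) s) (D′ , C)) → ⊥
    impossible a rewrite eb | et | er with () ← a
  -- `p` is the claim made with the pivot in the preceding round, and `last` gives the opposite one.
  select-cases zero s {D′} {C} no no no eb et er (by-claim l refl p) last c rewrite leafOf-pad 1 (inj₁ l)
    with refl ← chosen-go c with fine-clash s (inj₁ l) (last (here refl)) p
  ... | _ , refl , win = won win
  -- The literal is exchanged for a constant; on the way back the constant will meet its source.
  select-cases (suc h) s {D′} {C} no no no eb et er (by-claim l refl p) last c rewrite leafOf-pad (2 + h) (inj₁ l)
    with refl ← chosen-go c =
    moved (inj₂ refl) (λ { (here refl) → by-source l (cong (λ s → padE (suc h) (neutral s)) (sym (not-involutive s))) refl p }) tt
  -- The converse exchange: the head of `C` is the padded literal `l`, which the following round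
  -- treats as a claim.
  select-cases h s {D′} {C} no no no eb et er (by-source l refl refl p) last c rewrite leafOf-pad (suc h) (neutral (not s))
    with refl ← chosen-go c =
    moved (inj₁ (here refl)) (λ { (here refl) → by-claim l refl (fine-not-not s {inj₁ l} p) }) (last-pad h p)
    where
    last-pad : ∀ h → Fine s (inj₁ l) → LastFine h s (padE (suc h) (inj₁ l))
    last-pad zero    p (here refl) = p
    last-pad (suc h) p = tt

  select-traced : ∀ h s {D′ C w} → Tracked (suc h) s D′ C → LastFine h s D′ →
                  Chosen (fun (selectᶠ h s) (D′ , C)) w → Traced h s D′ C w
  select-traced h s {D′} {C} {w} tracked last c = select-cases h s _ _ _ refl refl refl tracked last
    (subst (λ q → Chosen q w) (select-unfold h s D′ C) c)

-- Sweeps over the stations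

-- At n s h s′ l C: l is the position C of height h and sign s′, the positions
-- of height n having sign s.
data At : ∀ n (s : Bool) h (s′ : Bool) → ⟦ Low n ⟧ → F h → Set where
  bottom : ∀ {s C} → At 0 s 0 s C C
  top    : ∀ {n s C} → At (suc n) s (suc n) s (inj₁ C) C
  below  : ∀ {n s h s′ l C} → At n (not s) h s′ l C → At (suc n) s h s′ (inj₂ l) C

at-top : ∀ n s C → At n s n s (fun (topᶠ n) C) C
at-top zero    s C = bottom
at-top (suc n) s C = top

none-not-at : ∀ {G} n {s h s′ C} (γ : ⟦ G ⟧) → ¬ At n s (suc h) s′ (fun (noneᶠ {G} n) γ) C
none-not-at (suc n) γ (below at) = none-not-at n γ at

at-unique : ∀ {n s s′ h s₁ h₂ s₂ l C C₂} → At n s h s₁ l C → At n s′ h₂ s₂ l C₂ → h ≡ h₂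
at-unique bottom    bottom     = refl
at-unique top       top        = refl
at-unique (below a) (below a₂) = at-unique a a₂

at-content : ∀ {n s h s₁ s₂ l C C₂} → At n s h s₁ l C → At n s h s₂ l C₂ → C ≡ C₂
at-content bottom    bottom     = refl
at-content top       top        = refl
at-content (below a) (below a₂) = at-content a a₂

at-bound : ∀ {n s h s′ l C} → At n s h s′ l C → h ≤ n
at-bound bottom     = z≤n
at-bound top        = ≤-refl
at-bound (below at) = m≤n⇒m≤1+n (at-bound at)

at-leaf : ∀ {n s h s′ l C} → At n s h s′ l C → fun (lowLeafᶠ n) l ≡ fun (leafOfᶠ h) C
at-leaf bottom     = refl
at-leaf top        = refl
at-leaf (below at) = at-leaf at

-- Positions written in rightward rounds have the sign `true`, those written in leftward rounds the
-- sign `false`. A source of the other sign was written in the preceding round, so the play has just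
-- turned around.
turning : Direction → Bool → Bool
turning rightward s = not s
turning leftward  s = s

turning-not : ∀ d s → turning d (not s) ≡ not (turning d s)
turning-not rightward s = refl
turning-not leftward  s = refl

turning-turn : ∀ d s → turning (turn d) s ≡ not (turning d s)
turning-turn rightward s = sym (not-involutive s)
turning-turn leftward  s = refl

module Rounds (honesty : Honesty) (j : ℕ) where

  open Honesty honesty
  open Tracing honesty
  open Machine j

  data Placed n s h s′ : ⟦ decTy (FT h) ⟧ → ⟦ decTy (Low n) ⟧ → Set where
    decided : ∀ {δ} → Placed n s h s′ (inj₁ δ) (inj₁ δ)
    placed  : ∀ {D l} → At n s h s′ l D → Placed n s h s′ (inj₂ D) (inj₂ l)

  chosen-map : ∀ {A B : Set} (q : ⟦ varTy ⟧ × (A × A)) (f : A → B) {w} →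
               Chosen (proj₁ q , (f (proj₁ (proj₂ q)) , f (proj₂ (proj₂ q)))) w → ∃[ u ] (Chosen q u × w ≡ f u)
  chosen-map q f (if-true e p)  = _ , if-true refl p , e
  chosen-map q f (if-false e p) = _ , if-false refl p , e

  lift : ∀ {A B D : Set} → (A → B) → D ⊎ A → D ⊎ B
  lift f s = [ inj₁ , (λ x → inj₂ (f x)) ]′ s

  low-select : ∀ n d {s t h s′ s₁ s₂ src tgt D′ C w} → t ≡ turning d s → turning d s′ ≡ false →
               At n s (suc h) s′ src D′ → At (suc n) s₁ (2 + h) s₂ tgt C →
               Chosen (fun (lowMoveᶠ n s t) (tgt , src)) w →
               ∃[ u ] (Chosen (fun (selectᶠ h s′) (D′ , C)) u × Placed n s (suc h) s′ u w)
  low-select (suc n) d {s} {src = inj₁ D′} {inj₁ C} refl e top top c rewrite e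
    with chosen-map (fun (selectᶠ n s) (D′ , C)) (lift inj₁) c
  ... | inj₁ δ , c′ , refl = _ , c′ , decided
  ... | inj₂ D , c′ , refl = _ , c′ , placed top
  low-select (suc n) d t≡ e top (below at) c = ⊥-elim (1+n≰n (at-bound at))
  low-select (suc n) d t≡ e (below at) top c = ⊥-elim (1+n≰n (at-bound at))
  low-select (suc n) d {s} {src = inj₂ src} {inj₂ tgt} refl e (below at) (below at′) c
    with u , c′ , refl ← chosen-map (fun (lowMoveᶠ n (not s) (not (turning d s))) (tgt , src)) (lift inj₂) c
    with low-select n d (sym (turning-not d s)) e at at′ c′
  ... | _ , c″ , decided    = _ , c″ , decided
  ... | _ , c″ , placed at″ = _ , c″ , placed (below at″)

  -- For the end of a round: the preceding round started at the last square without rewriting it, so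
  -- that square holds no position of that round to be searched.
  low-copy : ∀ n d {s t h s′ src tgt D′ w} → t ≡ turning d s → turning d s′ ≡ false →
             At n s (suc h) s′ src D′ → (∀ {s₁ s₂ C} → ¬ At (suc n) s₁ (2 + h) s₂ tgt C) →
             Chosen (fun (lowMoveᶠ n s t) (tgt , src)) w → w ≡ inj₂ src
  low-copy (suc n) d {tgt = inj₁ C} refl e (top {s = s}) ¬at c = ⊥-elim (¬at {s} top)
  low-copy (suc n) d {tgt = inj₂ l} refl e top ¬at c rewrite e = chosen-go c
  low-copy (suc n) d {s} {h = h} {src = inj₂ src} {tgt} refl e (below at) ¬at c
    with u , c′ , refl ← chosen-map (fun (lowMoveᶠ n (not s) (not (turning d s))) (fun (lowerᶠ (suc n)) tgt , src)) (lift inj₂) c =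
    cong (lift inj₂) (low-copy n d (sym (turning-not d s)) e at (λ {s₁} → lowered tgt ¬at {s₁}) c′)
    where
    lowered : ∀ tgt → (∀ {s₁ s₂ C} → ¬ At (2 + n) s₁ (2 + h) s₂ tgt C) →
              ∀ {s₁ s₂ C} → ¬ At (suc n) s₁ (2 + h) s₂ (fun (lowerᶠ (suc n)) tgt) C
    lowered (inj₁ C) ¬at at = none-not-at (suc n) {h = suc h} _ at
    lowered (inj₂ l) ¬at {s₁} at = ¬at (below (subst (λ s → At (suc n) s (2 + h) _ l _) (sym (not-involutive s₁)) at))

  low-turn : ∀ n d {s t h s′ src tgt D′ w} → t ≡ turning d s → turning d s′ ≡ true →
             At n s (suc h) s′ src D′ → Chosen (fun (lowMoveᶠ n s t) (tgt , src)) w →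
             ∃[ l ] (w ≡ inj₂ l × At n s h (not s′) l (fun (headᶠ h) D′))
  low-turn (suc n) d {s} refl e top c rewrite e = _ , chosen-go c , below (at-top n (not s) _)
  low-turn (suc n) d {s} {src = inj₂ src} {tgt} refl e (below at) c
    with u , c′ , refl ← chosen-map (fun (lowMoveᶠ n (not s) (not (turning d s))) (fun (lowerᶠ (suc n)) tgt , src)) (lift inj₂) c
    with l , refl , at′ ← low-turn n d (sym (turning-not d s)) e at c′ = inj₂ l , refl , below at′

  Station : Set
  Station = ⟦ stationTy ⟧

  pattern verdict δ  = inj₁ δ
  pattern start E    = inj₂ (inj₁ E)
  pattern clause R C = inj₂ (inj₂ (inj₁ (R , C)))
  pattern low l      = inj₂ (inj₂ (inj₂ l))

  record PosAt h (s : Bool) (x : Station) (C : F h) : Set where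
    constructor pos
    field lies : At (suc j) true h s (fun viewᶠ x) C

  pos-unique : ∀ {h s s′ x C C′} → PosAt h s x C → PosAt h s′ x C′ → C ≡ C′
  pos-unique (pos at) (pos at′) = at-content at at′

  data Won : Station → Set where
    won : ∀ {δ} → Win δ → Won (verdict δ)

  data Next (d : Direction) (src tgt w : Station) : Set where
    challenged : Won w → Next d src tgt w
    answered   : Chosen (fun (moveᶠ d) (tgt , src)) w → Next d src tgt w

  move-won : ∀ {d src tgt w} → Won src → Next d src tgt w → Won w
  move-won wn      (challenged wn′) = wn′
  move-won (won p) (answered c) with refl ← chosen-go c = won p

  isRight-turning : ∀ d → isRight d ≡ turning d false
  isRight-turning rightward = refl
  isRight-turning leftward  = refl

  LowAt : ∀ h → Bool → Station → F h → Set
  LowAt h s w C = ∃[ l ] (w ≡ low l × At j false h s l C)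

  low-pos : ∀ {h s w C} → LowAt h s w C → PosAt h s w C
  low-pos (l , refl , at) = pos (below at)

  move-select : ∀ {d h s s₂ src tgt w D′ C} → turning d s ≡ false → LowAt (suc h) s src D′ → PosAt (2 + h) s₂ tgt C →
                Tracked (suc h) s D′ C → LastFine h s D′ → Next d src tgt w →
                Won w ⊎ ∃[ D ] (LowAt (suc h) s w D × (D ∈ C ⊎ D ≡ padE (suc h) (neutral s)) × Edge h (not s) D′ D × LastFine h s D)
  move-select e at at′ tracked last (challenged wn) = inj₁ wn
  move-select {d} {h} {s} {tgt = tgt} e (l , refl , at) (pos at′) tracked last (answered c)
    with u , c′ , refl ← chosen-map (fun (lowMoveᶠ j false (isRight d)) (fun viewᶠ tgt , l)) (lift (λ x → inj₂ (inj₂ x))) c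
    with low-select j d (isRight-turning d) e at at′ c′
  ... | v , c″ , p with select-traced h s tracked last c″ | p
  ... | won win             | decided   = inj₁ (won win)
  ... | moved m edge last′  | placed a  = inj₂ (_ , (_ , refl , a) , m , edge , last′)

  move-copy : ∀ {d h s src tgt w D′} → turning d s ≡ false → LowAt (suc h) s src D′ →
              (∀ {s₁ s₂ C} → ¬ At (suc j) s₁ (2 + h) s₂ (fun viewᶠ tgt) C) → Next d src tgt w → Won w ⊎ w ≡ src
  move-copy e at ¬at (challenged wn) = inj₁ wn
  move-copy {d} {tgt = tgt} e (l , refl , at) ¬at (answered c)
    with u , c′ , refl ← chosen-map (fun (lowMoveᶠ j false (isRight d)) (fun viewᶠ tgt , l)) (lift (λ x → inj₂ (inj₂ x))) c
    with refl ← low-copy j d (isRight-turning d) e at (λ {s₁} → ¬at {s₁}) c′ = inj₂ refl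

  move-turn : ∀ {d h s src tgt w D′} → turning d s ≡ true → PosAt (suc h) s src D′ → Next d src tgt w →
              Won w ⊎ LowAt h (not s) w (fun (headᶠ h) D′)
  move-turn e at (challenged wn) = inj₁ wn
  move-turn {src = verdict δ} e (pos at) (answered c) = ⊥-elim (none-not-at (suc j) _ at)
  move-turn {src = start E}   e (pos at) (answered c) = ⊥-elim (none-not-at (suc j) _ at)
  move-turn {rightward} {src = clause R C} () (pos top) c
  move-turn {leftward} {src = clause R C} e (pos top) (answered c) with refl ← chosen-go c = inj₂ (_ , refl , at-top j false _)
  move-turn {d} {src = low l} {tgt} e (pos (below at)) (answered c)
    with u , c′ , refl ← chosen-map (fun (lowMoveᶠ j false (isRight d)) (fun viewᶠ tgt , l)) (lift (λ x → inj₂ (inj₂ x))) c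
    with l′ , refl , at′ ← low-turn j d (isRight-turning d) e at c′ = inj₂ (l′ , refl , at′)

  -- The stations are numbered in the order in which a round visits them, and
  -- L is the number of the last one. The position at which a round arrives is
  -- not rewritten when the next round starts there.
  flip : ℕ → (ℕ → Station) → ℕ → Station
  flip L Y i = Y (L ∸ i)

  data Plays (L : ℕ) : Direction → ℕ → (ℕ → Station) → Station → Set where
    over  : ∀ {d X} → Plays L d 0 X (X 0)
    round : ∀ {d n X w} (Y : ℕ → Station) → Y 0 ≡ X 0 → (∀ i → i < L → Next d (Y i) (X (suc i)) (Y (suc i))) →
            Plays L (turn d) n (flip L Y) w → Plays L d (suc n) X w

  won-later : ∀ {L d} {X Y : ℕ → Station} → (∀ i → i < L → Next d (Y i) (X (suc i)) (Y (suc i))) →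
              ∀ {i} m → i + m ≡ L → Won (Y i) → Won (Y L)
  won-later next {i} zero    e wn rewrite trans (sym (+-identityʳ i)) e = wn
  won-later {X = X} next {i} (suc m) e wn =
    won-later {X = X} next m (trans (sym (+-suc i m)) e)
      (move-won wn (next i (≤-trans (m<m+n i {suc m} (s≤s z≤n)) (≤-reflexive e))))

  plays-won : ∀ {L d n X w} → Plays L d n X w → Won (X 0) → Won w
  plays-won over wn = wn
  plays-won {L} {X = X} (round Y e next plays) wn =
    plays-won plays (won-later {X = X} next L refl (subst Won (sym e) wn))

  record Adjacent h (s : Bool) (x y : Station) : Set where
    field
      {D D′} : F (suc h)
      at     : PosAt (suc h) (not s) x D
      at′    : PosAt (suc h) (not s) y D′
      edge   : Edge h s D′ D

  -- The tape before the n-th last round, whose positions have the height n and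
  -- the sign s.
  record Before (L n : ℕ) (s : Bool) (X : ℕ → Station) : Set where
    field
      {l₀ l₁}    : ⟦ leafTy ⟧
      {C₁}       : F (suc n)
      rest       : List (F n)
      first-at   : PosAt (suc n) (not s) (X 0) (padE n l₀ ∷ rest)
      first-fine : Fine s l₀
      first-last : LastFine n (not s) (padE n l₀ ∷ rest)
      -- The first move descends into the head of `X 0` without looking at `X 1`, so the head has to
      -- be a member of `X 1` as well for the tracing to begin there.
      second-at  : PosAt (suc n) (not s) (X 1) C₁
      second-∋   : padE n l₀ ∈ C₁
      adjacent   : ∀ i → 1 ≤ i → suc i < L → Adjacent n s (X i) (X (suc i))
      final-at   : PosAt (suc n) (not s) (X (L ∸ 1)) (padE (suc n) l₁)
      final-fine : Fine (not s) l₁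
      -- This forces the last move to be a copy.
      end-not-at : ∀ {s₁ s₂ C} → ¬ At (suc j) s₁ (suc n) s₂ (fun viewᶠ (X L)) C

  -- `passed` collects the edges along which the next round will return, already in the order of
  -- that round.
  record During (L h : ℕ) (s : Bool) (X Y : ℕ → Station) (i : ℕ) : Set where
    field
      {D}      : F (suc h)
      {S}      : F (2 + h)
      at       : LowAt (suc h) s (Y i) D
      source   : PosAt (2 + h) (not s) (X i) S
      origin   : D ∈ S ⊎ D ≡ padE (suc h) (neutral s)
      last     : LastFine h s D
      passed   : ∀ m → 1 ≤ m → m < i → Adjacent h (not s) (Y (suc m)) (Y m)

  not-not : ∀ (P : Bool → Set) s → P s → P (not (not s))
  not-not P s = subst P (sym (not-involutive s))

  last-pad : ∀ h s l → Fine s l → LastFine h s (padE (suc h) l)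
  last-pad zero    s l p (here refl) = p
  last-pad (suc h) s l p = tt

  module Sweep {L′ h s d} {X Y : ℕ → Station} (before : Before (2 + L′) (suc h) s X)
               (straight : turning d s ≡ false) (Y₀ : Y 0 ≡ X 0)
               (next : ∀ i → i < 2 + L′ → Next d (Y i) (X (suc i)) (Y (suc i))) where

    L = 2 + L′

    open Before before

    depart : Won (Y 1) ⊎ LowAt (suc h) s (Y 1) (padE (suc h) l₀)
    depart with move-turn {d} {suc h} {not s} (trans (turning-not d s) (cong not straight))
                  (subst (λ x → PosAt (2 + h) (not s) x (padE (suc h) l₀ ∷ rest)) (sym Y₀) first-at)
                  (next 0 (s≤s z≤n))
    ... | inj₁ wn = inj₁ wn
    ... | inj₂ at = inj₂ (subst (λ s′ → LowAt (suc h) s′ (Y 1) (padE (suc h) l₀)) (not-involutive s) at)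

    begin : Won (Y 1) ⊎ During L h s X Y 1
    begin with depart
    ... | inj₁ wn = inj₁ wn
    ... | inj₂ at = inj₂ record
      { at = at
      ; source = second-at
      ; origin = inj₁ second-∋
      ; last = last-pad h s l₀ first-fine
      ; passed = λ m 1≤m m<1 → ⊥-elim (<⇒≱ m<1 1≤m)
      }

    advance : ∀ i → 1 ≤ i → suc i < L → During L h s X Y i → Won (Y (suc i)) ⊎ During L h s X Y (suc i)
    advance i 1≤i i<L during = result
      where
      open During during
      module A = Adjacent (adjacent i 1≤i i<L)
      tracked : D ∈ A.D ⊎ D ≡ padE (suc h) (neutral s) → Tracked (suc h) s D A.D′
      tracked (inj₁ D∈)   = A.edge D∈
      tracked (inj₂ refl) = by-avail (avail-neutral (suc h) s A.D′)
      result : Won (Y (suc i)) ⊎ During L h s X Y (suc i)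
      result with refl ← pos-unique source A.at
             with move-select straight at A.at′ (tracked origin) last (next i (<-trans (n<1+n i) i<L))
      ... | inj₁ wn = inj₁ wn
      ... | inj₂ (E , at₂ , origin₂ , edge₂ , last₂) = inj₂ record
        { at = at₂ ; source = A.at′ ; origin = origin₂ ; last = last₂
        ; passed = λ m 1≤m m<1+i → extend (m<1+n⇒m<n∨m≡n m<1+i) 1≤m
        }
        where
        extend : ∀ {m} → m < i ⊎ m ≡ i → 1 ≤ m → Adjacent h (not s) (Y (suc m)) (Y m)
        extend (inj₁ m<i)  1≤m = passed _ 1≤m m<i
        extend (inj₂ refl) 1≤m = record
          { at = not-not (λ s → PosAt (suc h) s _ E) s (low-pos at₂)
          ; at′ = not-not (λ s → PosAt (suc h) s _ D) s (low-pos at)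
          ; edge = edge₂ }

    reach : ∀ i → 1 ≤ i → i < L → Won (Y L) ⊎ During L h s X Y i
    reach (suc zero) _ i<L with begin
    ... | inj₁ wn = inj₁ (won-later {X = X} next (L ∸ 1) (m+[n∸m]≡n (<⇒≤ i<L)) wn)
    ... | inj₂ during = inj₂ during
    reach (suc (suc i)) _ i<L with reach (suc i) (s≤s z≤n) (<-trans (n<1+n _) i<L)
    ... | inj₁ wn = inj₁ wn
    ... | inj₂ during with advance (suc i) (s≤s z≤n) i<L during
    ... | inj₁ wn = inj₁ (won-later {X = X} next (L ∸ suc (suc i)) (m+[n∸m]≡n (<⇒≤ i<L)) wn)
    ... | inj₂ during′ = inj₂ during′

    -- The preceding round began with a padded leaf, so the present one arrives at a padded leaf as
    -- well, and one that can be claimed. It is the leaf with which the next round starts; the leaf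
    -- `l₀` of the departure becomes the goal of that round.
    pad-origin : (during : During L h s X Y (suc L′)) → ∃[ l₂ ] (During.D during ≡ padE (suc h) l₂ × Fine (not s) l₂)
    pad-origin during with pos-unique (During.source during) final-at | During.origin during
    ... | refl | inj₁ (here refl) = _ , refl , final-fine
    ... | refl | inj₂ refl        = neutral s , refl , cong encodeBool (sym (not-involutive s))

    sweep : Won (Y L) ⊎ Before L h (not s) (flip L Y)
    sweep with depart | reach (suc L′) (s≤s z≤n) ≤-refl
    ... | _ | inj₁ wn = inj₁ wn
    ... | inj₁ wn | _ = inj₁ (won-later {X = X} next (suc L′) refl wn)
    ... | inj₂ at₁ | inj₂ during
      with l₂ , D≡ , fine₂ ← pad-origin during
      with move-copy straight (During.at during) (λ {s₁} → end-not-at {s₁}) (next (suc L′) ≤-refl)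
    ... | inj₁ wn = inj₁ wn
    ... | inj₂ Y≡ = inj₂ record
      { rest = []
      ; first-at = subst (λ x → PosAt (suc h) (not (not s)) x _) (sym Y≡) arrived
      ; first-fine = fine₂
      ; first-last = not-not (λ s → LastFine h s (padE (suc h) l₂)) s (subst (LastFine h s) D≡ (During.last during))
      ; second-at = arrived
      ; second-∋ = here refl
      ; adjacent = λ i 1≤i i<L → subst (λ m → Adjacent h (not s) (Y m) (Y (L ∸ suc i))) (sym (+-∸-assoc 1 (≤-trans (n≤1+n _) i<L)))
          (During.passed during (L ∸ suc i) (m<n⇒0<n∸m i<L) (s≤s (∸-monoʳ-≤ (suc L′) 1≤i)))
      ; final-at = subst (λ m → PosAt (suc h) (not (not s)) (Y m) (padE (suc h) l₀)) (sym (m+n∸n≡m 1 L′)) departed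
      ; final-fine = fine-not-not s {l₀} first-fine
      -- The last square of the reversed order is the former square `0`, whose position is one level
      -- too high.
      ; end-not-at = λ at → 1+n≢n (sym (at-unique (subst (λ x → At (suc j) _ (suc h) _ (fun viewᶠ x) _) (trans (cong Y (n∸n≡0 L)) Y₀) at) (PosAt.lies first-at)))
      }
      where
      arrived : PosAt (suc h) (not (not s)) (Y (suc L′)) (padE (suc h) l₂)
      arrived = not-not (λ s → PosAt (suc h) s _ (padE (suc h) l₂)) s (subst (PosAt (suc h) s _) D≡ (low-pos (During.at during)))
      departed : PosAt (suc h) (not (not s)) (Y 1) (padE (suc h) l₀)
      departed = not-not (λ s → PosAt (suc h) s _ (padE (suc h) l₀)) s (low-pos at₁)

  data Victory : Station → Set where
    by-verdict  : ∀ {δ} → Win δ → Victory (verdict δ)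
    by-position : ∀ {x} → (∀ e → Win (inj₂ (fun labelOfᶠ (e , inj₂ x)))) → Victory (inj₂ x)

  won-victory : ∀ {x} → Won x → Victory x
  won-victory (won p) = by-verdict p

  label-at : ∀ {s x C} → PosAt 1 s x C → ∃[ p ] (x ≡ inj₂ p × ∀ e → fun labelOfᶠ (e , inj₂ p) ≡ fun blameLeafᶠ (fun (leafOfᶠ 1) C))
  label-at {x = verdict δ} (pos at) = ⊥-elim (none-not-at (suc j) _ at)
  label-at {x = start E} (pos at) = ⊥-elim (none-not-at (suc j) _ at)
  label-at {x = clause R C} (pos top) = _ , refl , λ e → refl
  label-at {x = low l} (pos (below at)) = _ , refl , λ e → cong (fun blameLeafᶠ) (at-leaf at)

  -- When no round is left, `first-fine` and `first-last` are claims of opposite signs about the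
  -- same leaf at the station where the play stops.
  low-victory : ∀ {L′ n s d X w} → turning d s ≡ false → Before (2 + L′) n s X → Plays (2 + L′) d n X w → Victory w
  low-victory {L′} {s = s} e before over with label-at (Before.first-at before)
    | fine-clash s (Before.l₀ before) (Before.first-fine before) (Before.first-last before (here refl))
  ... | p , x≡ , label | l , l₀≡ , win rewrite x≡ =
    by-position λ e → subst (λ l → Win (inj₂ l)) (sym (trans (label e) (cong (fun blameLeafᶠ) l₀≡))) win
  low-victory {L′} {s = s} {d} e before (round Y Y₀ next plays) with Sweep.sweep before e Y₀ next
  ... | inj₁ wn = won-victory (plays-won plays wn)
  ... | inj₂ before′ = low-victory (trans (turning-turn d (not s)) (cong not (trans (turning-not d s) (cong not e)))) before′ plays

-- The first round

module FirstRound (honesty : Honesty) (j : ℕ) where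

  open Honesty honesty
  open Tracing honesty
  open Machine j
  open Rounds honesty j

  lastOf : {S : Set} → S → List S → S
  lastOf x []       = x
  lastOf x (y ∷ ys) = lastOf y ys

  -- For a clause with literals a win is owed only if all of them have been claimed to be false; the
  -- verdict is read off the last one, where the scan stops.
  data Scannable : F (suc j) → Set where
    true-term  : Scannable (padE (suc j) (neutral true))
    false-term : Win (inj₁ tt) → Scannable (padE (suc j) (neutral false))
    literals   : ∀ l ls → (All (λ l → Fine true (inj₁ l)) (l ∷ ls) → Win (inj₂ (fun clauseLabelᶠ (lastOf l ls)))) →
                 Scannable (map (λ l → padE j (inj₁ l)) (l ∷ ls))

  -- The formulas to be visited after ψ; the empty ones stand for the scanning
  -- of a clause of the last proper formula.
  data Route (m : ℕ) : F k → List (F k) → Set where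
    arrive : ∀ {ψ} → (∀ {C} → C ∈ ψ → Scannable C × length C ≤ m) → 1 ≤ m → Route m ψ (replicate m [])
    pass   : ∀ {ψ C φ R} → Extends (suc j) true (C ∷ φ) ψ → Route m (C ∷ φ) R → Route m ψ ((C ∷ φ) ∷ R)

  data Scanned (R : List (F k)) (C : F (suc j)) (w : Station) : Set where
    won      : Won w → Scanned R C w
    accepted : ∀ {l₀ Ds} → w ≡ clause [] C → C ≡ padE j l₀ ∷ Ds → Fine false l₀ → Scanned R C w
    advanced : ∀ {D Ds} → w ≡ clause R Ds → C ≡ D ∷ Ds → Scannable Ds → Scanned R C w

  scan-reject : ∀ {R w} l ls → Fine true (inj₁ l) →
                (All (λ l → Fine true (inj₁ l)) (l ∷ ls) → Win (inj₂ (fun clauseLabelᶠ (lastOf l ls)))) →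
                let Ds = map (λ l → padE j (inj₁ l)) ls in
                w ≡ fun advanceᶠ (((R , padE j (inj₁ l) ∷ Ds) , (padE j (inj₁ l) , Ds)) , inj₂ (fun clauseLabelᶠ l)) →
                Scanned R (padE j (inj₁ l) ∷ Ds) w
  scan-reject l []        p h refl = won (won (h (p ∷ [])))
  scan-reject l (l′ ∷ ls) p h refl = advanced refl refl (literals l′ ls λ ps → h (p ∷ ps))

  move-scan : ∀ {R C tgt w} → Scannable C → Next rightward (clause ([] ∷ R) C) tgt w → Scanned R C w
  move-scan sc (challenged wn) = won wn
  move-scan true-term (answered c) rewrite leafOf-pad j (neutral true) = accepted (chosen-go c) refl refl
  move-scan (false-term win) (answered c) rewrite leafOf-pad j (neutral false) with refl ← chosen-go c = won (won win)
  move-scan (literals (yes , v) ls h) (answered c) rewrite leafOf-pad j (inj₁ (yes , v)) with c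
  ... | if-true e p  = accepted e refl p
  ... | if-false e p = scan-reject (yes , v) ls p h e
  move-scan (literals (no , v) ls h) (answered c) rewrite leafOf-pad j (inj₁ (no , v)) with c
  ... | if-false e p = accepted e refl p
  ... | if-true e p  = scan-reject (no , v) ls p h e

  move-done : ∀ {C tgt w} → Next rightward (clause [] C) tgt w → Won w ⊎ w ≡ clause [] C
  move-done (challenged wn) = inj₁ wn
  move-done (answered c)    = inj₂ (chosen-go c)

  move-start : ∀ {ψ E tgt w} → Next rightward (start (ψ ∷ E)) tgt w → Won w ⊎ w ≡ clause E (fun (headᶠ (suc j)) ψ)
  move-start (challenged wn) = inj₁ wn
  move-start (answered c)    = inj₂ (chosen-go c)

  move-clause : ∀ {C′ C φ R tgt w} → Tracked (suc j) true C′ (C ∷ φ) → LastFine j true C′ →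
                Next rightward (clause ((C ∷ φ) ∷ R) C′) tgt w →
                Won w ⊎ ∃[ D ] (w ≡ clause R D × (D ∈ C ∷ φ ⊎ D ≡ padE (suc j) (neutral true)) × Edge j false C′ D × LastFine j true D)
  move-clause tracked last (challenged wn) = inj₁ wn
  move-clause {C′} {C} {φ} {R} tracked last (answered c)
    with u , c′ , refl ← chosen-map (fun (selectᶠ j true) (C′ , C ∷ φ)) (lift (λ D → inj₂ (inj₁ (R , D)))) c
    with select-traced j true tracked last c′
  ... | won win            = inj₁ (won win)
  ... | moved m edge last′ = inj₂ (_ , refl , m , edge , last′)

  last-⊆ : ∀ h s {C D : F (suc h)} → (∀ {E} → E ∈ D → E ∈ C) → LastFine h s C → LastFine h s D
  last-⊆ zero    s ⊆C all m = all (⊆C m)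
  last-⊆ (suc h) s ⊆C all   = tt

  edge-⊆ : ∀ h s {C D : F (suc h)} → (∀ {E} → E ∈ D → E ∈ C) → Edge h s C D
  edge-⊆ h s ⊆C m = by-avail (avail-self h s (⊆C m))

  module Sweep₁ {L′ R ψ} {X Y : ℕ → Station} (X≡ : ∀ i → X i ≡ start (ψ ∷ R)) (ψ-false : ψ ≡ padE k (neutral false))
                (Y₀ : Y 0 ≡ X 0) (next : ∀ i → i < 2 + L′ → Next rightward (Y i) (X (suc i)) (Y (suc i))) where

    L = 2 + L′

    Passed : ℕ → Set
    Passed i = ∀ m → 1 ≤ m → m < i → Adjacent j false (Y (suc m)) (Y m)

    Result : Set
    Result = Won (Y L) ⊎ Before L j false (flip L Y)

    extend : ∀ {i C D R R′} → Passed i → Y i ≡ clause R C → Y (suc i) ≡ clause R′ D → Edge j false C D → Passed (suc i)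
    extend {i} {C} {D} {R} {R′} passed Yᵢ Yₛ edge m 1≤m m<1+i with m<1+n⇒m<n∨m≡n m<1+i
    ... | inj₁ m<i  = passed m 1≤m m<i
    ... | inj₂ refl = record { at = at-clause Yₛ ; at′ = at-clause Yᵢ ; edge = edge }
      where
      at-clause : ∀ {x R C} → x ≡ clause R C → PosAt (suc j) true x C
      at-clause refl = pos top

    lose : ∀ {i m} → i + suc m ≡ L → Won (Y (suc i)) → Result
    lose {i} {m} e wn = inj₁ (won-later {X = X} next m (trans (sym (+-suc i m)) e) wn)

    next-at : ∀ i m → i + suc m ≡ L → Next rightward (Y i) (X (suc i)) (Y (suc i))
    next-at i m e = next i (≤-trans (m<m+n i (s≤s z≤n)) (≤-reflexive e))

    module _ (first-at : PosAt (suc j) true (Y 1) (padE (suc j) (neutral false))) where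

      settle : ∀ m i {C R l₀ Ds} → suc i + m ≡ L → 1 ≤ i → Y i ≡ clause R C → Y (suc i) ≡ clause [] C →
               C ≡ padE j l₀ ∷ Ds → Fine false l₀ → LastFine j true C → Passed (suc i) → Result
      settle zero i {C} {R} {l₀} {Ds} e 1≤i Yᵢ Yₛ refl fine last passed with refl ← suc-injective (trans (sym (+-identityʳ (suc i))) e) = inj₂ record
        { rest = Ds
        ; first-at = subst (λ x → PosAt (suc j) true x C) (sym Yₛ) (pos top)
        ; first-fine = fine
        ; first-last = last
        ; second-at = subst (λ x → PosAt (suc j) true x C) (sym Yᵢ) (pos top)
        ; second-∋ = here refl
        ; adjacent = λ i 1≤i i<L → subst (λ m → Adjacent j false (Y m) (Y (L ∸ suc i))) (sym (+-∸-assoc 1 (≤-trans (n≤1+n _) i<L)))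
            (passed (L ∸ suc i) (m<n⇒0<n∸m i<L) (s≤s (m∸n≤m (suc L′) i)))
        ; final-at = subst (λ m → PosAt (suc j) true (Y m) (padE (suc j) (neutral false))) (sym (m+n∸n≡m 1 L′)) first-at
        ; final-fine = refl
        ; end-not-at = λ at → none-not-at (suc j) _ (subst (λ x → At (suc j) _ (suc j) _ (fun viewᶠ x) _) (trans (cong Y (n∸n≡0 L)) (trans Y₀ (X≡ 0))) at)
        }
      settle (suc m) i {C} e 1≤i Yᵢ Yₛ shape fine last passed
        with move-done (subst (λ x → Next rightward x (X (2 + i)) (Y (2 + i))) Yₛ (next-at (suc i) m e))
      ... | inj₁ wn = lose {suc i} {m} e wn
      ... | inj₂ Y₂ = settle m (suc i) (trans (sym (+-suc (suc i) m)) e) (s≤s z≤n) Yₛ Y₂ shape fine last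
                        (extend passed Yₛ Y₂ (edge-self j false C))

      -- Dropping a rejected literal leaves a clause contained in the former one, so the scanning
      -- stations are traced back in the second round like steps of the refutation. Since
      -- `length C ≤ m`, the `m` stations left suffice.
      scan : ∀ m i {C} → i + m ≡ L → 1 ≤ i → Y i ≡ clause (replicate m []) C → Scannable C → length C ≤ m →
             LastFine j true C → Passed i → Result
      scan zero i e 1≤i Yᵢ (literals l ls h) () last passed
      scan (suc m) i {C} e 1≤i Yᵢ sc len last passed
        with move-scan sc (subst (λ x → Next rightward x (X (suc i)) (Y (suc i))) Yᵢ (next-at i m e))
      ... | won wn = lose {i} {m} e wn
      ... | accepted Yₛ shape fine = settle m i (trans (sym (+-suc i m)) e) 1≤i Yᵢ Yₛ shape fine last
                                       (extend passed Yᵢ Yₛ (edge-self j false C))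
      scan (suc m) i e 1≤i Yᵢ sc (s≤s len) last passed | advanced Yₛ refl sc′ =
        scan m (suc i) (trans (sym (+-suc i m)) e) (s≤s z≤n) Yₛ sc′ len (last-⊆ j true there last)
          (extend passed Yᵢ Yₛ (edge-⊆ j false there))

      walk : ∀ {m ψ R} → Route m ψ R → ∀ i {C} → i + length R ≡ L → 1 ≤ i → Y i ≡ clause R C →
             C ∈ ψ ⊎ C ≡ padE (suc j) (neutral true) → LastFine j true C → Passed i → Result
      walk {m} (arrive scannable 1≤m) i {C} e 1≤i Yᵢ origin last passed =
        scan m i (trans (cong (i +_) (sym (length-replicate m))) e) 1≤i Yᵢ (proj₁ (ready origin)) (proj₂ (ready origin)) last passed
        where
        ready : C ∈ _ ⊎ C ≡ padE (suc j) (neutral true) → Scannable C × length C ≤ m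
        ready (inj₁ C∈)   = scannable C∈
        ready (inj₂ refl) = true-term , 1≤m
      walk (pass {ψ} {C} {φ} {R} extends route) i {C′} e 1≤i Yᵢ origin last passed
        with move-clause (tracked origin) last (subst (λ x → Next rightward x (X (suc i)) (Y (suc i))) Yᵢ (next-at i (length R) e))
        where
        tracked : C′ ∈ ψ ⊎ C′ ≡ padE (suc j) (neutral true) → Tracked (suc j) true C′ (C ∷ φ)
        tracked (inj₁ C∈)   = by-avail (extends C∈)
        tracked (inj₂ refl) = by-avail (avail-neutral (suc j) true _)
      ... | inj₁ wn = lose {i} {length R} e wn
      ... | inj₂ (D , Yₛ , origin′ , edge , last′) =
        walk route (suc i) (trans (sym (+-suc i (length R))) e) (s≤s z≤n) Yₛ origin′ last′ (extend passed Yᵢ Yₛ edge)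

    sweep : ∀ {m} → Route m ψ R → 1 + length R ≡ L → Result
    sweep route e with move-start (subst (λ x → Next rightward x (X 1) (Y 1)) (trans Y₀ (X≡ 0)) (next 0 (s≤s z≤n)))
    ... | inj₁ wn = lose {0} {length R} e wn
    ... | inj₂ Y₁ = walk (subst (λ x → PosAt (suc j) true x (padE (suc j) (neutral false))) (sym Y₁′) (pos top)) route 1 e (s≤s z≤n) Y₁′
        (inj₁ (subst (padE (suc j) (neutral false) ∈_) (sym ψ-false) (here refl)))
        (last-pad j true (neutral false) refl) (λ m 1≤m m<1 → ⊥-elim (<⇒≱ m<1 1≤m))
      where
      Y₁′ : Y 1 ≡ clause R (padE (suc j) (neutral false))
      Y₁′ = trans Y₁ (cong (λ ψ → clause R (fun (headᶠ (suc j)) ψ)) ψ-false)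

  victory : ∀ {L′ m R X w} → (∀ i → X i ≡ start (padE k (neutral false) ∷ R)) → Route m (padE k (neutral false)) R →
            1 + length R ≡ 2 + L′ → Plays (2 + L′) rightward (suc j) X w → Victory w
  victory X≡ route e (round Y Y₀ next plays) with Sweep₁.sweep X≡ refl Y₀ next route e
  ... | inj₁ wn     = won-victory (plays-won plays wn)
  ... | inj₂ before = low-victory refl before plays

-- The enumerated codes are closed under the moves

suffix-self : ∀ {S : Set} (xs : List S) → xs ∈ suffixes xs
suffix-self []       = here refl
suffix-self (x ∷ xs) = here refl

suffix-tail : ∀ {S : Set} {y : S} {ys} xs → y ∷ ys ∈ suffixes xs → ys ∈ suffixes xs
suffix-tail []       (here ())
suffix-tail (x ∷ xs) (here refl) = there (suffix-self xs)
suffix-tail (x ∷ xs) (there m)   = there (suffix-tail xs m)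

suffix-⊆ : ∀ {S : Set} {y : S} {ys} xs → ys ∈ suffixes xs → y ∈ ys → y ∈ xs
suffix-⊆ []       (here refl) m = m
suffix-⊆ (x ∷ xs) (here refl) m = m
suffix-⊆ (x ∷ xs) (there s)   m = there (suffix-⊆ xs s m)

children : ∀ h → List (F (suc h)) → List (F h)
children h = fun (childrenᶠ h)

child-pad : ∀ h s xs → padE h (neutral s) ∈ children h xs
child-pad h false xs = here refl
child-pad h true  xs = there (here refl)

child-∈ : ∀ h {xs C D} → C ∈ xs → D ∈ C → D ∈ children h xs
child-∈ h m m′ = there (there (∈-concat⁺′ m′ m))

child-head : ∀ h {xs} C → C ∈ xs → fun (headᶠ h) C ∈ children h xs
child-head h []      m = here refl
child-head h (D ∷ C) m = child-∈ h m (here refl)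

InLow : ∀ n → List (F n) → ⟦ Low n ⟧ → Set
InLow zero    xs l        = l ∈ xs
InLow (suc n) xs (inj₁ C) = C ∈ xs
InLow (suc n) xs (inj₂ l) = InLow n (children n xs) l

in-lows : ∀ n {xs} l → InLow n xs l → l ∈ fun (lowsᶠ n) xs
in-lows zero    l        m = m
in-lows (suc n) (inj₁ C) m = ∈-++⁺ˡ (∈-map⁺ inj₁ m)
in-lows (suc n) {xs} (inj₂ l) m = ∈-++⁺ʳ (map inj₁ xs) (∈-map⁺ inj₂ (in-lows n l m))

lows-in : ∀ n {xs l} → l ∈ fun (lowsᶠ n) xs → InLow n xs l
lows-in zero    m = m
lows-in (suc n) {xs} m with ∈-++⁻ (map inj₁ xs) m
... | inj₁ m′ with C , m″ , refl ← ∈-map⁻ inj₁ m′ = m″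
... | inj₂ m′ with l , m″ , refl ← ∈-map⁻ inj₂ m′ = lows-in n m″

none-in : ∀ {G} n {xs} (γ : ⟦ G ⟧) → InLow n (children n xs) (fun (noneᶠ {G} n) γ)
none-in zero    γ = here refl
none-in {G} (suc n) {xs} γ = none-in {G} n {children (suc n) xs} γ

top-in : ∀ n {xs C} → C ∈ xs → InLow n xs (fun (topᶠ n) C)
top-in zero    m = m
top-in (suc n) m = m

module Closure (j : ℕ) (E : List (F (2 + j))) where

  open Machine j

  verdicts : List ⟦ verdictTy ⟧
  verdicts = fun verdictsᶠ E

  clauses : List (F (suc j))
  clauses = fun clausesᶠ E

  constant-verdict : ∀ b → inj₂ (inj₁ b) ∈ verdicts
  constant-verdict no  = there (here refl)
  constant-verdict yes = there (there (here refl))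

  -- A challenge to a z-variable ends the game with its label, so this verdict has to be among the
  -- enumerated ones.
  VarOK : ⟦ varTy ⟧ → Set
  VarOK v = ∀ b → v ≡ inj₂ (inj₂ b) → inj₂ (inj₂ b) ∈ verdicts

  record OK h (C : F h) : Set where
    constructor ok
    field leaf-ok : ∀ {b v} → inj₁ (b , v) ∈ leaves h C → VarOK v

  open OK

  ok-route : OK (suc k) E
  ok-route = ok λ { m b refl → there (there (there (∈-map⁺ (fun zlabelᶠ) m))) }

  ok-child : ∀ h {C D} → D ∈ C → OK (suc h) C → OK h D
  ok-child h m (ok o) = ok λ l∈ → o (leaves-child h m l∈)

  ok-pad : ∀ h b → OK h (padE h (inj₂ b))
  ok-pad h b = ok λ l∈ → absurd (subst (_ ∈_) (leaves-pad h (inj₂ b)) l∈)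
    where
    absurd : ∀ {l v} → inj₁ l ∈ inj₂ b ∷ [] → VarOK v
    absurd (here ())
    absurd (there ())

  ok-children : ∀ h {xs} → (∀ {C} → C ∈ xs → OK (suc h) C) → ∀ {D} → D ∈ children h xs → OK h D
  ok-children h oks (here refl)         = ok-pad h no
  ok-children h oks (there (here refl)) = ok-pad h yes
  ok-children h {xs} oks (there (there m)) with C , D∈C , C∈xs ← ∈-concat⁻′ xs m = ok-child h D∈C (oks C∈xs)

  ok-clauses : ∀ {C} → C ∈ clauses → OK (suc j) C
  ok-clauses {C} m with S , m₁ , m₂ ← ∈-concat⁻′ (map suffixes (children (suc j) E)) m
                   with φ , φ∈ , refl ← ∈-map⁻ suffixes {xs = children (suc j) E} m₂ = ok λ l∈ →
    let D , D∈ , l∈D = leaves-child⁻ j C l∈ in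
    leaf-ok (ok-children (suc j) {E} (λ C∈ → ok-child k C∈ ok-route) φ∈) (leaves-child j (suffix-⊆ φ m₁ D∈) l∈D)

  in-clauses : ∀ {C} → C ∈ children (suc j) E → C ∈ clauses
  in-clauses {C} m = ∈-concat⁺′ (suffix-self C) (∈-map⁺ suffixes m)

  clauses-tail : ∀ {D Ds} → D ∷ Ds ∈ clauses → Ds ∈ clauses
  clauses-tail m with S , m₁ , m₂ ← ∈-concat⁻′ (map suffixes (children (suc j) E)) m
                 with φ , φ∈ , refl ← ∈-map⁻ suffixes {xs = children (suc j) E} m₂ = ∈-concat⁺′ (suffix-tail φ m₁) (∈-map⁺ suffixes φ∈)

  ok-leafOf : ∀ h D → OK h D → ∀ {b v} → fun (leafOfᶠ h) D ≡ inj₁ (b , v) → VarOK v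
  ok-leafOf zero    D       o  eq = leaf-ok o (here (sym eq))
  ok-leafOf (suc h) []      o  eq with () ← trans (sym (leafOf-pad h (neutral false))) eq
  ok-leafOf (suc h) (C ∷ D) o  eq = ok-leafOf h C (ok-child h (here refl) o) eq

  record InQuery {A : Set} (P : A → Set) (q : ⟦ varTy ⟧ × (A × A)) : Set where
    constructor in-query
    field
      var-ok   : VarOK (proj₁ q)
      in-true  : P (proj₁ (proj₂ q))
      in-false : P (proj₂ (proj₂ q))

  InDec : {A : Set} → (A → Set) → ⟦ verdictTy ⟧ ⊎ A → Set
  InDec P (inj₁ δ) = δ ∈ verdicts
  InDec P (inj₂ x) = P x

  in-go : ∀ {A : Set} (P : A → Set) {x} → P x → InQuery P (inj₁ [] , (x , x))
  in-go P p = in-query (λ _ ()) p p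

  in-map : ∀ {A B : Set} {P : A → Set} {Q : B → Set} (q : ⟦ varTy ⟧ × (A × A)) (f : A → B) → (∀ {x} → P x → Q (f x)) →
           InQuery P q → InQuery Q (proj₁ q , (f (proj₁ (proj₂ q)) , f (proj₂ (proj₂ q))))
  in-map q f h (in-query o p p′) = in-query o (h p) (h p′)

  in-undecided : ∀ {A B : Set} {P : A → Set} {Q : B → Set} (f : A → B) → (∀ {x} → P x → Q (f x)) →
                 ∀ {s} → InDec P s → InDec Q ([ inj₁ , (λ x → inj₂ (f x)) ]′ s)
  in-undecided f h {inj₁ δ} p = p
  in-undecided f h {inj₂ x} p = h p

  in-select : ∀ h s {D′ C} (S : List (F (suc h))) → OK (2 + h) C → (∀ {D} → D ∈ C → D ∈ S) →
              (∀ s → padE (suc h) (neutral s) ∈ S) → InQuery (InDec (_∈ S)) (fun (selectᶠ h s) (D′ , C))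
  in-select h s {D′} {C} S o ⊆S pad∈ = subst (InQuery (InDec (_∈ S))) (sym (select-unfold h s D′ C))
    (cases (same (FT (suc h)) D′ (padE (suc h) (neutral s))) (term h s (neutral (not s) , (D′ , C)))
      (resolvent h s (D′ , C)) (fun (leafOfᶠ (suc h)) D′) refl refl)
    where
    conflict : ∀ h (S : List (F (suc h))) → (∀ s → padE (suc h) (neutral s) ∈ S) →
               ∀ l → InQuery (InDec (_∈ S)) (fun (conflictᶠ {G = unit} h s) (tt , l))
    conflict zero    S pad∈ l = in-go (InDec (_∈ S)) (constant-verdict _)
    conflict (suc h) S pad∈ l = in-go (InDec (_∈ S)) (pad∈ s)
    head∈ : ∀ C → (∀ {D} → D ∈ C → D ∈ S) → fun (headᶠ (suc h)) C ∈ S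
    head∈ []      _  = pad∈ false
    head∈ (D ∷ C) ⊆S = ⊆S (here refl)
    cases : ∀ b t r l → term h s (neutral (not s) , (D′ , C)) ≡ t →
            resolvent h s (D′ , C) ≡ r → InQuery (InDec (_∈ S)) (select-by h s C b t r l)
    cases yes t r l et er = in-go (InDec (_∈ S)) (pad∈ s)
    cases no (inj₂ D) r l et er = in-go (InDec (_∈ S)) (⊆S (proj₁ (Term⁻ h s {C = C} et)))
    cases no no (inj₂ (v , Dₜ , D_f)) l et er with (b , m) , t , f ← Resolvent⁻ h s {D′} {C} er =
      in-query (leaf-ok o m) (⊆S (proj₁ (Term⁻ h s {C = C} t))) (⊆S (proj₁ (Term⁻ h s {C = C} f)))
    cases no no no (inj₁ l) et er = conflict h S pad∈ l
    cases no no no (inj₂ b) et er = in-go (InDec (_∈ S)) (head∈ C ⊆S)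

  in-topMove : ∀ n s t {xs tgt D} → (∀ {C} → C ∈ xs → OK (2 + n) C) → InLow (2 + n) xs tgt → D ∈ children (suc n) xs →
               InQuery (InDec (InLow (suc n) (children (suc n) xs))) (fun (topMoveᶠ n s t) ((tgt , inj₁ D) , D))
  in-topMove n s true {xs} {tgt} {D} oks t∈ m = in-go (InDec (InLow (suc n) (children (suc n) xs))) (top-in n {children n (children (suc n) xs)} (child-head n D m))
  in-topMove n s false {xs} {inj₁ C} {D} oks t∈ m =
    in-map {P = InDec (_∈ children (suc n) xs)} {Q = InDec (InLow (suc n) (children (suc n) xs))} (fun (selectᶠ n s) (D , C))
      [ inj₁ , (λ x → inj₂ (inj₁ x)) ]′ (λ {x} → in-undecided {P = _∈ children (suc n) xs} {Q = InLow (suc n) (children (suc n) xs)} inj₁ id {x})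
      (in-select n s {D} {C} (children (suc n) xs) (oks t∈) (child-∈ (suc n) t∈) (λ s → child-pad (suc n) s xs))
  in-topMove n s false {xs} {inj₂ l} oks t∈ m = in-go (InDec (InLow (suc n) (children (suc n) xs))) m

  in-lowMove : ∀ n s t {xs tgt src} → (∀ {C} → C ∈ xs → OK (suc n) C) → InLow (suc n) xs tgt → InLow n (children n xs) src →
               InQuery (InDec (InLow n (children n xs))) (fun (lowMoveᶠ n s t) (tgt , src))
  in-lowMove zero s t {xs} oks t∈ s∈ = in-go (InDec (InLow zero (children zero xs))) s∈
  in-lowMove (suc n) s t {xs} {tgt} {inj₁ D} oks t∈ s∈ = in-topMove n s t {xs} {tgt} oks t∈ s∈
  in-lowMove (suc n) s t {xs} {tgt} {inj₂ l} oks t∈ s∈ =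
    in-map {P = InDec (InLow n (children n (children (suc n) xs)))} {Q = InDec (InLow (suc n) (children (suc n) xs))}
      (fun (lowMoveᶠ n (not s) (not t)) (fun (lowerᶠ (suc n)) tgt , l))
      [ inj₁ , (λ x → inj₂ (inj₂ x)) ]′
      (λ {x} → in-undecided {P = InLow n (children n (children (suc n) xs))} {Q = InLow (suc n) (children (suc n) xs)} inj₂ id {x})
      (in-lowMove n (not s) (not t) (ok-children (suc n) oks) (lowered tgt t∈) s∈)
    where
    lowered : ∀ tgt → InLow (2 + n) xs tgt → InLow (suc n) (children (suc n) xs) (fun (lowerᶠ (suc n)) tgt)
    lowered (inj₁ C) _  = none-in n {children (suc n) xs} (inj₁ C , C)
    lowered (inj₂ l) l∈ = l∈

  InStation : ⟦ stationTy ⟧ → Set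
  InStation (inj₁ δ)                      = δ ∈ verdicts
  InStation (inj₂ (inj₁ R))               = R ≡ E
  InStation (inj₂ (inj₂ (inj₁ (R , C))))  = R ∈ suffixes E × C ∈ clauses
  InStation (inj₂ (inj₂ (inj₂ l)))        = InLow j (children j clauses) l

  in-advance : ∀ {R C D Ds δ} → R ∈ suffixes E → D ∷ Ds ∈ clauses → δ ∈ verdicts →
               InStation (fun advanceᶠ (((R , C) , (D , Ds)) , δ))
  in-advance {Ds = []}     R∈ C∈ δ∈ = δ∈
  in-advance {Ds = D ∷ Ds} R∈ C∈ δ∈ = R∈ , clauses-tail C∈

  []-suffix : ∀ {S : Set} (xs : List S) → [] ∈ suffixes xs
  []-suffix []       = here refl
  []-suffix (x ∷ xs) = there ([]-suffix xs)

  in-scan : ∀ {R C} → R ∈ suffixes E → C ∈ clauses → InQuery InStation (fun scanᶠ (R , C))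
  in-scan {R} {[]} R∈ C∈ = in-go InStation (R∈ , C∈)
  in-scan {R} {D ∷ Ds} R∈ C∈ with fun (leafOfᶠ j) D in eq
  ... | inj₁ (no  , v) = in-query (ok-leafOf j D (ok-child j (here refl) (ok-clauses C∈)) eq) (in-advance {C = D ∷ Ds} R∈ C∈ (constant-verdict _)) ([]-suffix E , C∈)
  ... | inj₁ (yes , v) = in-query (ok-leafOf j D (ok-child j (here refl) (ok-clauses C∈)) eq) ([]-suffix E , C∈) (in-advance {C = D ∷ Ds} R∈ C∈ (constant-verdict _))
  ... | inj₂ yes = in-go InStation ([]-suffix E , C∈)
  ... | inj₂ no  = in-go InStation (in-advance {C = D ∷ Ds} R∈ C∈ (here refl))

  in-firstMove : ∀ {R C} → R ∈ suffixes E → C ∈ clauses → InQuery InStation (fun firstMoveᶠ (R , C))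
  in-firstMove {[]} R∈ C∈ = in-go InStation (R∈ , C∈)
  in-firstMove {[] ∷ R} R∈ C∈ = in-scan (suffix-tail E R∈) C∈
  in-firstMove {(D ∷ φ) ∷ R} {C} R∈ C∈ =
    in-map {P = InDec (_∈ children (suc j) E)} {Q = InStation} (fun (selectᶠ j true) (C , D ∷ φ))
      [ inj₁ , (λ x → inj₂ (inj₂ (inj₁ (R , x)))) ]′
      (λ { {inj₁ δ} p → p ; {inj₂ x} p → suffix-tail E R∈ , in-clauses p })
      (in-select j true {C} {D ∷ φ} (children (suc j) E) (ok-child k φ∈ ok-route) (child-∈ (suc j) φ∈) (λ s → child-pad (suc j) s E))
    where
    φ∈ : D ∷ φ ∈ E
    φ∈ = suffix-⊆ E R∈ (here refl)

  in-view : ∀ {x} → InStation x → InLow (suc j) clauses (fun viewᶠ x)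
  in-view {inj₁ δ} _ = none-in j {clauses} (inj₁ δ , δ)
  in-view {inj₂ (inj₁ R)} _ = none-in j {clauses} ((inj₂ (inj₁ R) , inj₁ R) , R)
  in-view {inj₂ (inj₂ (inj₁ (R , C)))} (_ , C∈) = C∈
  in-view {inj₂ (inj₂ (inj₂ l))} l∈ = l∈

  in-move : ∀ d {tgt src} → InStation tgt → InStation src → InQuery InStation (fun (moveᶠ d) (tgt , src))
  in-move d {tgt} {inj₁ δ} t∈ s∈ = in-go InStation s∈
  in-move d {tgt} {inj₂ (inj₁ [])} t∈ s∈ = in-go InStation s∈
  in-move d {tgt} {inj₂ (inj₁ (φ ∷ R))} t∈ s∈ = in-go InStation
    (suffix-tail E (subst (_∈ suffixes E) (sym s∈) (suffix-self E)) , in-clauses (child-head (suc j) φ (subst (φ ∈_) s∈ (here refl))))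
  in-move rightward {tgt} {inj₂ (inj₂ (inj₁ (R , C)))} t∈ (R∈ , C∈) = in-firstMove R∈ C∈
  in-move leftward {tgt} {inj₂ (inj₂ (inj₁ (R , C)))} t∈ (R∈ , C∈) = in-go InStation (top-in j (child-head j C C∈))
  in-move d {tgt} {inj₂ (inj₂ (inj₂ l))} t∈ s∈ =
    in-map {P = InDec (InLow j (children j clauses))} {Q = InStation} (fun (lowMoveᶠ j false (isRight d)) (fun viewᶠ tgt , l))
      [ inj₁ , (λ x → inj₂ (inj₂ (inj₂ x))) ]′ (λ { {inj₁ δ} p → p ; {inj₂ x} p → p })
      (in-lowMove j false (isRight d) ok-clauses (in-view {tgt} t∈) s∈)

  in-answer : ∀ h b {q} → InQuery InStation q → InStation (fun (answerᶠ h) (b , q))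
  in-answer h no    {inj₁ x , _} (in-query o p p′)         = p′
  in-answer h yes   {inj₁ x , _} (in-query o p p′)         = p
  in-answer true b  {inj₂ (inj₁ y) , _} (in-query o p p′)  = p
  in-answer false b {inj₂ (inj₁ y) , _} (in-query o p p′)  = p′
  in-answer h no    {inj₂ (inj₂ z) , _} (in-query o p p′)  = p′
  in-answer true yes  {inj₂ (inj₂ z) , _} (in-query o p p′) = o z refl
  in-answer false yes {inj₂ (inj₂ z) , _} (in-query o p p′) = p

  InCode : ⟦ codeTy ⟧ → Set
  InCode (inj₁ x)       = InStation x
  InCode (inj₂ (b , x)) = InStation x

  in-step : ∀ d h {tgt src} → InCode tgt → InCode src → InCode (fun (stepᶠ d h) (tgt , src))
  in-step d h {tgt} {inj₁ x} t∈ s∈ = s∈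
  in-step d h {inj₁ y} {inj₂ (b , x)} t∈ s∈ = in-answer h b (in-move d {y} {x} t∈ s∈)
  in-step d h {inj₂ (_ , y)} {inj₂ (b , x)} t∈ s∈ = in-answer h b (in-move d {y} {x} t∈ s∈)

  in-stations : ∀ {x} → InStation x → x ∈ fun stationsᶠ E
  in-stations {inj₁ δ} m = ∈-++⁺ˡ (∈-map⁺ inj₁ m)
  in-stations {inj₂ (inj₁ R)} refl = ∈-++⁺ʳ (map inj₁ verdicts) (here refl)
  in-stations {inj₂ (inj₂ (inj₁ (R , C)))} (R∈ , C∈) = ∈-++⁺ʳ (map inj₁ verdicts) (∈-map⁺ inj₂ (there (∈-++⁺ˡ
    (∈-concat⁺′ (∈-map⁺ _ C∈) (∈-map⁺ (λ R → map (λ C → inj₂ (inj₁ (R , C))) clauses) R∈)))))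
  in-stations {inj₂ (inj₂ (inj₂ l))} l∈ = ∈-++⁺ʳ (map inj₁ verdicts) (∈-map⁺ inj₂ (there (∈-++⁺ʳ
    (concat (map (λ R → map (λ C → inj₂ (inj₁ (R , C))) clauses) (suffixes E))) (∈-map⁺ (λ l → inj₂ (inj₂ l)) (in-lows j l l∈)))))

  stations-in : ∀ {x} → x ∈ fun stationsᶠ E → InStation x
  stations-in m with ∈-++⁻ (map inj₁ verdicts) m
  ... | inj₁ m′ with δ , m″ , refl ← ∈-map⁻ inj₁ m′ = m″
  ... | inj₂ m′ with ∈-map⁻ inj₂ m′
  ... | _ , here refl , refl = refl
  ... | _ , there m″ , refl with ∈-++⁻ (concat (map (λ R → map (λ C → inj₂ (inj₁ (R , C))) clauses) (suffixes E))) m″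
  ... | inj₂ m‴ with l , l∈ , refl ← ∈-map⁻ (λ l → inj₂ (inj₂ l)) m‴ = lows-in j l∈
  ... | inj₁ m‴ with S , S∈ , R∈ ← ∈-concat⁻′ (map (λ R → map (λ C → inj₂ (inj₁ (R , C))) clauses) (suffixes E)) m‴
                with R , R∈E , refl ← ∈-map⁻ (λ R → map (λ C → inj₂ (inj₁ (R , C))) clauses) R∈
                with C , C∈ , refl ← ∈-map⁻ (λ C → inj₂ (inj₁ (R , C))) S∈ = R∈E , C∈

  -- Opaque, because unfolding this list in conversion checks is infeasible.
  abstract

    codes : List ⟦ codeTy ⟧
    codes = fun codesᶠ E

    codes-≡ : fun codesᶠ E ≡ codes
    codes-≡ = refl

    in-codes : ∀ {c} → InCode c → c ∈ codes
    in-codes {inj₁ x} m = ∈-++⁺ˡ (∈-map⁺ inj₁ (in-stations m))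
    in-codes {inj₂ (no , x)} m = ∈-++⁺ʳ (map inj₁ (fun stationsᶠ E)) (∈-++⁺ˡ (∈-map⁺ (λ x → inj₂ (no , x)) (in-stations m)))
    in-codes {inj₂ (yes , x)} m = ∈-++⁺ʳ (map inj₁ (fun stationsᶠ E)) (∈-++⁺ʳ (map (λ x → inj₂ (no , x)) (fun stationsᶠ E))
      (∈-map⁺ (λ x → inj₂ (yes , x)) (in-stations m)))

    codes-in : ∀ {c} → c ∈ codes → InCode c
    codes-in m with ∈-++⁻ (map inj₁ (fun stationsᶠ E)) m
    ... | inj₁ m′ with x , m″ , refl ← ∈-map⁻ inj₁ m′ = stations-in m″
    ... | inj₂ m′ with ∈-++⁻ (map (λ x → inj₂ (no , x)) (fun stationsᶠ E)) m′
    ... | inj₁ m″ with x , m‴ , refl ← ∈-map⁻ (λ x → inj₂ (no , x)) m″ = stations-in m‴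
    ... | inj₂ m″ with x , m‴ , refl ← ∈-map⁻ (λ x → inj₂ (yes , x)) m″ = stations-in m‴

-- The schema

∈-tail : ∀ A {x y ys} → same A x y ≡ no → x ∈ y ∷ ys → x ∈ ys
∈-tail A {x} e (here refl) with () ← trans (sym e) (same-refl A x)
∈-tail A     e (there m)   = m

-- Repeats the recursion of `position`, so that the index in `Fin` is by construction the one that
-- the program writes in unary.
locate    : ∀ A x xs → x ∈ xs → Fin (length xs)
locate-by : ∀ A x y ys → x ∈ y ∷ ys → (b : ⊤ ⊎ ⊤) → same A x y ≡ b → Fin (suc (length ys))
locate A x (y ∷ ys) m = locate-by A x y ys m (same A x y) refl
locate-by A x y ys m yes e = zero
locate-by A x y ys m no  e = suc (locate A x ys (∈-tail A e m))

lookup-locate    : ∀ A x xs m → lookup xs (locate A x xs m) ≡ x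
lookup-locate-by : ∀ A x y ys m b e → lookup (y ∷ ys) (locate-by A x y ys m b e) ≡ x
lookup-locate A x (y ∷ ys) m = lookup-locate-by A x y ys m (same A x y) refl
lookup-locate-by A x y ys m yes e = sym (same-sound A e)
lookup-locate-by A x y ys m no  e = lookup-locate A x ys (∈-tail A e m)

position-locate    : ∀ A x xs m → position A x xs ≡ encodeUnary (toℕ (locate A x xs m))
position-locate-by : ∀ A x y ys m b e → [ (λ _ → tt ∷ position A x ys) , (λ _ → []) ]′ b ≡ encodeUnary (toℕ (locate-by A x y ys m b e))
position-locate A x (y ∷ ys) m = position-locate-by A x y ys m (same A x y) refl
position-locate-by A x y ys m yes e = refl
position-locate-by A x y ys m no  e = cong (tt ∷_) (position-locate A x ys (∈-tail A e m))

map-lookup : ∀ {S T : Set} (f : S → T) xs → map f xs ≡ tabulate (λ i → f (lookup xs i))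
map-lookup f xs = trans (cong (map f) (sym (tabulate-lookup xs))) (map-tabulate (lookup xs) f)

-- Decoding of indices and labels

decodeℕᵇ : ⟦ bits ⟧ → ℕᵇ
decodeℕᵇ []         = Bin.zero
decodeℕᵇ (no  ∷ bs) = Bin.2[1+ decodeℕᵇ bs ]
decodeℕᵇ (yes ∷ bs) = Bin.1+[2 decodeℕᵇ bs ]

decode-encodeℕᵇ : ∀ b → decodeℕᵇ (encodeℕᵇ b) ≡ b
decode-encodeℕᵇ Bin.zero     = refl
decode-encodeℕᵇ Bin.2[1+ b ] = cong Bin.2[1+_] (decode-encodeℕᵇ b)
decode-encodeℕᵇ Bin.1+[2 b ] = cong Bin.1+[2_] (decode-encodeℕᵇ b)

decodeIndex : ⟦ bits ⟧ → ℕ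
decodeIndex bs = Bin.toℕ (decodeℕᵇ bs)

decode-encodeIndex : ∀ {n} (i : Fin n) → decodeIndex (encodeIndex i) ≡ toℕ i
decode-encodeIndex i = trans (cong Bin.toℕ (decode-encodeℕᵇ (Bin.fromℕ (toℕ i)))) (Binₚ.toℕ-fromℕ (toℕ i))

fromℕ<-unique : ∀ {m n} {i : Fin n} (m<n : m < n) → m ≡ toℕ i → fromℕ< m<n ≡ i
fromℕ<-unique {i = i} m<n refl = fromℕ<-toℕ i m<n

-- An index out of range falls back to `𝟎`; the labels of the enumerated codes are shown to be
-- encodings, so that encoding the decoded label gives back what the program wrote.
decodeLabel : ∀ n → ⟦ labelTy ⟧ → Label n
decodeLabel n (inj₁ no)  = 𝟎
decodeLabel n (inj₁ yes) = 𝟏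
decodeLabel n (inj₂ bs) with decodeIndex bs <? n
... | Dec.yes i<n = var (fromℕ< i<n)
... | Dec.no _    = 𝟎

decode-encodeLabel : ∀ {n} (l : Label n) → decodeLabel n (encodeLabel l) ≡ l
decode-encodeLabel 𝟎 = refl
decode-encodeLabel 𝟏 = refl
decode-encodeLabel {n} (var i) with decodeIndex (encodeIndex i) <? n
... | Dec.no ≮n   = ⊥-elim (≮n (subst (_< n) (sym (decode-encodeIndex i)) (toℕ<n i)))
... | Dec.yes i<n = cong var (fromℕ<-unique i<n (decode-encodeIndex i))

double : ℕ → ℕ
double zero    = 0
double (suc n) = suc (suc (double n))

tableOf : ∀ A → List ⟦ A ⟧ → (⟦ A ⟧ → ⟦ A ⟧ → ⟦ A ⟧) → ⟦ tableTy ⟧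
tableOf A codes f = map (λ b → map (λ c → position A (f b c) codes) codes) codes

-- Stated for an arbitrary step function on a closed list of codes, so that the comparison of tables
-- with `encodeSchema` does not involve the machine.
module Tabulate (A : Ty) (codes : List ⟦ A ⟧) (In : ⟦ A ⟧ → Set) (∈-codes : ∀ c → In c → c ∈ codes) (codes-∈ : ∀ c → c ∈ codes → In c)
                (step : Direction → Bool → ⟦ A ⟧ → ⟦ A ⟧ → ⟦ A ⟧) (step-in : ∀ d h src tgt → In src → In tgt → In (step d h src tgt))
                (Λ : ⟦ A ⟧) (Λ-in : In Λ) (n : ℕ) (labelOf : ⟦ A ⟧ → ⟦ labelTy ⟧) (valid : ∀ c → In c → ∃[ l ] labelOf c ≡ encodeLabel {n} l)
                (k extra : ℕ) where

  code : Fin (length codes) → ⟦ A ⟧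
  code = lookup codes

  code-in : ∀ s → In (code s)
  code-in s = codes-∈ (code s) (∈-lookup s)

  symbol : ∀ c → In c → Fin (length codes)
  symbol c m = locate A c codes (∈-codes c m)

  code-symbol : ∀ c m → code (symbol c m) ≡ c
  code-symbol c m = lookup-locate A c codes (∈-codes c m)

  stepSymbol : Direction → Bool → Fin (length codes) → Fin (length codes) → Fin (length codes)
  stepSymbol d h src tgt = symbol (step d h (code src) (code tgt)) (step-in d h (code src) (code tgt) (code-in src) (code-in tgt))

  schema : Schema k n
  schema = record
    { arena = record
      { extra = extra
      ; size  = length codes
      ; Λ     = symbol Λ Λ-in
      ; T→    = λ h b c → stepSymbol rightward h b c
      ; T←    = λ h b c → stepSymbol leftward h c b
      }
    ; label = λ s → decodeLabel n (labelOf (code s))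
    }

  encode-label : ∀ {l} → ∃[ l′ ] l ≡ encodeLabel {n} l′ → encodeLabel (decodeLabel n l) ≡ l
  encode-label (l , refl) = cong encodeLabel (decode-encodeLabel l)

  table-≡ : ∀ (f : ⟦ A ⟧ → ⟦ A ⟧ → ⟦ A ⟧) (f∈ : ∀ b c → In b → In c → In (f b c)) →
            map (λ b → map (λ c → position A (f b c) codes) codes) codes ≡
            tabulate (λ b → tabulate (λ c → encodeUnary (toℕ (symbol (f (code b) (code c)) (f∈ (code b) (code c) (code-in b) (code-in c))))))
  table-≡ f f∈ = trans (map-lookup _ codes) (tabulate-cong λ b → trans (map-lookup _ codes) (tabulate-cong λ c →
    position-locate A (f (code b) (code c)) codes (∈-codes (f (code b) (code c)) (f∈ (code b) (code c) (code-in b) (code-in c)))))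

  size-≡ : ∀ {S : Set} (xs : List S) → map (λ _ → tt) xs ≡ List.replicate (length xs) tt
  size-≡ []       = refl
  size-≡ (x ∷ xs) = cong (tt ∷_) (size-≡ xs)

  schema-≡ : ∀ {sq} → sq ≡ encodeUnary (2 + extra) →
    (sq , (map (λ _ → tt) codes , (position A Λ codes ,
      ((tableOf A codes (λ b c → step rightward false b c) , tableOf A codes (λ b c → step rightward true b c)) ,
       ((tableOf A codes (λ b c → step leftward false c b) , tableOf A codes (λ b c → step leftward true c b)) , map labelOf codes)))))
    ≡ encodeSchema schema
  schema-≡ sq≡ = cong₂ _,_ sq≡ (cong₂ _,_ (size-≡ codes) (cong₂ _,_ (position-locate A Λ codes (∈-codes Λ Λ-in))
    (cong₂ _,_ (cong₂ _,_ (right false) (right true)) (cong₂ _,_ (cong₂ _,_ (left false) (left true))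
      (trans (map-lookup labelOf codes) (tabulate-cong λ s → sym (encode-label (valid (code s) (code-in s)))))))))
    where
    right : ∀ h → tableOf A codes (λ b c → step rightward h b c) ≡ tabulate (λ b → tabulate (λ c → encodeUnary (toℕ (stepSymbol rightward h b c))))
    right h = table-≡ (λ b c → step rightward h b c) (λ b c b∈ c∈ → step-in rightward h b c b∈ c∈)
    left : ∀ h → tableOf A codes (λ b c → step leftward h c b) ≡ tabulate (λ b → tabulate (λ c → encodeUnary (toℕ (stepSymbol leftward h c b))))
    left h = table-≡ (λ b c → step leftward h c b) (λ b c b∈ c∈ → step-in leftward h c b c∈ b∈)

module _ (j : ℕ) where

  open Machine j

  stepCode : Direction → Bool → ⟦ codeTy ⟧ → ⟦ codeTy ⟧ → ⟦ codeTy ⟧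
  stepCode d h src tgt = fun (stepᶠ d h) (tgt , src)

  labelOfCode : ⟦ bool ⟧ → ⟦ codeTy ⟧ → ⟦ labelTy ⟧
  labelOfCode e c = fun labelOfᶠ (e , fun stationᶠ c)

  schema-unfold : ∀ E e codes → fun schemaOfᶠ ((E , e) , codes) ≡
    (fun squaresᶠ E , (map (λ _ → tt) codes , (position codeTy (inj₁ (inj₂ (inj₁ E))) codes ,
      ((tableOf codeTy codes (λ b c → stepCode rightward false b c) , tableOf codeTy codes (λ b c → stepCode rightward true b c)) ,
       ((tableOf codeTy codes (λ b c → stepCode leftward false c b) , tableOf codeTy codes (λ b c → stepCode leftward true c b)) , map (labelOfCode e) codes)))))
  schema-unfold E e codes = refl

module Build (j n : ℕ) (φ : F (2 + j)) (E′ : List (F (2 + j)))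
             (valid : ∀ {b bs} → inj₁ (b , inj₂ (inj₂ bs)) ∈ leaves (3 + j) (φ ∷ E′) → ∃[ i ] bs ≡ encodeIndex {n} i)
             (e : ⟦ bool ⟧) where

  open Machine j

  E : List (F k)
  E = φ ∷ E′

  open Closure j E

  Valid : ⟦ labelTy ⟧ → Set
  Valid l = ∃[ l′ ] l ≡ encodeLabel {n} l′

  valid-bool : ∀ b → Valid (inj₁ b)
  valid-bool no  = 𝟎 , refl
  valid-bool yes = 𝟏 , refl

  valid-verdict : ∀ {δ} → δ ∈ verdicts → Valid (fun labelOfᶠ (e , inj₁ δ))
  valid-verdict (here refl)                 = valid-bool e
  valid-verdict (there (here refl))         = valid-bool no
  valid-verdict (there (there (here refl))) = valid-bool yes
  valid-verdict (there (there (there m))) with l , m′ , refl ← ∈-map⁻ (fun zlabelᶠ) m = valid-leaf l m′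
    where
    valid-leaf : ∀ l → l ∈ leaves (3 + j) E → Valid (fun labelOfᶠ (e , inj₁ (fun zlabelᶠ l)))
    valid-leaf (inj₁ (b , inj₁ x))         m = valid-bool e
    valid-leaf (inj₁ (b , inj₂ (inj₁ y)))  m = valid-bool e
    valid-leaf (inj₁ (b , inj₂ (inj₂ bs))) m with i , refl ← valid m = var i , refl
    valid-leaf (inj₂ b)                    m = valid-bool e

  valid-blame : ∀ l → Valid (fun blameLeafᶠ l)
  valid-blame (inj₁ (b , v)) = valid-bool _
  valid-blame (inj₂ b)       = valid-bool _

  valid-station : ∀ x → InStation x → Valid (fun labelOfᶠ (e , x))
  valid-station (inj₁ δ)                     m = valid-verdict m
  valid-station (inj₂ (inj₁ R))              m = valid-bool _
  valid-station (inj₂ (inj₂ (inj₁ (R , C)))) m = valid-blame (fun (leafOfᶠ (suc j)) C)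
  valid-station (inj₂ (inj₂ (inj₂ l)))       m = valid-blame (fun (lowLeafᶠ j) l)

  valid-code : ∀ c → InCode c → Valid (labelOfCode j e c)
  valid-code (inj₁ x)       m = valid-station x m
  valid-code (inj₂ (b , x)) m = valid-station x m

  squares-≡ : ∀ (xs : List (F k)) → concat (map (λ _ → tt ∷ tt ∷ []) xs) ≡ List.replicate (double (length xs)) tt
  squares-≡ []       = refl
  squares-≡ (x ∷ xs) = cong (λ ts → tt ∷ tt ∷ ts) (squares-≡ xs)

  module T = Tabulate codeTy codes InCode (λ c → in-codes {c}) (λ c → codes-in {c}) (stepCode j) (λ d h src tgt s∈ t∈ → in-step d h {tgt} {src} t∈ s∈)
               -- The last argument is `extra`; together with the two squares of every arena it
               -- makes two squares for each element of `E` and one more.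
               (inj₁ (inj₂ (inj₁ E))) refl n (labelOfCode j e) valid-code (suc j) (suc (double (length E′)))

  schema-≡ : fun schemaOfᶠ ((E , e) , codes) ≡ encodeSchema T.schema
  schema-≡ = trans (schema-unfold j E e codes) (T.schema-≡ (cong (tt ∷_) (squares-≡ E)))

-- Plays as sequences of sweeps

_≟ᴾ_ : (P Q : Player) → Dec (P ≡ Q)
I  ≟ᴾ I  = Dec.yes refl
I  ≟ᴾ II = Dec.no λ ()
II ≟ᴾ I  = Dec.no λ ()
II ≟ᴾ II = Dec.yes refl

module Sweeping {k : ℕ} (A : Arena k) where

  open Arena A

  N : ℕ
  N = suc extra

  -- The o-th square visited by a round.
  order : Direction → ℕ → ℕ
  order rightward o = o
  order leftward  o = N ∸ o

  order-turn : ∀ d {o} → o ≤ N → order (turn d) o ≡ order d (N ∸ o)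
  order-turn rightward o≤N = refl
  order-turn leftward  o≤N = sym (m∸[m∸n]≡n o≤N)

  order-≤ : ∀ d {o} → o ≤ N → order d o ≤ N
  order-≤ rightward o≤N = o≤N
  order-≤ leftward  {o} o≤N = m∸n≤m N o

  order-injective : ∀ d {o o′} → o ≤ N → o′ ≤ N → order d o ≡ order d o′ → o ≡ o′
  order-injective rightward o≤N o′≤N e = e
  order-injective leftward  o≤N o′≤N e = ∸-cancelˡ-≡ o≤N o′≤N e

  square : ℕ → Square
  square m with m <? squares
  ... | Dec.yes m< = fromℕ< m<
  ... | Dec.no _   = zero

  square-toℕ : ∀ s → square (toℕ s) ≡ s
  square-toℕ s with toℕ s <? squares
  ... | Dec.yes m< = fromℕ<-toℕ s m<
  ... | Dec.no m≮  = ⊥-elim (m≮ (toℕ<n s))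

  toℕ-square : ∀ {m} → m ≤ N → toℕ (square m) ≡ m
  toℕ-square {m} m≤N with m <? squares
  ... | Dec.yes m< = toℕ-fromℕ< m<
  ... | Dec.no m≮  = ⊥-elim (m≮ (s≤s m≤N))

  content : Direction → Tape → ℕ → Symbol
  content d t o = Vec.lookup t (square (order d o))

  write : Direction → Bool → Symbol → Symbol → Symbol
  write rightward h src tgt = T→ h src tgt
  write leftward  h src tgt = T← h tgt src

  data Path (d : Direction) : ℕ → ℕ → List Edge → Set where
    []  : ∀ {o} → Path d o o []
    _∷_ : ∀ {o o′ e es} → toℕ (source d e) ≡ order d o × toℕ (target d e) ≡ order d (suc o) × o < N →
          Path d (suc o) o′ es → Path d o o′ (e ∷ es)

  path-++ : ∀ {d o o′ o″ es es′} → Path d o o′ es → Path d o′ o″ es′ → Path d o o″ (es ++ es′)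
  path-++ []       q = q
  path-++ (x ∷ p)  q = x ∷ path-++ p q

  path-right : ∀ m o (f : Fin m → Edge) → (∀ i → toℕ (f i) ≡ o + toℕ i) → o + m ≡ N → Path rightward o N (tabulate f)
  path-right zero    o f f≡ e rewrite trans (sym (+-identityʳ o)) e = []
  path-right (suc m) o f f≡ e =
    (trans (toℕ-inject₁ (f zero)) f₀ , cong suc f₀ , ≤-trans (m<m+n o (s≤s z≤n)) (≤-reflexive e))
    ∷ path-right m (suc o) (f ∘ suc) (λ i → trans (f≡ (suc i)) (+-suc o (toℕ i))) (trans (sym (+-suc o m)) e)
    where
    f₀ : toℕ (f zero) ≡ o
    f₀ = trans (f≡ zero) (+-identityʳ o)

  path-left : ∀ m c (f : Fin m → Edge) → (∀ i → toℕ (f i) ≡ c + toℕ i) → c + m ≡ N → Path leftward 0 m (reverse (tabulate f))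
  path-left zero    c f f≡ e = []
  path-left (suc m) c f f≡ e = subst (Path leftward 0 (suc m)) (sym (unfold-reverse (f zero) (tabulate (f ∘ suc))))
    (path-++ (path-left m (suc c) (f ∘ suc) (λ i → trans (f≡ (suc i)) (+-suc c (toℕ i))) e′) (last ∷ []))
    where
    e′ : suc c + m ≡ N
    e′ = trans (sym (+-suc c m)) e
    f₀ : toℕ (f zero) ≡ c
    f₀ = trans (f≡ zero) (+-identityʳ c)
    last : suc (toℕ (f zero)) ≡ N ∸ m × toℕ (inject₁ (f zero)) ≡ N ∸ suc m × m < N
    last = trans (cong suc f₀) (sym (trans (cong (_∸ m) (sym e′)) (m+n∸n≡m (suc c) m)))
         , trans (trans (toℕ-inject₁ (f zero)) f₀) (sym (trans (cong (_∸ suc m) (sym e)) (m+n∸n≡m c (suc m))))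
         , ≤-trans (m≤n+m (suc m) c) (≤-reflexive e)

  path-edges : ∀ d → Path d 0 N (edges d)
  path-edges rightward = path-right N 0 id (λ _ → refl) refl
  path-edges leftward  = path-left N 0 id (λ _ → refl) refl

  module Following {P : Player} (bit : Direction → Symbol → Symbol → Bool) where

    choice : Direction → Symbol → Symbol → Bool
    choice rightward b c = bit rightward b c
    choice leftward  b c = bit leftward c b

    strategy : Strategy P
    strategy = record
      { σ     = λ r j own b c → transition (dir r) (choice (dir r) b c) b c
      ; legal = λ r j own b c → choice (dir r) b c , refl
      }

    -- A move that follows the strategy agrees with it in the symbol written, not necessarily in the
    -- bit. The bit recorded here may thus differ from the one played; on the player's own squares
    -- it is chosen to be the prescribed one.
    record Written (d : Direction) (o : ℕ) (src tgt w : Symbol) : Set where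
      field
        h     : Bool
        w≡    : w ≡ write d h src tgt
        owned : mover (order d o) ≡ P → h ≡ bit d src tgt

    -- A move reads its source as just written, from `t′`, and its target as the preceding round
    -- left it, from `t`.
    record Swept (d : Direction) (t t′ : Tape) (from : ℕ) : Set where
      field
        before : ∀ {o} → o ≤ from → content d t′ o ≡ content d t o
        after  : ∀ {o} → from ≤ o → o < N → Written d o (content d t′ o) (content d t (suc o)) (content d t′ (suc o))

    content-source : ∀ d {t o e} → toℕ (source d e) ≡ order d o → Vec.lookup t (source d e) ≡ content d t o
    content-source d {t} {o} {e} eq = cong (Vec.lookup t) (trans (sym (square-toℕ (source d e))) (cong square eq))

    content-target : ∀ d {t o e} → toℕ (target d e) ≡ order d (suc o) → Vec.lookup t (target d e) ≡ content d t (suc o)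
    content-target d {t} {o} {e} eq = cong (Vec.lookup t) (trans (sym (square-toℕ (target d e))) (cong square eq))

    transition-write : ∀ d h {t o e} → toℕ (source d e) ≡ order d o → toℕ (target d e) ≡ order d (suc o) →
      transition d h (Vec.lookup t (left e)) (Vec.lookup t (right e)) ≡ write d h (content d t o) (content d t (suc o))
    transition-write rightward h {t} s≡ t≡ = cong₂ (T→ h) (content-source rightward {t} s≡) (content-target rightward {t} t≡)
    transition-write leftward  h {t} {o} {e} s≡ t≡ = cong₂ (T← h) (content-target leftward {t} {o} {e} t≡) (content-source leftward {t} {o} {e} s≡)

    choice-bit : ∀ d {t o e} → toℕ (source d e) ≡ order d o → toℕ (target d e) ≡ order d (suc o) →
      choice d (Vec.lookup t (left e)) (Vec.lookup t (right e)) ≡ bit d (content d t o) (content d t (suc o))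
    choice-bit rightward {t} s≡ t≡ = cong₂ (bit rightward) (content-source rightward {t} s≡) (content-target rightward {t} t≡)
    choice-bit leftward {t} {o} {e} s≡ t≡ = cong₂ (bit leftward) (content-source leftward {t} {o} {e} s≡) (content-target leftward {t} {o} {e} t≡)

    content-updated : ∀ d {t : Tape} {o o′ e w} → toℕ (target d e) ≡ order d o → o ≤ N → o′ ≤ N → o′ ≢ o →
                      content d (t [ target d e ]≔ w) o′ ≡ content d t o′
    content-updated d {t} {o} {o′} {e} {w} t≡ o≤N o′≤N o′≢o = lookup∘update′ distinct t w
      where
      distinct : square (order d o′) ≢ target d e
      distinct eq = o′≢o (order-injective d o′≤N o≤N
        (trans (sym (toℕ-square (order-≤ d o′≤N))) (trans (cong toℕ eq) t≡)))

    content-written : ∀ d {t : Tape} {o e w} → toℕ (target d e) ≡ order d o → content d (t [ target d e ]≔ w) o ≡ w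
    content-written d {t} {o} {e} {w} t≡ =
      trans (cong (Vec.lookup (t [ target d e ]≔ w)) (trans (cong square (sym t≡)) (square-toℕ (target d e)))) (lookup∘update (target d e) t w)

    sweep : ∀ r {es o rest t s s′} → Path (dir r) o N es → o ≤ N → s ≡ content (dir r) t o →
            (π : Play (map (r ,_) es ++ rest) t s s′) → Follows strategy π →
            ∃[ t′ ] ∃[ s″ ] Σ[ π′ ∈ Play rest t′ s″ s′ ] (Follows strategy π′ × s″ ≡ content (dir r) t′ N × Swept (dir r) t t′ o)
    sweep r {t = t} [] o≤N s≡ π f = t , _ , π , f , s≡ , record { before = λ _ → refl ; after = λ N≤o o<N → ⊥-elim (<⇒≱ o<N N≤o) }
    sweep r {e ∷ es} {o} {t = t} ((s≡ , t≡ , o<N) ∷ path) o≤N _ (move h π) (own , f)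
      with t′ , s″ , π′ , f′ , s″≡ , swept ← sweep r path o<N (sym (content-written (dir r) {t = t} t≡)) π f =
      t′ , s″ , π′ , f′ , s″≡ , record
        { before = λ {o′} o′≤o → trans (Swept.before swept (m≤n⇒m≤1+n o′≤o)) (unchanged o′≤o)
        ; after = λ {o′} o≤o′ o′<N → next o′ o′<N (m≤n⇒m<n∨m≡n o≤o′)
        }
      where
      d = dir r
      w = transition d h (Vec.lookup t (left e)) (Vec.lookup t (right e))
      t₁ = t [ target d e ]≔ w
      unchanged : ∀ {o′} → o′ ≤ o → content d t₁ o′ ≡ content d t o′
      unchanged o′≤o = content-updated d {t = t} {w = w} t≡ o<N (≤-trans o′≤o o≤N) (<⇒≢ (s≤s o′≤o))
      written : Written d o (content d t o) (content d t (suc o)) w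
      written with mover (order d o) ≟ᴾ P
      ... | Dec.no other = record { h = h ; w≡ = transition-write d h {t} s≡ t≡ ; owned = λ eq → ⊥-elim (other eq) }
      ... | Dec.yes mine = record
        { h = bit d (content d t o) (content d t (suc o))
        ; w≡ = trans (own (trans (cong mover s≡) mine)) (trans (transition-write d _ {t} s≡ t≡)
                 (cong (λ b → write d b (content d t o) (content d t (suc o))) (choice-bit d {t} s≡ t≡)))
        ; owned = λ _ → refl }
      next : ∀ o′ → o′ < N → o < o′ ⊎ o ≡ o′ → Written d o′ (content d t′ o′) (content d t (suc o′)) (content d t′ (suc o′))
      next o′ o′<N (inj₁ o<o′) = subst (λ x → Written d o′ (content d t′ o′) x (content d t′ (suc o′)))
        (content-updated d {t = t} {w = w} t≡ o<N o′<N (λ eq → <⇒≢ o<o′ (sym (suc-injective eq)))) (Swept.after swept o<o′ o′<N)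
      next o′ o′<N (inj₂ refl) = subst₂ (λ x y → Written d o x (content d t (suc o)) y)
        (sym (trans (Swept.before swept (n≤1+n o)) (unchanged ≤-refl)))
        (sym (trans (Swept.before swept ≤-refl) (content-written d {t = t} t≡))) written

    data Course : Direction → ℕ → Tape → Symbol → Set where
      over  : ∀ {d t} → Course d 0 t (content d t 0)
      round : ∀ {d n t t′ s} → Swept d t t′ 0 → Course (turn d) n t′ s → Course d (suc n) t s

    data Alternating : Direction → List Round → Set where
      []  : ∀ {d} → Alternating d []
      _∷_ : ∀ {d r rs} → dir r ≡ d → Alternating (turn d) rs → Alternating d (r ∷ rs)

    alternating-tabulate : ∀ m n (f : Fin n → Round) → (∀ i → toℕ (f i) ≡ m + toℕ i) → Alternating (direction m) (tabulate f)
    alternating-tabulate m zero    f f≡ = []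
    alternating-tabulate m (suc n) f f≡ = cong direction (trans (f≡ zero) (+-identityʳ m))
      ∷ alternating-tabulate (suc m) n (f ∘ suc) (λ i → trans (f≡ (suc i)) (+-suc m (toℕ i)))

    course : ∀ {d rs t s s′} → Alternating d rs → s ≡ content d t 0 →
             (π : Play (concatMap (λ r → map (r ,_) (edges (dir r))) rs) t s s′) → Follows strategy π → Course d (length rs) t s′
    course [] refl done f = over
    course {rs = r ∷ rs} (refl ∷ alt) s≡ π f
      with t′ , s″ , π′ , f′ , s″≡ , swept ← sweep r (path-edges (dir r)) z≤n s≡ π f =
      round swept (course alt (trans s″≡ (cong (λ m → Vec.lookup t′ (square m)) (sym (order-turn (dir r) {0} z≤n)))) π′ f′)

-- Replay of a play with two squares per station

double-∸ : ∀ L i → double L ∸ double i ≡ double (L ∸ i)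
double-∸ L       zero    = refl
double-∸ zero    (suc i) = refl
double-∸ (suc L) (suc i) = double-∸ L i

double-∸-suc : ∀ L i → i < L → double L ∸ suc (double i) ≡ suc (double (L ∸ suc i))
double-∸-suc (suc L) zero    _         = refl
double-∸-suc (suc L) (suc i) (s≤s i<L) = double-∸-suc L i i<L

double-mono : ∀ {i L} → i ≤ L → double i ≤ double L
double-mono z≤n       = z≤n
double-mono (s≤s i≤L) = s≤s (s≤s (double-mono i≤L))

double-< : ∀ {i L} → i < L → suc (double i) < double L
double-< (s≤s i≤L) = s≤s (s≤s (double-mono i≤L))

mover-double : ∀ i → mover (double i) ≡ I
mover-double zero    = refl
mover-double (suc i) rewrite mover-double i = refl

record Coding (Code Station Query : Set) : Set₁ where
  field
    stop      : Station → Code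
    middle    : Bool → Station → Code
    station   : Code → Station
    query     : Direction → Station → Station → Query
    answer    : Bool → Bool → Query → Station
    step      : Direction → Bool → Code → Code → Code
    station-stop   : ∀ x → station (stop x) ≡ x
    station-middle : ∀ h x → station (middle h x) ≡ x
    step-stop      : ∀ d h x c → step d h (stop x) c ≡ middle h x
    step-middle    : ∀ d h₂ h₁ x c → step d h₂ (middle h₁ x) c ≡ stop (answer h₂ h₁ (query d x (station c)))

module Replay {k} (A : Arena k) {Code Station Query : Set} (coding : Coding Code Station Query) (L : ℕ)
  (N≡ : suc (Arena.extra A) ≡ double L) (code : Arena.Symbol A → Code)
  (code-write : ∀ d h src tgt → code (Sweeping.write A d h src tgt) ≡ Coding.step coding d h (code src) (code tgt))
  (P : Player) (val : Query → Bool) (Outcome : Query → Station → Set)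
  (honest : ∀ q h₁ h₂ → (P ≡ I → h₁ ≡ val q) → (P ≡ II → h₂ ≡ val q) → Outcome q (Coding.answer coding h₂ h₁ q)) where

  open Coding coding
  open Arena A
  open Sweeping A

  bit : Direction → Symbol → Symbol → Bool
  bit d src tgt = val (query d (station (code src)) (station (code tgt)))

  open Following {P} bit

  read : Direction → Tape → ℕ → Code
  read d t o = code (content d t o)

  bound : ∀ {m} → m ≤ double L → m ≤ N
  bound m≤ = ≤-trans m≤ (≤-reflexive (sym N≡))

  order-even : ∀ i → N ∸ double i ≡ double (L ∸ i)
  order-even i = trans (cong (_∸ double i) N≡) (double-∸ L i)

  order-odd : ∀ i → i < L → N ∸ suc (double i) ≡ suc (double (L ∸ suc i))
  order-odd i i<L = trans (cong (_∸ suc (double i)) N≡) (double-∸-suc L i i<L)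

  mover-even : ∀ d i → mover (order d (double i)) ≡ I
  mover-even rightward i = mover-double i
  mover-even leftward  i = trans (cong mover (order-even i)) (mover-double (L ∸ i))

  mover-odd : ∀ d i → i < L → mover (order d (suc (double i))) ≡ II
  mover-odd rightward i i<L = cong opponent (mover-double i)
  mover-odd leftward  i i<L = trans (cong mover (order-odd i i<L)) (cong opponent (mover-double (L ∸ suc i)))

  -- Both players must compute the same query, so the square between two stations has to show the
  -- station ahead already to Player I, who moves into it. It does: the preceding round wrote there
  -- the station it was leaving, which lies ahead in the opposite direction.
  record Ready d (X : ℕ → Station) (t : Tape) : Set where
    field
      origin : read d t 0 ≡ stop (X 0)
      even   : ∀ i → i ≤ L → station (read d t (double i)) ≡ X i
      odd    : ∀ i → i < L → station (read d t (suc (double i))) ≡ X (suc i)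

  data Replayed : Direction → ℕ → (ℕ → Station) → Station → Set where
    over  : ∀ {d X} → Replayed d 0 X (X 0)
    round : ∀ {d n X w} (Y : ℕ → Station) → Y 0 ≡ X 0 → (∀ i → i < L → Outcome (query d (Y i) (X (suc i))) (Y (suc i))) →
            Replayed (turn d) n (λ i → Y (L ∸ i)) w → Replayed d (suc n) X w

  module Round {d X t t′} (ready : Ready d X t) (swept : Swept d t t′ 0) where

    open Ready ready
    open Swept swept

    Y : ℕ → Station
    Y i = station (read d t′ (double i))

    between : ∀ i → i < L → read d t′ (double i) ≡ stop (Y i) →
              ∃[ h ] (read d t′ (suc (double i)) ≡ middle h (Y i) × (P ≡ I → h ≡ val (query d (Y i) (X (suc i)))))
    between i i<L fresh = h , code≡ , answered₁
      where
      open Written (after {double i} z≤n (bound (<⇒≤ (double-< i<L))))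
      code≡ : read d t′ (suc (double i)) ≡ middle h (Y i)
      code≡ = trans (cong code w≡) (trans (code-write d h _ _)
        (trans (cong (λ c → step d h c (read d t (suc (double i)))) fresh) (step-stop d h _ _)))
      answered₁ : P ≡ I → h ≡ val (query d (Y i) (X (suc i)))
      answered₁ P≡I = trans (owned (trans (mover-even d i) (sym P≡I))) (cong (λ x → val (query d (Y i) x)) (odd i i<L))

    next : ∀ i → i < L → read d t′ (double i) ≡ stop (Y i) →
           read d t′ (double (suc i)) ≡ stop (Y (suc i)) × Outcome (query d (Y i) (X (suc i))) (Y (suc i))
    next i i<L fresh with h₁ , mid , first-answered ← between i i<L fresh = trans code≡ (cong stop (sym Y≡)) , follows
      where
      open Written (after {suc (double i)} z≤n (bound (double-< i<L))) renaming (h to h₂)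
      q = query d (Y i) (X (suc i))
      code≡ : read d t′ (double (suc i)) ≡ stop (answer h₂ h₁ q)
      code≡ = trans (cong code w≡) (trans (code-write d h₂ _ _)
        (trans (cong (λ c → step d h₂ c (read d t (double (suc i)))) mid) (trans (step-middle d h₂ h₁ _ _)
               (cong (λ x → stop (answer h₂ h₁ (query d (Y i) x))) (even (suc i) i<L)))))
      Y≡ : Y (suc i) ≡ answer h₂ h₁ q
      Y≡ = trans (cong station code≡) (station-stop _)
      answered₂ : P ≡ II → h₂ ≡ val q
      answered₂ P≡II = trans (owned (trans (mover-odd d i i<L) (sym P≡II)))
        (cong₂ (λ x y → val (query d x y)) (trans (cong station mid) (station-middle h₁ _)) (even (suc i) i<L))
      follows : Outcome q (Y (suc i))
      follows = subst (Outcome q) (sym Y≡) (honest q h₁ h₂ first-answered answered₂)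

    start-kept : read d t′ 0 ≡ stop (X 0)
    start-kept = trans (cong code (before z≤n)) origin

    Y₀ : Y 0 ≡ X 0
    Y₀ = trans (cong station start-kept) (station-stop _)

    fresh : ∀ i → i ≤ L → read d t′ (double i) ≡ stop (Y i)
    fresh zero    _   = trans start-kept (cong stop (sym Y₀))
    fresh (suc i) i<L = proj₁ (next i i<L (fresh i (<⇒≤ i<L)))

    turned : ∀ {m m′} → m ≤ N → N ∸ m ≡ m′ → read (turn d) t′ m ≡ read d t′ m′
    turned m≤N refl = cong (λ o → code (Vec.lookup t′ (square o))) (order-turn d m≤N)

    ready′ : Ready (turn d) (λ i → Y (L ∸ i)) t′
    ready′ = record
      { origin = trans (turned z≤n N≡) (fresh L ≤-refl)
      ; even   = λ i i≤L → cong station (turned (bound (double-mono i≤L)) (order-even i))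
      ; odd    = λ i i<L → trans (cong station (turned (bound (<⇒≤ (double-< i<L))) (order-odd i i<L)))
                   (let h , mid , _ = between (L ∸ suc i) (earlier i i<L) (fresh (L ∸ suc i) (m∸n≤m L (suc i))) in
                    trans (cong station mid) (station-middle h _))
      }
      where
      earlier : ∀ i → i < L → L ∸ suc i < L
      earlier i i<L = ∸-monoʳ-< {o = 0} (s≤s z≤n) i<L

  replay : ∀ {d m X t s} → Ready d X t → Course d m t s → ∃[ x ] (code s ≡ stop x × Replayed d m X x)
  replay {X = X} ready over = X 0 , Ready.origin ready , over
  replay ready (round swept c) with x , s≡ , p ← replay (Round.ready′ ready swept) c =
    x , s≡ , round Y Y₀ (λ i i<L → proj₂ (next i i<L (fresh i (<⇒≤ i<L)))) p
    where open Round ready swept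

  ready-initially : ∀ x → code Λ ≡ stop x → Ready rightward (λ _ → x) (Vec.replicate squares Λ)
  ready-initially x Λ≡ = record
    { origin = trans (blank 0) Λ≡
    ; even = λ i _ → trans (cong station (trans (blank (double i)) Λ≡)) (station-stop x)
    ; odd = λ i _ → trans (cong station (trans (blank (suc (double i))) Λ≡)) (station-stop x)
    }
    where
    blank : ∀ o → read rightward (Vec.replicate squares Λ) o ≡ code Λ
    blank o = cong code (lookup-replicate (square o) Λ)

  replay-play : ∀ x → code Λ ≡ stop x → ∀ {s} (π : Play schedule (Vec.replicate squares Λ) Λ s) → Follows strategy π →
                ∃[ y ] (code s ≡ stop y × Replayed rightward k (λ _ → x) y)
  replay-play x Λ≡ {s} π f = replay (ready-initially x Λ≡)
    (subst (λ m → Course rightward m (Vec.replicate squares Λ) s) (length-tabulate {n = k} id)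
      (course (alternating-tabulate 0 k id (λ _ → refl)) (sym (lookup-replicate (square 0) Λ)) π f))

-- Winning strategies

true-false : ∀ {b : Bool} → b ≡ true → b ≡ false → ⊥
true-false refl ()

isI : Player → Bool
isI I  = true
isI II = false

module Players (j n : ℕ) (E′ : List (F (2 + j)))
  (valid : ∀ {b bs} → inj₁ (b , inj₂ (inj₂ bs)) ∈ leaves (3 + j) (padE (2 + j) (neutral false) ∷ E′) → ∃[ i ] bs ≡ encodeIndex {n} i)
  (e : ⟦ bool ⟧) (a : Fin n → Bool) where

  open Machine j
  open Build j n (padE (2 + j) (neutral false)) E′ valid e using (E; module T)

  WinLabel : Player → ⟦ labelTy ⟧ → Set
  WinLabel P l = evalLabel a (decodeLabel n l) ≡ isI P

  WinVerdict : Player → ⟦ verdictTy ⟧ → Set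
  WinVerdict P δ = WinLabel P (fun labelOfᶠ (e , inj₁ δ))

  coding : Coding ⟦ codeTy ⟧ ⟦ stationTy ⟧ ⟦ queryTy stationTy ⟧
  coding = record
    { stop = inj₁
    ; middle = λ h x → inj₂ (encodeBool h , x)
    ; station = fun stationᶠ
    ; query = λ d src tgt → fun (moveᶠ d) (tgt , src)
    ; answer = λ h₂ h₁ q → fun (answerᶠ h₂) (encodeBool h₁ , q)
    ; step = stepCode j
    ; station-stop = λ _ → refl
    ; station-middle = λ _ _ → refl
    ; step-stop = λ _ _ _ _ → refl
    ; step-middle = λ _ _ _ _ _ → refl
    }

  code-write : ∀ d h src tgt → T.code (Sweeping.write (Schema.arena T.schema) d h src tgt) ≡ stepCode j d h (T.code src) (T.code tgt)
  code-write rightward h src tgt = T.code-symbol (stepCode j rightward h (T.code src) (T.code tgt)) _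
  code-write leftward  h src tgt = T.code-symbol (stepCode j leftward h (T.code src) (T.code tgt)) _

  module _ (P : Player) (honesty : Honesty) (wins : ∀ δ → Honesty.Win honesty δ → WinVerdict P δ) (val : ⟦ varTy ⟧ → Bool)
    (honest : ∀ q h₁ h₂ → (P ≡ I → h₁ ≡ val (proj₁ q)) → (P ≡ II → h₂ ≡ val (proj₁ q)) →
      Rounds.Won honesty j (fun (answerᶠ h₂) (encodeBool h₁ , q)) ⊎ Tracing.Chosen honesty q (fun (answerᶠ h₂) (encodeBool h₁ , q)))
    {m : ℕ} (route : FirstRound.Route honesty j m (padE (2 + j) (neutral false)) E′) (1≤E′ : 1 ≤ length E′) where

    open Rounds honesty j
    open FirstRound honesty j using (victory)
    module R = Replay (Schema.arena T.schema) coding (length E) refl T.code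
      code-write P (λ q → val (proj₁ q)) (λ q w → Won w ⊎ Tracing.Chosen honesty q w) honest

    replayed-plays : ∀ {d m X w} → R.Replayed d m X w → Plays (length E) d m X w
    replayed-plays R.over = over
    replayed-plays (R.round Y Y₀ next r) = round Y Y₀ (λ i i<L → [ challenged , answered ]′ (next i i<L)) (replayed-plays r)

    victory-label : ∀ {x} → Victory x → WinLabel P (fun labelOfᶠ (e , x))
    victory-label (by-verdict win)  = wins _ win
    victory-label (by-position win) = wins _ (win e)

    won-by : ∀ {s} → WinLabel P (labelOfCode j e (T.code s)) → Game.WonBy (T.schema ⟨ a ⟩) P s
    won-by = by P
      where
      by : ∀ P {s} → WinLabel P (labelOfCode j e (T.code s)) → Game.WonBy (T.schema ⟨ a ⟩) P s
      by I  win = win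
      by II win = win

    winning : HasPositionalWinningStrategy P (T.schema ⟨ a ⟩)
    winning = Sweeping.Following.strategy (Schema.arena T.schema) R.bit , λ {s} π f →
      let x , s≡ , r = R.replay-play (inj₂ (inj₁ E)) (T.code-symbol (inj₁ (inj₂ (inj₁ E))) refl) π f in
      won-by (subst (λ c → WinLabel P (labelOfCode j e c)) (sym s≡) (victory-label (conclude 1≤E′ refl (replayed-plays r))))
      where
      conclude : ∀ {N x} → 1 ≤ N → length E′ ≡ N → Plays (suc N) rightward (suc j) (λ _ → inj₂ (inj₁ E)) x → Victory x
      conclude {suc L′} _ N≡ p = victory (λ _ → refl) route (cong suc N≡) p

  zval : ⟦ bits ⟧ → Bool
  zval bs = evalLabel a (decodeLabel n (inj₂ bs))

  module PlayerI (xval : ⟦ bits ⟧ → Bool) where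

    Poss : ⟦ varTy ⟧ → Bool → Set
    Poss (inj₁ x)        b = xval x ≡ b
    Poss (inj₂ (inj₁ y)) b = ⊤
    Poss (inj₂ (inj₂ z)) b = zval z ≡ b

    honesty : Honesty
    honesty = record { Poss = Poss ; Win = WinVerdict I ; clash = clash }
      where
      clash : ∀ b v → Poss v true → Poss v false → WinVerdict I (inj₂ (fun blameᶠ (b , v)))
      clash b (inj₁ x)        p q = ⊥-elim (true-false p q)
      clash b (inj₂ (inj₁ y)) p q = refl
      clash b (inj₂ (inj₂ z)) p q = ⊥-elim (true-false p q)

    val : ⟦ varTy ⟧ → Bool
    val (inj₁ x)        = xval x
    val (inj₂ (inj₁ y)) = false
    val (inj₂ (inj₂ z)) = zval z

    open Tracing honesty
    open Rounds honesty j

    honest : ∀ q h₁ h₂ → (I ≡ I → h₁ ≡ val (proj₁ q)) → (I ≡ II → h₂ ≡ val (proj₁ q)) →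
             Won (fun (answerᶠ h₂) (encodeBool h₁ , q)) ⊎ Chosen q (fun (answerᶠ h₂) (encodeBool h₁ , q))
    honest (inj₁ x , _)        true  h₂    e₁ e₂ = inj₂ (if-true refl (sym (e₁ refl)))
    honest (inj₁ x , _)        false h₂    e₁ e₂ = inj₂ (if-false refl (sym (e₁ refl)))
    honest (inj₂ (inj₁ y) , _) h₁    true  e₁ e₂ = inj₂ (if-true refl tt)
    honest (inj₂ (inj₁ y) , _) h₁    false e₁ e₂ = inj₂ (if-false refl tt)
    -- The challenge meets a true claim, and the game ends with a label whose value is true.
    honest (inj₂ (inj₂ z) , _) true  true  e₁ e₂ = inj₁ (won (sym (e₁ refl)))
    honest (inj₂ (inj₂ z) , _) true  false e₁ e₂ = inj₂ (if-true refl (sym (e₁ refl)))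
    honest (inj₂ (inj₂ z) , _) false h₂    e₁ e₂ = inj₂ (if-false refl (sym (e₁ refl)))

  module PlayerII (yval : ⟦ bits ⟧ → Bool) where

    -- Player II can refuse a false claim that a z-variable is true, but not a claim that it is
    -- false. This is enough because a true z-literal of his own CNF is negative and can be called
    -- false only by claiming the variable to be true.
    Poss : ⟦ varTy ⟧ → Bool → Set
    Poss (inj₁ x)        b     = ⊤
    Poss (inj₂ (inj₁ y)) b     = yval y ≡ b
    Poss (inj₂ (inj₂ z)) true  = zval z ≡ true
    Poss (inj₂ (inj₂ z)) false = ⊤

    honesty : Honesty
    honesty = record { Poss = Poss ; Win = WinVerdict II ; clash = clash }
      where
      clash : ∀ b v → Poss v true → Poss v false → WinVerdict II (inj₂ (fun blameᶠ (b , v)))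
      clash b (inj₁ x)        p q = refl
      clash b (inj₂ (inj₁ y)) p q = ⊥-elim (true-false p q)
      clash b (inj₂ (inj₂ z)) p q = refl

    val : ⟦ varTy ⟧ → Bool
    val (inj₁ x)        = false
    val (inj₂ (inj₁ y)) = yval y
    -- For a z-variable this bit is the decision to challenge, not a value.
    val (inj₂ (inj₂ z)) = not (zval z)

    not-true : ∀ {b} → true ≡ not b → b ≡ false
    not-true {false} _ = refl

    not-false : ∀ {b} → false ≡ not b → b ≡ true
    not-false {true} _ = refl

    open Tracing honesty
    open Rounds honesty j

    honest : ∀ q h₁ h₂ → (II ≡ I → h₁ ≡ val (proj₁ q)) → (II ≡ II → h₂ ≡ val (proj₁ q)) →
             Won (fun (answerᶠ h₂) (encodeBool h₁ , q)) ⊎ Chosen q (fun (answerᶠ h₂) (encodeBool h₁ , q))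
    honest (inj₁ x , _)        true  h₂    e₁ e₂ = inj₂ (if-true refl tt)
    honest (inj₁ x , _)        false h₂    e₁ e₂ = inj₂ (if-false refl tt)
    honest (inj₂ (inj₁ y) , _) h₁    true  e₁ e₂ = inj₂ (if-true refl (sym (e₂ refl)))
    honest (inj₂ (inj₁ y) , _) h₁    false e₁ e₂ = inj₂ (if-false refl (sym (e₂ refl)))
    honest (inj₂ (inj₂ z) , _) true  true  e₁ e₂ = inj₁ (won (not-true (e₂ refl)))
    honest (inj₂ (inj₂ z) , _) true  false e₁ e₂ = inj₂ (if-true refl (not-false (e₂ refl)))
    honest (inj₂ (inj₂ z) , _) false h₂    e₁ e₂ = inj₂ (if-false refl tt)

-- From refutations to strategies

extend : ∀ {n} → (Fin n → Bool) → ⟦ bits ⟧ → Bool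
extend {n} f bs with decodeIndex bs <? n
... | Dec.yes i<n = f (fromℕ< i<n)
... | Dec.no _    = false

extend-encode : ∀ {n} (f : Fin n → Bool) i → extend f (encodeIndex i) ≡ f i
extend-encode {n} f i with decodeIndex (encodeIndex i) <? n
... | Dec.no ≮n   = ⊥-elim (≮n (subst (_< n) (sym (decode-encodeIndex i)) (toℕ<n i)))
... | Dec.yes i<n = cong f (fromℕ<-unique i<n (decode-encodeIndex i))

length-∈-concat : ∀ {S : Set} {xs : List S} {xss} → xs ∈ xss → length xs ≤ length (concat xss)
length-∈-concat {xs = xs} {xs ∷ xss} (here refl) = ≤-trans (m≤m+n _ (length (concat xss))) (≤-reflexive (sym (length-++ xs)))
length-∈-concat {xs = xs} {ys ∷ xss} (there m)   = ≤-trans (length-∈-concat m) (≤-trans (m≤n+m _ (length ys)) (≤-reflexive (sym (length-++ ys))))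

map-const : ∀ {S T : Set} (y : T) (xs : List S) → map (λ _ → y) xs ≡ replicate (length xs) y
map-const y []       = refl
map-const y (x ∷ xs) = cong (y ∷_) (map-const y xs)

clauseFormula : ∀ {V} j → List (Literal V) → Formula V ∨ (suc j)
clauseFormula j C = node (termsOr (pad j `⊥) (map (λ l → pad j (lit l)) C))

padded : ∀ {V} j → CNF V → Πˢ (2 + j) V
padded j Φ = node (termsOr (pad (suc j) `⊤) (map (clauseFormula j) Φ))

module _ {p q n : ℕ} where

  encode-literals : ∀ {c} j (C : List (Literal (Var p q n))) →
    map (encodeFormula {p} {q} {n} {c} j) (map (λ l → pad j (lit l)) C) ≡ map (λ l → padE j (inj₁ l)) (map encodeLiteral C)
  encode-literals j []      = refl
  encode-literals j (l ∷ C) = cong₂ _∷_ (encode-pad j (lit l)) (encode-literals j C)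

  encoded-index : ∀ {c} m (φ : Formula (Var p q n) c m) {b bs} → inj₁ (b , inj₂ (inj₂ bs)) ∈ leaves m (encodeFormula m φ) →
                  ∃[ i ] bs ≡ encodeIndex {n} i
  encoded-index zero (leaf (lit (pos (zvar i)))) (here refl) = i , refl
  encoded-index zero (leaf (lit (neg (zvar i)))) (here refl) = i , refl
  encoded-index zero (leaf (lit (pos (xvar i)))) (here ())
  encoded-index zero (leaf (lit (neg (xvar i)))) (here ())
  encoded-index zero (leaf (lit (pos (yvar i)))) (here ())
  encoded-index zero (leaf (lit (neg (yvar i)))) (here ())
  encoded-index zero (leaf `⊤) (here ())
  encoded-index zero (leaf `⊥) (here ())
  encoded-index (suc m) (node φs) l∈
    with E , E∈ , l∈E ← leaves-child⁻ m (map (encodeFormula m) (toList φs)) l∈ with φ , φ∈ , refl ← ∈-map⁻ (encodeFormula m) {xs = toList φs} E∈ = encoded-index m φ l∈E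

  module _ (j : ℕ) where

    -- The stations of the first round after ψ, ending with the scanning of
    -- the clauses of ψ₀.
    data Trail (m : ℕ) (ψ₀ : F (2 + j)) : F (2 + j) → List (F (2 + j)) → Set where
      arrive : Trail m ψ₀ ψ₀ (replicate m [])
      pass   : ∀ {ψ C φ R} → Extends (suc j) true (C ∷ φ) ψ → Trail m ψ₀ (C ∷ φ) R → Trail m ψ₀ ψ ((C ∷ φ) ∷ R)

    Proof : Set
    Proof = List (Πˢ (2 + j) (Var p q n))

    -- A reversal with an accumulator: `R` leads from the current line back to the CNF, and each
    -- further line is put in front of it.
    refutation-trail : ∀ {m ψ₀ d} (D : Proof) {R last} → Linked Step (d ∷ D) → List.last (d ∷ D) ≡ just last → Trail m ψ₀ ⌜ d ⌝ R →
                       ∃[ E ] (reverse (map ⌜_⌝ (d ∷ D)) ++ R ≡ ⌜ last ⌝ ∷ E × Trail m ψ₀ ⌜ last ⌝ E)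
    refutation-trail [] [-] refl trail = _ , refl , trail
    refutation-trail {d = node φs} (d′ ∷ D) {R} (step ∷ linked) last≡ trail
      with E , eq , trail′ ← refutation-trail D linked last≡ (pass {C = ⌜ List⁺.head φs ⌝} {φ = map ⌜_⌝ (List⁺.tail φs)} (step-traceable step) trail)
      = E , trans (trans (cong (_++ R) (unfold-reverse ⌜ node φs ⌝ (map ⌜_⌝ (d′ ∷ D)))) (++-assoc (reverse (map ⌜_⌝ (d′ ∷ D))) (⌜ node φs ⌝ ∷ []) R)) eq , trail′

    trail-route : ∀ honesty {m ψ₀ ψ R} → (∀ {C} → C ∈ ψ₀ → FirstRound.Scannable honesty j C × length C ≤ m) → 1 ≤ m →
                  Trail m ψ₀ ψ R → FirstRound.Route honesty j m ψ R
    trail-route honesty ready 1≤m arrive         = FirstRound.arrive ready 1≤m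
    trail-route honesty ready 1≤m (pass e trail) = FirstRound.pass e (trail-route honesty ready 1≤m trail)

    trail-length : ∀ {m ψ₀ ψ R} → 1 ≤ m → Trail m ψ₀ ψ R → 1 ≤ length R
    trail-length (s≤s _) arrive         = s≤s z≤n
    trail-length 1≤m     (pass e trail) = s≤s z≤n

    route-≡ : ∀ D → fun (Machine.routeᶠ j) D ≡ reverse D ++ replicate (suc (length (concat (concat D)))) []
    route-≡ D = cong (λ R → reverse D ++ [] ∷ R) (map-const [] (concat (concat D)))

  module _ (honesty : Honesty) (j : ℕ) where

    open Honesty honesty
    open Tracing honesty using (Fine)
    open FirstRound honesty j

    data ClauseOK : List (Literal (Var p q n)) → Set where
      empty    : Win (inj₁ tt) → ClauseOK []
      nonempty : ∀ {l ls} → (All (λ l → Fine true (inj₁ (encodeLiteral l))) (l ∷ ls) → Win (inj₂ (fun clauseLabelᶠ (encodeLiteral (lastOf l ls))))) →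
                 ClauseOK (l ∷ ls)

    last-map : ∀ {S T : Set} (f : S → T) x xs → lastOf (f x) (map f xs) ≡ f (lastOf x xs)
    last-map f x []       = refl
    last-map f x (y ∷ xs) = last-map f y xs

    all-unmap : ∀ {S T : Set} {P : T → Set} (f : S → T) xs → All P (map f xs) → All (λ x → P (f x)) xs
    all-unmap f []       []       = []
    all-unmap f (x ∷ xs) (p ∷ ps) = p ∷ all-unmap f xs ps

    scannable-clause : ∀ {C} → ClauseOK C → Scannable (encodeFormula (suc j) (clauseFormula {Var p q n} j C))
    scannable-clause (empty win) = subst (λ D → Scannable (D ∷ [])) (sym (encode-pad {c = ∧} j `⊥)) (false-term win)
    scannable-clause (nonempty {l} {ls} h) = subst Scannable (sym (encode-literals j (l ∷ ls)))
      (literals (encodeLiteral l) (map encodeLiteral ls) λ ps →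
        subst (λ l → Win (inj₂ (fun clauseLabelᶠ l))) (sym (last-map encodeLiteral l ls)) (h (all-unmap encodeLiteral (l ∷ ls) ps)))

    scannable-padded : ∀ Φ → (∀ {C} → C ∈ Φ → ClauseOK C) → ∀ {D} → D ∈ encodeFormula (2 + j) (padded j Φ) → Scannable D
    scannable-padded [] ok (here refl) = subst Scannable (sym (encode-pad {c = ∨} (suc j) `⊤)) true-term
    scannable-padded (C ∷ Φ) ok D∈
      with φ , φ∈ , refl ← ∈-map⁻ (encodeFormula (suc j)) {xs = map (clauseFormula j) (C ∷ Φ)} D∈
      with C′ , C′∈ , refl ← ∈-map⁻ (clauseFormula j) φ∈ = scannable-clause (ok C′∈)

    -- For the clauses of the honest player's own CNF: one literal is true under the assignment, so
    -- they are never all claimed to be false.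
    satisfied-clause : ∀ {V : Set} (ρ : V → Var p q n) (α : V → Bool) C → Any (λ l → T (evalLiteral α l)) C →
      (∀ l → l ∈ C → T (evalLiteral α l) → ¬ Fine true (inj₁ (encodeLiteral (mapLiteral ρ l)))) → ClauseOK (map (mapLiteral ρ) C)
    satisfied-clause ρ α (l ∷ ls) sat refute = nonempty λ fines → ⊥-elim (contradictory (l ∷ ls) sat refute fines)
      where
      contradictory : ∀ C → Any (λ l → T (evalLiteral α l)) C →
        (∀ l → l ∈ C → T (evalLiteral α l) → ¬ Fine true (inj₁ (encodeLiteral (mapLiteral ρ l)))) →
        All (λ l → Fine true (inj₁ (encodeLiteral l))) (map (mapLiteral ρ) C) → ⊥
      contradictory (l ∷ C) (here t)  refute (fine ∷ _) = refute l (here refl) t fine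
      contradictory (l ∷ C) (there t) refute (_ ∷ fines) = contradictory C t (λ l m → refute l (there m)) fines

    lastOf-∈ : ∀ {S : Set} (x : S) xs → lastOf x xs ∈ x ∷ xs
    lastOf-∈ x []       = here refl
    lastOf-∈ x (y ∷ xs) = there (lastOf-∈ y xs)

    -- The clauses of the other CNF may all be claimed to be false, but then the label makes the
    -- opponent lose.
    foreign-clause : ∀ {V : Set} (ρ : V → Var p q n) C → (C ≡ [] → Win (inj₁ tt)) →
      (∀ l → l ∈ C → Win (inj₂ (fun clauseLabelᶠ (encodeLiteral (mapLiteral ρ l))))) → ClauseOK (map (mapLiteral ρ) C)
    foreign-clause ρ []       win wins = empty (win refl)
    foreign-clause ρ (l ∷ ls) win wins = nonempty λ _ →
      subst (λ l → Win (inj₂ (fun clauseLabelᶠ (encodeLiteral l)))) (sym (last-map (mapLiteral ρ) l ls)) (wins (lastOf l ls) (lastOf-∈ l ls))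

map-[] : ∀ {S T : Set} {f : S → T} xs → map f xs ≡ [] → xs ≡ []
map-[] [] _ = refl

emptyLabel-yes : ∀ j Φ → (∀ {C} → C ∈ Φ → C ≢ []) → fun (Machine.emptyLabelᶠ j) Φ ≡ yes
emptyLabel-yes j []            ne = refl
emptyLabel-yes j ([] ∷ Φ)      ne = ⊥-elim (ne (here refl) refl)
emptyLabel-yes j ((l ∷ C) ∷ Φ) ne = emptyLabel-yes j Φ (ne ∘ there)

emptyLabel-no : ∀ j Φ → [] ∈ Φ → fun (Machine.emptyLabelᶠ j) Φ ≡ no
emptyLabel-no j ([] ∷ Φ)      _         = refl
emptyLabel-no j ((l ∷ C) ∷ Φ) (there m) = emptyLabel-no j Φ m

T-false : ∀ {b} → T b → b ≡ false → ⊥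
T-false t refl = t

T-not-true : ∀ {b} → T (not b) → b ≡ true → ⊥
T-not-true t refl = t

-- The clauses of both CNFs under a satisfying assignment

module Interpolation (j : ℕ) {p q n : ℕ} (Φ : CNF (Fin p ⊎ Fin n)) (Ψ : CNF (Fin q ⊎ Fin n))
  (zpos : ZPositive Φ) (zneg : ZNegative Ψ) (a : Fin n → Bool)
  (e : ⟦ bool ⟧) (e≡ : e ≡ fun (Machine.emptyLabelᶠ j) (encodeCNF (viaXZ {q = q} Φ))) where

  module _ (E′ : List (F (2 + j)))
    (valid : ∀ {b bs} → inj₁ (b , inj₂ (inj₂ bs)) ∈ leaves (3 + j) (padE (2 + j) (neutral false) ∷ E′) → ∃[ i ] bs ≡ encodeIndex {n} i) where

    open Players j n E′ valid e a

    zval-encode : ∀ i → zval (encodeIndex i) ≡ a i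
    zval-encode i = cong (evalLabel a) (decode-encodeLabel (var i))

    clausesI : Satisfiable Φ a → ∃[ xval ] (∀ {C} → C ∈ viaXZ Φ ++ viaYZ Ψ → ClauseOK {p} {q} (PlayerI.honesty xval) j C)
    clausesI (β , sat) = extend β , λ {C} C∈ → ok (∈-++⁻ (viaXZ Φ) C∈)
      where
      open PlayerI (extend β)
      open Tracing honesty using (Fine)
      ok : ∀ {C} → C ∈ viaXZ Φ ⊎ C ∈ viaYZ Ψ → ClauseOK {p} {q} honesty j C
      ok (inj₁ C∈) with C , C∈Φ , refl ← ∈-map⁻ _ {xs = Φ} C∈ = satisfied-clause honesty j _ _ C (All.lookup sat C∈Φ) λ
        { (pos (inj₁ v)) _ t f → T-false t (trans (sym (extend-encode β v)) f)
        ; (neg (inj₁ v)) _ t f → T-not-true t (trans (sym (extend-encode β v)) f)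
        ; (pos (inj₂ i)) _ t f → T-false t (trans (sym (zval-encode i)) f)
        ; (neg (inj₂ i)) _ t f → T-not-true t (trans (sym (zval-encode i)) f) }
      ok (inj₂ C∈) with C , C∈Ψ , refl ← ∈-map⁻ _ {xs = Ψ} C∈ = foreign-clause honesty j _ C
        (λ _ → cong (λ e → evalLabel a (decodeLabel n (inj₁ e))) (trans e≡ (emptyLabel-yes j (encodeCNF (viaXZ {q = q} Φ)) nonempty′))) λ
        { (pos (inj₁ v)) m → refl
        ; (neg (inj₁ v)) m → refl
        ; (pos (inj₂ i)) m → ⊥-elim (All.lookup (All.lookup zneg C∈Ψ) m i refl)
        ; (neg (inj₂ i)) m → refl }
        where
        nonempty′ : ∀ {C} → C ∈ encodeCNF (viaXZ {q = q} Φ) → C ≢ []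
        nonempty′ m eq with C′ , m′ , refl ← ∈-map⁻ (map encodeLiteral) {xs = viaXZ {q = q} Φ} m
                       with C″ , m″ , refl ← ∈-map⁻ (map (mapLiteral _)) {xs = Φ} m′
                       with refl ← map-[] C″ (map-[] (map (mapLiteral _) C″) eq) with () ← All.lookup sat m″

    clausesII : Satisfiable Ψ a → ∃[ yval ] (∀ {C} → C ∈ viaXZ Φ ++ viaYZ Ψ → ClauseOK {p} {q} (PlayerII.honesty yval) j C)
    clausesII (β , sat) = extend β , λ {C} C∈ → ok (∈-++⁻ (viaXZ Φ) C∈)
      where
      open PlayerII (extend β)
      open Tracing honesty using (Fine)
      ok : ∀ {C} → C ∈ viaXZ Φ ⊎ C ∈ viaYZ Ψ → ClauseOK {p} {q} honesty j C
      ok (inj₂ C∈) with C , C∈Ψ , refl ← ∈-map⁻ _ {xs = Ψ} C∈ = satisfied-clause honesty j _ _ C (All.lookup sat C∈Ψ) λ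
        { (pos (inj₁ v)) _ t f → T-false t (trans (sym (extend-encode β v)) f)
        ; (neg (inj₁ v)) _ t f → T-not-true t (trans (sym (extend-encode β v)) f)
        ; (pos (inj₂ i)) m t f → All.lookup (All.lookup zneg C∈Ψ) m i refl
        ; (neg (inj₂ i)) _ t f → T-not-true t (trans (sym (zval-encode i)) f) }
      ok (inj₁ C∈) with C , C∈Φ , refl ← ∈-map⁻ _ {xs = Φ} C∈ = foreign-clause honesty j _ C
        (λ { refl → cong (λ e → evalLabel a (decodeLabel n (inj₁ e)))
               (trans e≡ (emptyLabel-no j (encodeCNF (viaXZ {q = q} Φ)) (∈-map⁺ (map encodeLiteral) (∈-map⁺ (map (mapLiteral _)) C∈Φ)))) }) λ
        { (pos (inj₁ v)) m → refl
        ; (neg (inj₁ v)) m → refl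
        ; (pos (inj₂ i)) m → refl
        ; (neg (inj₂ i)) m → ⊥-elim (All.lookup (All.lookup zpos C∈Φ) m i refl) }

-- The size of the input

size-++ˡ : ∀ A xs ys → size (list A) xs ≤ size (list A) (xs ++ ys)
size-++ˡ A []       ys = size≥1 (list A) ys
size-++ˡ A (x ∷ xs) ys = s≤s (+-monoʳ-≤ (size A x) (size-++ˡ A xs ys))

size-++ʳ : ∀ A xs ys → size (list A) ys ≤ size (list A) (xs ++ ys)
size-++ʳ A []       ys = ≤-refl
size-++ʳ A (x ∷ xs) ys = m≤n⇒m≤1+n (≤-trans (size-++ʳ A xs ys) (m≤n+m _ (size A x)))

size-∈ : ∀ A {x xs} → x ∈ xs → size A x ≤ size (list A) xs
size-∈ A (here refl) = m≤n⇒m≤1+n (m≤m+n _ _)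
size-∈ A {xs = y ∷ xs} (there m) = m≤n⇒m≤1+n (≤-trans (size-∈ A m) (m≤n+m _ (size A y)))

size-pad : ∀ h l → size leafTy l ≤ size (FT h) (padE h l)
size-pad zero    l = ≤-refl
size-pad (suc h) l = m≤n⇒m≤1+n (≤-trans (size-pad h l) (m≤m+n _ 1))

module _ {p q n : ℕ} (j : ℕ) where

  size-literals : ∀ (C : List (Literal (Var p q n))) →
                  size (list litTy) (map encodeLiteral C) ≤ size (FT (suc j)) (map (λ l → padE j (inj₁ l)) (map encodeLiteral C))
  size-literals []      = ≤-refl
  size-literals (l ∷ C) = s≤s (+-mono-≤ (≤-trans (n≤1+n _) (size-pad j (inj₁ (encodeLiteral l)))) (size-literals C))

  size-clause : ∀ (C : List (Literal (Var p q n))) →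
                size (list litTy) (map encodeLiteral C) ≤ size (FT (suc j)) (encodeFormula (suc j) (clauseFormula j C))
  size-clause []      = s≤s z≤n
  size-clause (l ∷ C) = ≤-trans (size-literals (l ∷ C)) (≤-reflexive (cong (size (FT (suc j))) (sym (encode-literals j (l ∷ C)))))

  size-clauses : ∀ (Φ : CNF (Var p q n)) →
                 size cnfTy (encodeCNF Φ) ≤ size (FT (2 + j)) (map (encodeFormula (suc j)) (map (clauseFormula j) Φ))
  size-clauses []      = ≤-refl
  size-clauses (C ∷ Φ) = s≤s (+-mono-≤ (size-clause C) (size-clauses Φ))

  -- The CNFs are part of the input beside the refutation, whose first line is at least as large;
  -- hence the cost is bounded in terms of the refutation alone.
  size-padded : ∀ (Φ : CNF (Var p q n)) → size cnfTy (encodeCNF Φ) ≤ size (FT (2 + j)) (encodeFormula (2 + j) (padded j Φ))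
  size-padded []      = s≤s z≤n
  size-padded (C ∷ Φ) = size-clauses (C ∷ Φ)

-- The bound `2 + 3 * N` is that of an input of three parts of size at most `N` joined by two
-- pairings.
cost-bound : ∀ {A B} (f : A ⇒ B) → Σ[ d ∈ ℕ ] (∀ a N → size A a ≤ 2 + 3 * N → cost (prog f) a ≤ d * N ^ d + d)
cost-bound f with poly-bound (poly f ⊙ (con 2 ⊞ con 3 ⊠ arg))
... | d , bound = d , λ a N le → ≤-trans (bounded-at f le) (bound N)

head-∈ : ∀ {S : Set} {x : S} xs → List.head xs ≡ just x → x ∈ xs
head-∈ (x ∷ xs) refl = here refl

∈-replicate : ∀ {S : Set} {x y : S} m → x ∈ replicate m y → x ≡ y
∈-replicate (suc m) (here e)  = e
∈-replicate (suc m) (there i) = ∈-replicate m i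

-- The schema of a refutation and its strategies

module Construction (j : ℕ) {p q n : ℕ} (Φ : CNF (Fin p ⊎ Fin n)) (Ψ : CNF (Fin q ⊎ Fin n))
  (zpos : ZPositive Φ) (zneg : ZNegative Ψ) (D : List (Πˢ (2 + j) (Var p q n)))
  (refutation : IsRefutation (2 + j) (s≤s (s≤s z≤n)) (Φ ∧ᶜ Ψ) D) where

  open Machine j hiding (k)
  open IsRefutation refutation

  D′ : List (F (2 + j))
  D′ = encodeProof (2 + j) D

  start-formula : F (2 + j)
  start-formula = encodeFormula (2 + j) (padded j (Φ ∧ᶜ Ψ))

  start-∈ : start-formula ∈ D′
  start-∈ = ∈-map⁺ (encodeFormula (2 + j)) (head-∈ D starts)

  scans : ℕ
  -- One station for each term of a clause of any line, which is enough to scan every clause of the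
  -- CNF, and one more so that there is always a station for a constant clause.
  scans = suc (length (concat (concat D′)))

  trail-from : ∀ D → List.head D ≡ just (padded j (Φ ∧ᶜ Ψ)) → List.last D ≡ just (pad (2 + j) `⊥) → Linked Step D →
    ∃[ E′ ] (reverse (encodeProof (2 + j) D) ++ replicate scans [] ≡ padE (2 + j) (neutral false) ∷ E′
             × Trail {p} {q} {n} j scans start-formula (padE (2 + j) (neutral false)) E′)
  trail-from (d ∷ D) refl last≡ linked
    with E′ , eq , trail ← refutation-trail j D linked last≡ (arrive {m = scans})
    rewrite encode-pad {p} {q} {n} {∧} (2 + j) `⊥ = E′ , eq , trail

  trail-exists : ∃[ E′ ] (reverse D′ ++ replicate scans [] ≡ padE (2 + j) (neutral false) ∷ E′
                          × Trail {p} {q} {n} j scans start-formula (padE (2 + j) (neutral false)) E′)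
  trail-exists = trail-from D starts ends steps

  E′ : List (F (2 + j))
  E′ = proj₁ trail-exists

  route-E : fun routeᶠ D′ ≡ padE (2 + j) (neutral false) ∷ E′
  route-E = trans (route-≡ {p} {q} {n} j D′) (proj₁ (proj₂ trail-exists))

  valid : ∀ {b bs} → inj₁ (b , inj₂ (inj₂ bs)) ∈ leaves (3 + j) (padE (2 + j) (neutral false) ∷ E′) → ∃[ i ] bs ≡ encodeIndex {n} i
  valid l∈ with φ , φ∈ , l∈φ ← leaves-child⁻ (2 + j) (padE (2 + j) (neutral false) ∷ E′) l∈
    with ∈-++⁻ (reverse D′) (subst (φ ∈_) (sym (proj₁ (proj₂ trail-exists))) φ∈)
  ... | inj₁ m with d , _ , refl ← ∈-map⁻ (encodeFormula (2 + j)) {xs = D} (reverse⁻ m) = encoded-index (2 + j) d l∈φ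
  ... | inj₂ m with refl ← ∈-replicate scans m with () ← l∈φ

  label-e : ⟦ bool ⟧
  label-e = fun emptyLabelᶠ (encodeCNF (viaXZ {q = q} Φ))

  open Build j n (padE (2 + j) (neutral false)) E′ valid label-e using (E; module T; schema-≡)

  schema : Schema (suc j) n
  schema = T.schema

  input : ⟦ inputTy (2 + j) ⟧
  input = encodeInput (2 + j) Φ Ψ D

  computes : run (prog (proj₁ machine)) input ≡ encodeSchema schema
  computes = trans (proj₂ machine (encodeCNF (viaYZ {p = p} Ψ)) route-E refl (Closure.codes-≡ j E)) schema-≡

  size-input : size (inputTy (2 + j)) input ≤ 2 + 3 * proofSize (2 + j) D
  size-input = begin
    suc (size cnfTy (encodeCNF X) + suc (size cnfTy (encodeCNF Y) + N)) ≤⟨ s≤s (+-mono-≤ X≤ (s≤s (+-monoˡ-≤ N Y≤))) ⟩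
    suc (N + suc (N + N))  ≡⟨ cong suc (+-suc N (N + N)) ⟩
    2 + (N + (N + N))      ≡⟨ cong (λ m → 2 + (N + (N + m))) (sym (+-identityʳ N)) ⟩
    2 + 3 * N              ∎
    where
    open ≤-Reasoning
    N = proofSize (2 + j) D
    X = viaXZ {q = q} Φ
    Y = viaYZ {p = p} Ψ
    total : size cnfTy (encodeCNF (X ++ Y)) ≤ N
    total = ≤-trans (size-padded j (X ++ Y)) (size-∈ (FT (2 + j)) start-∈)
    X≤ : size cnfTy (encodeCNF X) ≤ N
    X≤ = ≤-trans (size-++ˡ (list litTy) (encodeCNF X) (encodeCNF Y))
           (≤-trans (≤-reflexive (cong (size cnfTy) (sym (map-++ (map encodeLiteral) X Y)))) total)
    Y≤ : size cnfTy (encodeCNF Y) ≤ N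
    Y≤ = ≤-trans (size-++ʳ (list litTy) (encodeCNF X) (encodeCNF Y))
           (≤-trans (≤-reflexive (cong (size cnfTy) (sym (map-++ (map encodeLiteral) X Y)))) total)

  module _ (a : Fin n → Bool) where

    open Players j n E′ valid label-e a
    open Interpolation j Φ Ψ zpos zneg a label-e refl using (clausesI; clausesII)

    ready : ∀ honesty → (∀ {C} → C ∈ Φ ∧ᶜ Ψ → ClauseOK {p} {q} honesty j C) →
            ∀ {C} → C ∈ start-formula → FirstRound.Scannable honesty j C × length C ≤ scans
    ready honesty ok C∈ = scannable-padded honesty j (Φ ∧ᶜ Ψ) ok C∈ ,
      m≤n⇒m≤1+n (length-∈-concat (∈-concat⁺′ C∈ start-∈))

    route : ∀ honesty → (∀ {C} → C ∈ Φ ∧ᶜ Ψ → ClauseOK {p} {q} honesty j C) →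
            FirstRound.Route honesty j scans (padE (2 + j) (neutral false)) E′
    route honesty ok = trail-route {p} {q} {n} j honesty (ready honesty ok) (s≤s z≤n) (proj₂ (proj₂ trail-exists))

    1≤E′ : 1 ≤ length E′
    1≤E′ = trail-length {p} {q} {n} j (s≤s z≤n) (proj₂ (proj₂ trail-exists))

    wins-I : Satisfiable Φ a → HasPositionalWinningStrategy I (schema ⟨ a ⟩)
    wins-I sat = byClauses (clausesI E′ valid sat)
      where
      byClauses : ∃[ xval ] (∀ {C} → C ∈ Φ ∧ᶜ Ψ → ClauseOK {p} {q} (PlayerI.honesty xval) j C) → HasPositionalWinningStrategy I (schema ⟨ a ⟩)
      byClauses (xval , ok) = winning I (PlayerI.honesty xval) (λ _ w → w) (PlayerI.val xval) (PlayerI.honest xval)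
        (route (PlayerI.honesty xval) ok) 1≤E′

    wins-II : Satisfiable Ψ a → HasPositionalWinningStrategy II (schema ⟨ a ⟩)
    wins-II sat = byClauses (clausesII E′ valid sat)
      where
      byClauses : ∃[ yval ] (∀ {C} → C ∈ Φ ∧ᶜ Ψ → ClauseOK {p} {q} (PlayerII.honesty yval) j C) → HasPositionalWinningStrategy II (schema ⟨ a ⟩)
      byClauses (yval , ok) = winning II (PlayerII.honesty yval) (λ _ w → w) (PlayerII.val yval) (PlayerII.honest yval)
        (route (PlayerII.honesty yval) ok) 1≤E′

theorem7p1 : (k : ℕ) (2≤k : 2 ≤ k) →
    Σ[ M ∈ Prog (inputTy k) schemaTy ] Σ[ d ∈ ℕ ]
    (∀ {p q n : ℕ} (Φ : CNF (Fin p ⊎ Fin n)) (Ψ : CNF (Fin q ⊎ Fin n)) →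
    ZPositive Φ → ZNegative Ψ →
    (D : List (Πˢ k (Var p q n))) → IsRefutation k 2≤k (Φ ∧ᶜ Ψ) D →
    Σ[ S ∈ Schema (k ∸ 1) n ]
    (run M (encodeInput k Φ Ψ D) ≡ encodeSchema S
    × cost M (encodeInput k Φ Ψ D) ≤ d * proofSize k D ^ d + d
    × schemaSize S ≤ d * proofSize k D ^ d + d
    × ((a : Fin n → Bool) →
    (Satisfiable Φ a → HasPositionalWinningStrategy I (S ⟨ a ⟩))
    × (Satisfiable Ψ a → HasPositionalWinningStrategy II (S ⟨ a ⟩)))))
theorem7p1 (suc (suc j)) (s≤s (s≤s z≤n)) = prog (proj₁ machine) , d , λ Φ Ψ zpos zneg D refutation →
  let module C = Construction j Φ Ψ zpos zneg D refutation
      cost≤ = bound C.input (proofSize (2 + j) D) C.size-input in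
  C.schema , C.computes , cost≤ ,
  -- The size of a result never exceeds the cost of computing it, so the cost bound is also a size
  -- bound.
  ≤-trans (≤-reflexive (cong (size schemaTy) (sym C.computes))) (≤-trans (size-run (prog (proj₁ machine)) C.input) cost≤) ,
  λ a → C.wins-I a , C.wins-II a
  where
  open Machine j using (machine)
  d = proj₁ (cost-bound (proj₁ machine))
  bound = proj₂ (cost-bound (proj₁ machine))
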